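{- Let $p$ be a prime, $X$ a nonempty totally ordered set, $S$ the free profinite group on $X$, and $n\geq 2$. Let $\mathrm{Lyn}_{\leq n}(X)$, the set of Lyndon words in $X$ of length $\leq n$, be totally ordered by $\preceq$. Then the matrix $$\Bigl((\tau_w^{p^{n-|w|}},\alpha_{w',n})_n\Bigr),$$ where $w,w'\in\mathrm{Lyn}_{\leq n}(X)$, is upper-triangular unipotent, i.e. its diagonal entries are $1$ and its $(w,w')$ entry is $0$ whenever $w'\prec w$.
   Context: For a profinite group $G$: $G^{(1,p)}=G$, $G^{(n+1,p)}=(G^{(n,p)})^p[G,G^{(n,p)}]$ (closed subgroup generated by all $h^p$ and $[g,h]=g^{ -1}h^{ -1}gh$, $g\in G$, $h\in G^{(n,p)}$), and $G^{[n,p]}=G/G^{(n,p)}$. Cohomology is profinite cohomology with trivial action on $\mathbb{Z}/p$. The free profinite group $S=S_X$ on basis $X$: $X\subseteq S$ generates $S$ topologically, the inclusion converges to $1$ (every open normal subgroup contains all but finitely many elements of $X$), and every map $X\to G$ to a profinite group converging to $1$ extends uniquely to a continuous homomorphism $S\to G$. $X^*$ is the free monoid of words in $X$; $|w|$ is the length of $w$. $w_1\leq_{\rm alp}w_2$ iff $w_2=w_1v$ for some $v\in X^*$, or $w_1=vx_1u_1$, $w_2=vx_2u_2$ with $v,u_1,u_2\in X^*$ and letters $x_1<x_2$. $w_1\preceq w_2$ iff $|w_1|<|w_2|$, or $|w_1|=|w_2|$ and $w_1\leq_{\rm alp}w_2$; $\prec$ is the strict version. A nonempty word is Lyndon if it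 is strictly smaller in $\leq_{\rm alp}$ than all its nontrivial proper suffixes. For a Lyndon word $w$ define $\tau_w\in S$ inductively: $\tau_{(x)}=x$ for $x\in X$; if $|w|>1$, let $w=w'w''$ be the standard factorization of $w$, i.e. $w''$ is the longest proper suffix of $w$ that is a Lyndon word (then $w'$ is Lyndon too), and $\tau_w=[\tau_{w'},\tau_{w''}]$. One has $\tau_w^{p^{n-|w|}}\in S^{(n,p)}$ for $|w|\le n$. For a profinite commutative ring $R$, $\Lambda_R\colon S\to R\langle\langle X\rangle\rangle^\times$ is the continuous (Magnus) homomorphism into the units of the ring of non-commuting formal power series with $\Lambda_R(x)=1+x$, $x\in X$; $\epsilon_{w,R}(\sigma)$ is the coefficient of $w$ in $\Lambda_R(\sigma)$. For $1\leq s\leq n$ let $\mathbb{U}=\mathbb{U}_{s+1}(\mathbb{Z}/p^{n-s+1})$ be the group of unipotent upper-triangular $(s+1)\times(s+1)$ matrices over $\mathbb{Z}/p^{n-s+1}$. It is known that $\mathbb{U}^{(n,p)}=I_{s+1}+\mathbb{Z}p^{n-s}E_{1,s+1}$ is central in $\mathbb{U}$; identify it with $\mathbb{Z}/p$ via $I_{s+1}+ap^{n-s}E_{1,s+1}\mapsto a\pmod p$. Let $\gamma_{n,s}\in H^2(\mathbb{U}^{[n,p]},\mathbb{Z}/p)$ be the class of the central extension $0\to\mathbb{Z}/p\to\mathbb{U}\to\mathbb{U}^{[n,p]}\to1$ (represented by the cocycle $\lambda(\bar u)\lambda(\bar u')\lambda(\bar u\bar u')^{ -1}$ for a section $\lambda$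 with $\lambda(1)=1$). For a word $w=(x_1\cdots x_s)$, let $\rho^w\colon S\to\mathbb{U}$ be the continuous homomorphism with $(i,j)$ entry $\epsilon_{(x_i\cdots x_{j-1}),\mathbb{Z}/p^{n-s+1}}(\sigma)$ for $i<j$, $\bar\rho^w\colon S^{[n,p]}\to\mathbb{U}^{[n,p]}$ the induced map, and $\alpha_{w,n}=(\bar\rho^w)^*\gamma_{n,s}\in H^2(S^{[n,p]},\mathbb{Z}/p)$. For $n\geq2$ the transgression $\mathrm{trg}\colon H^1(S^{(n,p)},\mathbb{Z}/p)^S\to H^2(S^{[n,p]},\mathbb{Z}/p)$ is an isomorphism; here $\mathrm{trg}([x])=[\partial y]$ for any continuous $1$-cochain $y$ on $S$ with $y|_{S^{(n,p)}}=x$ such that $(\partial y)(\sigma_1,\sigma_2)=y(\sigma_1)+y(\sigma_2)-y(\sigma_1\sigma_2)$ depends only on the cosets of $\sigma_1,\sigma_2$ modulo $S^{(n,p)}$. The bilinear map $(\cdot,\cdot)_n\colon S^{(n,p)}\times H^2(S^{[n,p]},\mathbb{Z}/p)\to\mathbb{Z}/p$ is $(\sigma,\alpha)_n=-(\mathrm{trg}^{ -1}(\alpha))(\sigma)$. -}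

module Defs where

open import Level using (0ℓ; _⊔_) renaming (suc to lsuc)
open import Algebra.Bundles using (Monoid; Group; CommutativeRing)
open import Algebra.Morphism.Structures using (IsGroupHomomorphism)
import Algebra.Definitions.RawMonoid as RawMonoidOps
import Algebra.Properties.Group as GroupProperties
import Algebra.Properties.Ring as RingProperties
import Algebra.Properties.Semiring.Sum as SemiringSum
open import Data.Bool.Base using (true; false; if_then_else_)
open import Data.Empty using (⊥-elim)
open import Data.Fin.Base using (Fin; zero; suc; toℕ; fromℕ; fromℕ<; funToFin; finToFun)
import Data.Fin.Base as Fin
import Data.Fin.Properties as Finₚ
open import Data.Integer.Base as ℤ using (ℤ; +_; 0ℤ; 1ℤ)
import Data.Integer.DivMod as ℤD
import Data.Integer.Properties as ℤₚ
open import Data.Integer.Divisibility.Signed as ℤ∣ using (_∣_; divides)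
open import Data.Integer.Tactic.RingSolver using (solve-∀)
open import Data.List.Base using (List; []; _∷_; [_]; _++_; length; take; drop)
import Data.List.Properties as Listₚ
open import Data.List.Membership.Propositional using (_∉_)
open import Data.List.Relation.Unary.Any using (here)
import Data.List.Relation.Unary.Any.Properties as Anyₚ
open import Data.List.Relation.Binary.Lex.Strict using (Lex-<; Lex-≤; <-decidable)
open import Data.Nat.Base as ℕ using (ℕ; zero; suc; NonZero; _≤ᵇ_; _∸_)
import Data.Nat.Properties as ℕₚ
import Data.Nat.Divisibility as ℕ∣
open import Data.Nat.Primality using (Prime; prime⇒nonZero)
open import Data.Product.Base using (Σ; Σ-syntax; ∃-syntax; _×_; _,_; proj₁; proj₂)
open import Data.Sum.Base using (_⊎_)
open import Data.Unit.Polymorphic.Base using (⊤; tt)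
open import Function.Base using (_∘_; id)
open import Function.Bundles using (Injection)
open import Relation.Binary.Bundles using (Setoid)
open import Relation.Binary.Core using (Rel)
open import Relation.Binary.Definitions using (tri<; tri≈; tri>)
open import Relation.Binary.PropositionalEquality as ≡ using (_≡_; _≢_)
open import Relation.Binary.Structures using (IsEquivalence; IsStrictTotalOrder)
import Relation.Binary.Reasoning.Setoid as SetoidReasoning
open import Relation.Nullary using (Dec; yes; no; ¬_; does)
open import Relation.Nullary.Decidable using (map′; _×-dec_)

-- "The element of A satisfying P satisfies Q": definite description.
The : ∀ {a ℓ p q} (A : Setoid a ℓ) → (Setoid.Carrier A → Set p) →
      (Setoid.Carrier A → Set q) → Set (a ⊔ ℓ ⊔ p ⊔ q)
The A P Q = ∃[ x ] P x × (∀ y → P y → y ≈ x) × Q x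
  where open Setoid A

-- Having an injection to some Fin k; constructively weaker than having a
-- bijection with some Fin k, classically the same.
Finite : ∀ {a ℓ} → Setoid a ℓ → Set (a ⊔ ℓ)
Finite A = ∃[ k ] Injection A (≡.setoid (Fin k))

infix 4 _≡_[mod_]

record _≡_[mod_] (a b : ℤ) (m : ℕ) : Set where
  constructor mod
  field m∣a-b : + m ∣ a ℤ.- b

module _ {m : ℕ} where

  abstract

    ≡⇒mod : ∀ {a b} → a ≡ b → a ≡ b [mod m ]
    ≡⇒mod {a} ≡.refl = mod (divides 0ℤ (ℤₚ.+-inverseʳ a))

    mod-sym : ∀ {a b} → a ≡ b [mod m ] → b ≡ a [mod m ]
    mod-sym {a} {b} (mod (divides q eq)) = mod (divides (ℤ.- q)
      (≡.trans (lemma₁ a b) (≡.trans (≡.cong ℤ.-_ eq) (lemma₂ q (+ m)))))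
      where
      lemma₁ : ∀ a b → b ℤ.- a ≡ ℤ.- (a ℤ.- b)
      lemma₁ = solve-∀
      lemma₂ : ∀ q m → ℤ.- (q ℤ.* m) ≡ (ℤ.- q) ℤ.* m
      lemma₂ = solve-∀

    mod-trans : ∀ {a b c} → a ≡ b [mod m ] → b ≡ c [mod m ] → a ≡ c [mod m ]
    mod-trans {a} {b} {c} (mod (divides q eq)) (mod (divides r eq′)) = mod (divides (q ℤ.+ r)
      (≡.trans (lemma₁ a b c) (≡.trans (≡.cong₂ ℤ._+_ eq eq′) (lemma₂ q r (+ m)))))
      where
      lemma₁ : ∀ a b c → a ℤ.- c ≡ (a ℤ.- b) ℤ.+ (b ℤ.- c)
      lemma₁ = solve-∀
      lemma₂ : ∀ q r m → q ℤ.* m ℤ.+ r ℤ.* m ≡ (q ℤ.+ r) ℤ.* m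
      lemma₂ = solve-∀

    mod-+-cong : ∀ {a b c d} → a ≡ b [mod m ] → c ≡ d [mod m ] →
                 a ℤ.+ c ≡ b ℤ.+ d [mod m ]
    mod-+-cong {a} {b} {c} {d} (mod (divides q eq)) (mod (divides r eq′)) = mod (divides (q ℤ.+ r)
      (≡.trans (lemma₁ a b c d) (≡.trans (≡.cong₂ ℤ._+_ eq eq′) (lemma₂ q r (+ m)))))
      where
      lemma₁ : ∀ a b c d → (a ℤ.+ c) ℤ.- (b ℤ.+ d) ≡ (a ℤ.- b) ℤ.+ (c ℤ.- d)
      lemma₁ = solve-∀
      lemma₂ : ∀ q r m → q ℤ.* m ℤ.+ r ℤ.* m ≡ (q ℤ.+ r) ℤ.* m
      lemma₂ = solve-∀

    mod-*-cong : ∀ {a b c d} → a ≡ b [mod m ] → c ≡ d [mod m ] →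
                 a ℤ.* c ≡ b ℤ.* d [mod m ]
    mod-*-cong {a} {b} {c} {d} (mod (divides q eq)) (mod (divides r eq′)) =
      mod (divides (q ℤ.* c ℤ.+ b ℤ.* r)
      (≡.trans (lemma₁ a b c d)
        (≡.trans (≡.cong₂ (λ x y → x ℤ.* c ℤ.+ b ℤ.* y) eq eq′) (lemma₂ q r b c (+ m)))))
      where
      lemma₁ : ∀ a b c d → (a ℤ.* c) ℤ.- (b ℤ.* d) ≡ (a ℤ.- b) ℤ.* c ℤ.+ b ℤ.* (c ℤ.- d)
      lemma₁ = solve-∀
      lemma₂ : ∀ q r b c m → q ℤ.* m ℤ.* c ℤ.+ b ℤ.* (r ℤ.* m) ≡ (q ℤ.* c ℤ.+ b ℤ.* r) ℤ.* m
      lemma₂ = solve-∀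

    mod-neg-cong : ∀ {a b} → a ≡ b [mod m ] → ℤ.- a ≡ ℤ.- b [mod m ]
    mod-neg-cong {a} {b} (mod (divides q eq)) = mod (divides (ℤ.- q)
      (≡.trans (lemma₁ a b) (≡.trans (≡.cong ℤ.-_ eq) (lemma₂ q (+ m)))))
      where
      lemma₁ : ∀ a b → (ℤ.- a) ℤ.- (ℤ.- b) ≡ ℤ.- (a ℤ.- b)
      lemma₁ = solve-∀
      lemma₂ : ∀ q m → ℤ.- (q ℤ.* m) ≡ (ℤ.- q) ℤ.* m
      lemma₂ = solve-∀

ℤ/_ : ℕ → CommutativeRing 0ℓ 0ℓ
ℤ/ m = record
  { Carrier = ℤ
  ; _≈_ = λ a b → a ≡ b [mod m ]
  ; _+_ = ℤ._+_
  ; _*_ = ℤ._*_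
  ; -_ = ℤ.-_
  ; 0# = 0ℤ
  ; 1# = 1ℤ
  ; isCommutativeRing = record
    { isRing = record
      { +-isAbelianGroup = record
        { isGroup = record
          { isMonoid = record
            { isSemigroup = record
              { isMagma = record
                { isEquivalence = record
                  { refl = ≡⇒mod ≡.refl ; sym = mod-sym ; trans = mod-trans }
                ; ∙-cong = mod-+-cong
                }
              ; assoc = λ a b c → ≡⇒mod (ℤₚ.+-assoc a b c)
              }
            ; identity = (λ a → ≡⇒mod (ℤₚ.+-identityˡ a)) , (λ a → ≡⇒mod (ℤₚ.+-identityʳ a))
            }
          ; inverse = (λ a → ≡⇒mod (ℤₚ.+-inverseˡ a)) , (λ a → ≡⇒mod (ℤₚ.+-inverseʳ a))
          ; ⁻¹-cong = mod-neg-cong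
          }
        ; comm = λ a b → ≡⇒mod (ℤₚ.+-comm a b)
        }
      ; *-cong = mod-*-cong
      ; *-assoc = λ a b c → ≡⇒mod (ℤₚ.*-assoc a b c)
      ; *-identity = (λ a → ≡⇒mod (ℤₚ.*-identityˡ a)) , (λ a → ≡⇒mod (ℤₚ.*-identityʳ a))
      ; distrib = (λ a b c → ≡⇒mod (ℤₚ.*-distribˡ-+ a b c)) , (λ a b c → ≡⇒mod (ℤₚ.*-distribʳ-+ a b c))
      }
    ; *-comm = λ a b → ≡⇒mod (ℤₚ.*-comm a b)
    }
  }

module _ (m : ℕ) .{{_ : NonZero m}} where

  residue : ℤ → Fin m
  residue a = fromℕ< (ℤD.n%ℕd<d a m)

  mod-residue : ∀ a → a ≡ + (toℕ (residue a)) [mod m ]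
  mod-residue a = mod (divides (a ℤD./ℕ m) (≡.trans
    (≡.cong₂ ℤ._-_ (ℤD.a≡a%ℕn+[a/ℕn]*n a m) (≡.cong +_ (Finₚ.toℕ-fromℕ< (ℤD.n%ℕd<d a m))))
    (lemma (+ (a ℤD.%ℕ m)) (a ℤD./ℕ m ℤ.* + m))))
    where
    lemma : ∀ r s → (r ℤ.+ s) ℤ.- r ≡ s
    lemma = solve-∀

  fin-mod-injective : (i j : Fin m) → + (toℕ i) ≡ + (toℕ j) [mod m ] → i ≡ j
  fin-mod-injective i j i≡j = Finₚ.toℕ-injective (ℤₚ.+-injective (ℤₚ.i-j≡0⇒i≡j _ _
    (ℤₚ.∣i∣≡0⇒i≡0 (small (ℤ∣.∣⇒∣ᵤ (m∣a-b i≡j)) bound))))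
    where
    open _≡_[mod_]
    bound : ℤ.∣ + (toℕ i) ℤ.- + (toℕ j) ∣ ℕ.< m
    bound = ≡.subst (ℕ._< m) (≡.cong ℤ.∣_∣ (≡.sym (ℤₚ.m-n≡m⊖n (toℕ i) (toℕ j))))
      (ℕₚ.≤-<-trans (ℤₚ.∣m⊝n∣≤m⊔n (toℕ i) (toℕ j))
        (ℕₚ.⊔-lub (Finₚ.toℕ<n i) (Finₚ.toℕ<n j)))
    small : ∀ {k} → m ℕ∣.∣ k → k ℕ.< m → k ≡ 0
    small {zero} _ _ = ≡.refl
    small {suc k} m∣k k<m = ⊥-elim (ℕ∣.>⇒∤ k<m m∣k)

  ℤ/-finite : Finite (CommutativeRing.setoid (ℤ/ m))
  ℤ/-finite = m , record
    { to = residue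
    ; cong = λ {a} {b} a≡b → fin-mod-injective _ _
        (mod-trans (mod-sym (mod-residue a)) (mod-trans a≡b (mod-residue b)))
    ; injective = λ {a} {b} eq →
        mod-trans (mod-residue a) (mod-trans (≡⇒mod (≡.cong (+_ ∘ toℕ) eq)) (mod-sym (mod-residue b)))
    }

module _ {c ℓ} (G : Group c ℓ) where
  open Group G

  power : Carrier → ℕ → Carrier
  power g n = RawMonoidOps._×_ rawMonoid n g

  commutator : Carrier → Carrier → Carrier
  commutator g h = g ⁻¹ ∙ h ⁻¹ ∙ g ∙ h

  data Generated {q} (Q : Carrier → Set q) : Carrier → Set (c ⊔ ℓ ⊔ q) where
    gen  : ∀ {g} → Q g → Generated Q g
    unit : Generated Q ε
    mul  : ∀ {g h} → Generated Q g → Generated Q h → Generated Q (g ∙ h)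
    inv  : ∀ {g} → Generated Q g → Generated Q (g ⁻¹)
    resp : ∀ {g h} → g ≈ h → Generated Q g → Generated Q h

-- A group whose topology has a basis of neighbourhoods of 1 consisting
-- of open normal subgroups, indexed by Nbhd.  The i-th subgroup N enters
-- through its congruence: g ≈[ i ] h means gN = hN, so the sets
-- { h ∣ g ≈[ i ] h } form a basis of the topology.
record TopGroup ℓ : Set (lsuc ℓ) where
  no-eta-equality
  infix 4 _≈[_]_
  field
    group : Group ℓ ℓ
  open Group group public
  field
    Nbhd              : Set ℓ
    someNbhd          : Nbhd
    _≈[_]_            : Carrier → Nbhd → Carrier → Set ℓ
    ≈[]-isEquivalence : ∀ i → IsEquivalence (λ g h → g ≈[ i ] h)
    ≈⇒≈[]             : ∀ {i g h} → g ≈ h → g ≈[ i ] h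
    ∙-cong[]          : ∀ {i g g′ h h′} → g ≈[ i ] g′ → h ≈[ i ] h′ → g ∙ h ≈[ i ] g′ ∙ h′
    directed          : ∀ i j → ∃[ k ] (∀ {g h} → g ≈[ k ] h → g ≈[ i ] h × g ≈[ j ] h)

  module _ {i : Nbhd} where
    open IsEquivalence (≈[]-isEquivalence i) public
      using () renaming (refl to ≈[]-refl; sym to ≈[]-sym; trans to ≈[]-trans)

  coset-setoid : Nbhd → Setoid ℓ ℓ
  coset-setoid i = record { isEquivalence = ≈[]-isEquivalence i }

  ⁻¹-cong[] : ∀ {i g h} → g ≈[ i ] h → g ⁻¹ ≈[ i ] h ⁻¹
  ⁻¹-cong[] {i} {g} {h} g≈h = begin
    g ⁻¹             ≈⟨ ≈⇒≈[] (identityʳ _) ⟨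
    g ⁻¹ ∙ ε         ≈⟨ ≈⇒≈[] (∙-congˡ (inverseʳ h)) ⟨
    g ⁻¹ ∙ (h ∙ h ⁻¹) ≈⟨ ≈⇒≈[] (assoc _ _ _) ⟨
    g ⁻¹ ∙ h ∙ h ⁻¹  ≈⟨ ∙-cong[] (∙-cong[] ≈[]-refl g≈h) ≈[]-refl ⟨
    g ⁻¹ ∙ g ∙ h ⁻¹  ≈⟨ ≈⇒≈[] (∙-congʳ (inverseˡ g)) ⟩
    ε ∙ h ⁻¹         ≈⟨ ≈⇒≈[] (identityˡ _) ⟩
    h ⁻¹             ∎
    where open SetoidReasoning (coset-setoid i)

-- An inverse limit of finite groups: Hausdorff, complete, and with a basis
-- of open normal subgroups of finite index.
record ProfiniteGroup ℓ : Set (lsuc ℓ) where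
  field
    topGroup : TopGroup ℓ
  open TopGroup topGroup public
  field
    separated : ∀ {g h} → (∀ i → g ≈[ i ] h) → g ≈ h
    finite    : ∀ i → Finite (coset-setoid i)
    complete  : (g : Nbhd → Carrier) →
                (∀ i j → (∀ {a b} → a ≈[ j ] b → a ≈[ i ] b) → g j ≈[ i ] g i) →
                ∃[ a ] (∀ i → a ≈[ i ] g i)

record ContinuousHom {a b} (G : TopGroup a) (H : TopGroup b) : Set (a ⊔ b) where
  private
    module G = TopGroup G
    module H = TopGroup H
  field
    ⟦_⟧        : G.Carrier → H.Carrier
    isHom      : IsGroupHomomorphism G.rawGroup H.rawGroup ⟦_⟧
    continuous : ∀ g j → ∃[ i ] (∀ {h} → g G.≈[ i ] h → ⟦ g ⟧ H.≈[ j ] ⟦ h ⟧)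
  open IsGroupHomomorphism isHom public

discrete : ∀ {ℓ} → Group ℓ ℓ → TopGroup ℓ
discrete G = record
  { group = G
  ; Nbhd = ⊤
  ; someNbhd = tt
  ; _≈[_]_ = λ g _ h → g ≈ h
  ; ≈[]-isEquivalence = λ _ → isEquivalence
  ; ≈⇒≈[] = id
  ; ∙-cong[] = ∙-cong
  ; directed = λ _ _ → tt , λ g≈h → g≈h , g≈h
  }
  where open Group G

module _ {ℓ} (G : TopGroup ℓ) where
  open TopGroup G

  Closure : (Carrier → Set ℓ) → Carrier → Set ℓ
  Closure Q g = ∀ i → ∃[ h ] Q h × g ≈[ i ] h

  ClosedSubgroupGenerated : (Carrier → Set ℓ) → Carrier → Set ℓ
  ClosedSubgroupGenerated Q = Closure (Generated group Q)

  module _ (p : ℕ) where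

    data PowerOrCommutator (H : Carrier → Set ℓ) : Carrier → Set ℓ where
      pth-power : ∀ {h} → H h → PowerOrCommutator H (power group h p)
      comm      : ∀ g {h} → H h → PowerOrCommutator H (commutator group g h)

    -- G^(n,p); the value at n = 0 is irrelevant.
    lowerCentral : ℕ → Carrier → Set ℓ
    lowerCentral zero          _ = ⊤
    lowerCentral (suc zero)    _ = ⊤
    lowerCentral (suc (suc n))   =
      ClosedSubgroupGenerated (PowerOrCommutator (lowerCentral (suc n)))

  record IsNormalSubgroup (N : Carrier → Set ℓ) : Set ℓ where
    field
      N-resp : ∀ {g h} → g ≈ h → N g → N h
      N-ε    : N ε
      N-∙    : ∀ {g h} → N g → N h → N (g ∙ h)
      N-⁻¹   : ∀ {g} → N g → N (g ⁻¹)
      N-conj : ∀ g {h} → N h → N (g ⁻¹ ∙ h ∙ g)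

module _ {a b} {G : TopGroup a} {H : TopGroup b} (φ : ContinuousHom G H) (p : ℕ) where
  private
    module G = TopGroup G
    module H = TopGroup H
  open ContinuousHom φ

  power-homo : ∀ g n → ⟦ power G.group g n ⟧ H.≈ power H.group ⟦ g ⟧ n
  power-homo g zero    = ε-homo
  power-homo g (suc n) = H.trans (homo _ _) (H.∙-congˡ (power-homo g n))

  commutator-homo : ∀ g h →
    ⟦ commutator G.group g h ⟧ H.≈ commutator H.group ⟦ g ⟧ ⟦ h ⟧
  commutator-homo g h = H.trans (homo _ _) (H.∙-congʳ (H.trans (homo _ _) (H.∙-congʳ
    (H.trans (homo _ _) (H.∙-cong (⁻¹-homo _) (⁻¹-homo _))))))

  generated-map : ∀ {q r} {Q : G.Carrier → Set q} {R : H.Carrier → Set r} →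
    (∀ {g} → Q g → Generated H.group R ⟦ g ⟧) →
    ∀ {g} → Generated G.group Q g → Generated H.group R ⟦ g ⟧
  generated-map f (gen q)     = f q
  generated-map f unit        = resp (H.sym ε-homo) unit
  generated-map f (mul s t)   = resp (H.sym (homo _ _)) (mul (generated-map f s) (generated-map f t))
  generated-map f (inv s)     = resp (H.sym (⁻¹-homo _)) (inv (generated-map f s))
  generated-map f (resp eq s) = resp (⟦⟧-cong eq) (generated-map f s)

  generator-map : ∀ {Q R} → (∀ {h} → Q h → R ⟦ h ⟧) →
    ∀ {g} → PowerOrCommutator G p Q g → Generated H.group (PowerOrCommutator H p R) ⟦ g ⟧
  generator-map f (pth-power {h} h∈) = resp (H.sym (power-homo h p)) (gen (pth-power (f h∈)))
  generator-map f (comm g {h} h∈)    = resp (H.sym (commutator-homo g h)) (gen (comm ⟦ g ⟧ (f h∈)))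

  lowerCentral-map : ∀ n {g} → lowerCentral G p n g → lowerCentral H p n ⟦ g ⟧
  lowerCentral-map zero          _ = tt
  lowerCentral-map (suc zero)    _ = tt
  lowerCentral-map (suc (suc n)) {g} g∈ j =
    let i , near = continuous g j
        h , h∈ , g≈h = g∈ i
    in ⟦ h ⟧ , generated-map (generator-map (lowerCentral-map (suc n))) h∈ , near g≈h

module _ {ℓ} (G : TopGroup ℓ) where
  open TopGroup G
  open GroupProperties group
  open SetoidReasoning setoid

  conjugation : Carrier → ContinuousHom G G
  conjugation g = record
    { ⟦_⟧ = λ h → g ⁻¹ ∙ h ∙ g
    ; isHom = record
      { isMonoidHomomorphism = record
        { isMagmaHomomorphism = record
          { isRelHomomorphism = record { cong = λ h≈k → ∙-congʳ (∙-congˡ h≈k) }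
          ; homo = homo
          }
        ; ε-homo = trans (∙-congʳ (identityʳ _)) (inverseˡ g)
        }
      ; ⁻¹-homo = λ h → begin
          g ⁻¹ ∙ h ⁻¹ ∙ g                ≈⟨ assoc _ _ _ ⟩
          g ⁻¹ ∙ (h ⁻¹ ∙ g)              ≈⟨ ∙-congˡ (∙-congˡ (⁻¹-involutive g)) ⟨
          g ⁻¹ ∙ (h ⁻¹ ∙ (g ⁻¹) ⁻¹)      ≈⟨ ∙-congˡ (⁻¹-anti-homo-∙ _ _) ⟨
          g ⁻¹ ∙ (g ⁻¹ ∙ h) ⁻¹           ≈⟨ ⁻¹-anti-homo-∙ _ _ ⟨
          (g ⁻¹ ∙ h ∙ g) ⁻¹              ∎
      }
    ; continuous = λ h j → j , λ h≈k → ∙-cong[] (∙-cong[] ≈[]-refl h≈k) ≈[]-refl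
    }
    where
    homo : ∀ h k → g ⁻¹ ∙ (h ∙ k) ∙ g ≈ (g ⁻¹ ∙ h ∙ g) ∙ (g ⁻¹ ∙ k ∙ g)
    homo h k = begin
      g ⁻¹ ∙ (h ∙ k) ∙ g                    ≈⟨ ∙-congʳ (assoc _ _ _) ⟨
      g ⁻¹ ∙ h ∙ k ∙ g                      ≈⟨ assoc _ _ _ ⟩
      g ⁻¹ ∙ h ∙ (k ∙ g)                    ≈⟨ ∙-congˡ (\\-leftDividesˡ g (k ∙ g)) ⟨
      g ⁻¹ ∙ h ∙ (g ∙ (g ⁻¹ ∙ (k ∙ g)))     ≈⟨ assoc _ _ _ ⟨
      g ⁻¹ ∙ h ∙ g ∙ (g ⁻¹ ∙ (k ∙ g))       ≈⟨ ∙-congˡ (assoc _ _ _) ⟨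
      g ⁻¹ ∙ h ∙ g ∙ (g ⁻¹ ∙ k ∙ g)         ∎

  lowerCentral-isNormal : ∀ p n → IsNormalSubgroup G (lowerCentral G p n)
  lowerCentral-isNormal p n = record
    { N-resp = N-resp n
    ; N-ε    = N-ε n
    ; N-∙    = N-∙ n
    ; N-⁻¹   = N-⁻¹ n
    ; N-conj = λ g → lowerCentral-map (conjugation g) p n
    }
    where
    N : ℕ → Carrier → Set ℓ
    N = lowerCentral G p
    N-resp : ∀ n {g h} → g ≈ h → N n g → N n h
    N-resp zero          _ _ = tt
    N-resp (suc zero)    _ _ = tt
    N-resp (suc (suc n)) g≈h g∈ i =
      let k , k∈ , g≈k = g∈ i in k , k∈ , ≈[]-trans (≈⇒≈[] (sym g≈h)) g≈k
    N-ε : ∀ n → N n ε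
    N-ε zero            = tt
    N-ε (suc zero)      = tt
    N-ε (suc (suc n)) i = ε , unit , ≈[]-refl
    N-∙ : ∀ n {g h} → N n g → N n h → N n (g ∙ h)
    N-∙ zero          _ _ = tt
    N-∙ (suc zero)    _ _ = tt
    N-∙ (suc (suc n)) g∈ h∈ i =
      let k , k∈ , g≈k = g∈ i
          l , l∈ , h≈l = h∈ i
      in k ∙ l , mul k∈ l∈ , ∙-cong[] g≈k h≈l
    N-⁻¹ : ∀ n {g} → N n g → N n (g ⁻¹)
    N-⁻¹ zero          _ = tt
    N-⁻¹ (suc zero)    _ = tt
    N-⁻¹ (suc (suc n)) g∈ i =
      let k , k∈ , g≈k = g∈ i in k ⁻¹ , inv k∈ , ⁻¹-cong[] g≈k

  module _ {N : Carrier → Set ℓ} (isNormal : IsNormalSubgroup G N) where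
    open IsNormalSubgroup isNormal

    infix 4 _∼_

    _∼_ : Rel Carrier ℓ
    g ∼ h = N (g ⁻¹ ∙ h)

    ≈⇒∼ : ∀ {g h} → g ≈ h → g ∼ h
    ≈⇒∼ {g} {h} g≈h = N-resp (trans (sym (inverseˡ g)) (∙-congˡ g≈h)) N-ε

    -- G/N with the quotient topology: the basic open subgroups are the
    -- images of those of G.
    quotient : TopGroup ℓ
    quotient = record
      { group = record
        { Carrier = Carrier
        ; _≈_ = _∼_
        ; _∙_ = _∙_
        ; ε = ε
        ; _⁻¹ = _⁻¹
        ; isGroup = record
          { isMonoid = record
            { isSemigroup = record
              { isMagma = record
                { isEquivalence = record
                  { refl = ≈⇒∼ refl ; sym = ∼-sym ; trans = ∼-trans }
                ; ∙-cong = ∼-∙-cong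
                }
              ; assoc = λ g h k → ≈⇒∼ (assoc g h k)
              }
            ; identity = (λ g → ≈⇒∼ (identityˡ g)) , (λ g → ≈⇒∼ (identityʳ g))
            }
          ; inverse = (λ g → ≈⇒∼ (inverseˡ g)) , (λ g → ≈⇒∼ (inverseʳ g))
          ; ⁻¹-cong = ∼-⁻¹-cong
          }
        }
      ; Nbhd = Nbhd
      ; someNbhd = someNbhd
      ; _≈[_]_ = λ g i h → ∃[ k ] N k × g ∙ k ≈[ i ] h
      ; ≈[]-isEquivalence = λ i → record
        { refl  = ε , N-ε , ≈⇒≈[] (identityʳ _)
        ; sym   = λ (k , k∈ , gk≈h) → k ⁻¹ , N-⁻¹ k∈ ,
            ≈[]-trans (∙-cong[] (≈[]-sym gk≈h) ≈[]-refl) (≈⇒≈[] (//-rightDividesʳ k _))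
        ; trans = λ (k , k∈ , gk≈h) (l , l∈ , hl≈m) → k ∙ l , N-∙ k∈ l∈ ,
            ≈[]-trans (≈⇒≈[] (sym (assoc _ _ _))) (≈[]-trans (∙-cong[] gk≈h ≈[]-refl) hl≈m)
        }
      ; ≈⇒≈[] = λ {i} {g} {h} g∼h → g ⁻¹ ∙ h , g∼h , ≈⇒≈[] (\\-leftDividesˡ g h)
      ; ∙-cong[] = λ {i} {g} {g′} {h} {h′} (k , k∈ , gk≈g′) (l , l∈ , hl≈h′) →
          h ⁻¹ ∙ k ∙ h ∙ l , N-∙ (N-conj h k∈) l∈ ,
          ≈[]-trans (≈⇒≈[] (shuffle g h k l)) (∙-cong[] gk≈g′ hl≈h′)
      ; directed = λ i j →
          let k , k≤ = directed i j
          in k , λ (l , l∈ , gl≈h) →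
               (l , l∈ , proj₁ (k≤ gl≈h)) , (l , l∈ , proj₂ (k≤ gl≈h))
      }
      where
      ∼-sym : ∀ {g h} → g ∼ h → h ∼ g
      ∼-sym {g} {h} g∼h = N-resp (⁻¹-anti-homo-\\ g h) (N-⁻¹ g∼h)
      ∼-trans : ∀ {g h k} → g ∼ h → h ∼ k → g ∼ k
      ∼-trans {g} {h} {k} g∼h h∼k = N-resp
        (trans (assoc _ _ _) (∙-congˡ (\\-leftDividesˡ h k))) (N-∙ g∼h h∼k)
      ∼-∙-cong : ∀ {g g′ h h′} → g ∼ g′ → h ∼ h′ → g ∙ h ∼ g′ ∙ h′
      ∼-∙-cong {g} {g′} {h} {h′} g∼g′ h∼h′ = N-resp eq (N-∙ (N-conj h g∼g′) h∼h′)
        where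
        eq : h ⁻¹ ∙ (g ⁻¹ ∙ g′) ∙ h ∙ (h ⁻¹ ∙ h′) ≈ (g ∙ h) ⁻¹ ∙ (g′ ∙ h′)
        eq = begin
          h ⁻¹ ∙ (g ⁻¹ ∙ g′) ∙ h ∙ (h ⁻¹ ∙ h′)   ≈⟨ assoc _ _ _ ⟩
          h ⁻¹ ∙ (g ⁻¹ ∙ g′) ∙ (h ∙ (h ⁻¹ ∙ h′)) ≈⟨ ∙-cong (sym (assoc _ _ _)) (\\-leftDividesˡ h h′) ⟩
          h ⁻¹ ∙ g ⁻¹ ∙ g′ ∙ h′                  ≈⟨ assoc _ _ _ ⟩
          h ⁻¹ ∙ g ⁻¹ ∙ (g′ ∙ h′)                ≈⟨ ∙-congʳ (⁻¹-anti-homo-∙ g h) ⟨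
          (g ∙ h) ⁻¹ ∙ (g′ ∙ h′)                 ∎
      ∼-⁻¹-cong : ∀ {g h} → g ∼ h → g ⁻¹ ∼ h ⁻¹
      ∼-⁻¹-cong {g} {h} g∼h = N-resp eq (N-conj (g ⁻¹) (∼-sym g∼h))
        where
        eq : (g ⁻¹) ⁻¹ ∙ (h ⁻¹ ∙ g) ∙ g ⁻¹ ≈ (g ⁻¹) ⁻¹ ∙ h ⁻¹
        eq = trans (assoc _ _ _) (∙-congˡ (//-rightDividesʳ g (h ⁻¹)))
      shuffle : ∀ g h k l → g ∙ h ∙ (h ⁻¹ ∙ k ∙ h ∙ l) ≈ g ∙ k ∙ (h ∙ l)
      shuffle g h k l = begin
        g ∙ h ∙ (h ⁻¹ ∙ k ∙ h ∙ l)      ≈⟨ assoc _ _ _ ⟩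
        g ∙ (h ∙ (h ⁻¹ ∙ k ∙ h ∙ l))    ≈⟨ ∙-congˡ (∙-congˡ (trans (assoc _ _ _) (assoc _ _ _))) ⟩
        g ∙ (h ∙ (h ⁻¹ ∙ (k ∙ (h ∙ l)))) ≈⟨ ∙-congˡ (\\-leftDividesˡ h _) ⟩
        g ∙ (k ∙ (h ∙ l))               ≈⟨ assoc _ _ _ ⟨
        g ∙ k ∙ (h ∙ l)                 ∎

-- G^[n,p]
_/lowerCentral[_,_] : ∀ {ℓ} → TopGroup ℓ → ℕ → ℕ → TopGroup ℓ
G /lowerCentral[ n , p ] = quotient G (lowerCentral-isNormal G p n)

induced : ∀ {a b} {G : TopGroup a} {H : TopGroup b} → ContinuousHom G H →
          ∀ n p → ContinuousHom (G /lowerCentral[ n , p ]) (H /lowerCentral[ n , p ])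
induced {G = G} {H} φ n p = record
  { ⟦_⟧ = ⟦_⟧
  ; isHom = record
    { isMonoidHomomorphism = record
      { isMagmaHomomorphism = record
        { isRelHomomorphism = record
          { cong = λ {g} {h} g∼h → N-resp (H.trans (homo _ _) (H.∙-congʳ (⁻¹-homo _)))
                                     (lowerCentral-map φ p n g∼h) }
        ; homo = λ g h → ≈⇒∼ H isNormal (homo g h)
        }
      ; ε-homo = ≈⇒∼ H isNormal ε-homo
      }
    ; ⁻¹-homo = λ g → ≈⇒∼ H isNormal (⁻¹-homo g)
    }
  ; continuous = λ g j →
      let i , near = continuous g j
      in i , λ {h} (k , k∈ , gk≈h) → ⟦ k ⟧ , lowerCentral-map φ p n k∈ ,
               H.≈[]-trans
                 (H.∙-cong[] (near (G.≈[]-trans (G.≈⇒≈[] (G.sym (//-rightDividesʳ k g)))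
                   (G.∙-cong[] gk≈h G.≈[]-refl))) H.≈[]-refl)
                 (H.≈⇒≈[] (H.trans (H.sym (homo _ _)) (⟦⟧-cong (//-rightDividesˡ k h))))
  }
  where
  module G = TopGroup G
  module H = TopGroup H
  isNormal = lowerCentral-isNormal H p n
  open ContinuousHom φ
  open IsNormalSubgroup isNormal
  open GroupProperties G.group

module _ {ℓ} (G : TopGroup ℓ) (p : ℕ) where
  open TopGroup G

  IsCochain¹ : (Carrier → ℤ) → Set ℓ
  IsCochain¹ y = ∀ g → ∃[ i ] (∀ {h} → g ≈[ i ] h → y g ≡ y h [mod p ])

  coboundary : (Carrier → ℤ) → Carrier → Carrier → ℤ
  coboundary y g h = y g ℤ.+ y h ℤ.- y (g ∙ h)

  record Cocycle² : Set ℓ where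
    field
      fun        : Carrier → Carrier → ℤ
      continuous : ∀ g h → ∃[ i ] (∀ {g′ h′} → g ≈[ i ] g′ → h ≈[ i ] h′ →
                                   fun g h ≡ fun g′ h′ [mod p ])
      cocycle    : ∀ g h k → fun h k ℤ.+ fun g (h ∙ k) ≡ fun (g ∙ h) k ℤ.+ fun g h [mod p ]

  open Cocycle²

  record Cohomologous (c c′ : Cocycle²) : Set ℓ where
    field
      cochain    : Carrier → ℤ
      continuous : IsCochain¹ cochain
      difference : ∀ g h → fun c g h ℤ.- fun c′ g h ≡ coboundary cochain g h [mod p ]

  H² : Setoid ℓ ℓ
  H² = record
    { Carrier = Cocycle²
    ; _≈_ = Cohomologous
    ; isEquivalence = record { refl = c-refl ; sym = c-sym ; trans = c-trans }
    }
    where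
    open Cohomologous
    c-refl : ∀ {c} → Cohomologous c c
    c-refl {c} = record
      { cochain = λ _ → 0ℤ
      ; continuous = λ g → someNbhd , λ _ → ≡⇒mod ≡.refl
      ; difference = λ g h → ≡⇒mod (ℤₚ.+-inverseʳ (fun c g h))
      }
    c-sym : ∀ {c d} → Cohomologous c d → Cohomologous d c
    c-sym {c} {d} c~d = record
      { cochain = λ g → ℤ.- cochain c~d g
      ; continuous = λ g → let i , near = continuous c~d g in i , λ g≈h → mod-neg-cong (near g≈h)
      ; difference = λ g h → mod-trans (≡⇒mod (lemma₁ (fun c g h) (fun d g h)))
          (mod-trans (mod-neg-cong (difference c~d g h))
            (≡⇒mod (lemma₂ (cochain c~d g) (cochain c~d h) (cochain c~d (g ∙ h)))))
      }
      where
      lemma₁ : ∀ a b → b ℤ.- a ≡ ℤ.- (a ℤ.- b)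
      lemma₁ = solve-∀
      lemma₂ : ∀ a b c → ℤ.- (a ℤ.+ b ℤ.- c) ≡ ℤ.- a ℤ.+ (ℤ.- b) ℤ.- (ℤ.- c)
      lemma₂ = solve-∀
    c-trans : ∀ {c d e} → Cohomologous c d → Cohomologous d e → Cohomologous c e
    c-trans {c} {d} {e} c~d d~e = record
      { cochain = λ g → cochain c~d g ℤ.+ cochain d~e g
      ; continuous = λ g →
          let i , near₁ = continuous c~d g
              j , near₂ = continuous d~e g
              k , k≤    = directed i j
          in k , λ g≈h → mod-+-cong (near₁ (proj₁ (k≤ g≈h))) (near₂ (proj₂ (k≤ g≈h)))
      ; difference = λ g h → mod-trans (≡⇒mod (lemma₁ (fun c g h) (fun d g h) (fun e g h)))
          (mod-trans (mod-+-cong (difference c~d g h) (difference d~e g h))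
            (≡⇒mod (lemma₂ (cochain c~d g) (cochain c~d h) (cochain c~d (g ∙ h))
                           (cochain d~e g) (cochain d~e h) (cochain d~e (g ∙ h)))))
      }
      where
      lemma₁ : ∀ a b c → a ℤ.- c ≡ (a ℤ.- b) ℤ.+ (b ℤ.- c)
      lemma₁ = solve-∀
      lemma₂ : ∀ a b c x y z → (a ℤ.+ b ℤ.- c) ℤ.+ (x ℤ.+ y ℤ.- z) ≡
                               (a ℤ.+ x) ℤ.+ (b ℤ.+ y) ℤ.- (c ℤ.+ z)
      lemma₂ = solve-∀

  -- An element of H¹(N,ℤ/p)^G: since the action on ℤ/p is trivial, a
  -- continuous homomorphism N → ℤ/p invariant under conjugation by G.
  record InvariantHom (N : Carrier → Set ℓ) : Set ℓ where
    field
      fun        : ∀ g → N g → ℤ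
      continuous : ∀ {g} (g∈ : N g) →
                   ∃[ i ] (∀ {h} (h∈ : N h) → g ≈[ i ] h → fun g g∈ ≡ fun h h∈ [mod p ])
      homo       : ∀ {g h} (g∈ : N g) (h∈ : N h) (gh∈ : N (g ∙ h)) →
                   fun (g ∙ h) gh∈ ≡ fun g g∈ ℤ.+ fun h h∈ [mod p ]
      invariant  : ∀ σ {g} (g∈ : N g) (g^σ∈ : N (σ ⁻¹ ∙ g ∙ σ)) →
                   fun (σ ⁻¹ ∙ g ∙ σ) g^σ∈ ≡ fun g g∈ [mod p ]

  H¹-invariants : (Carrier → Set ℓ) → Setoid ℓ ℓ
  H¹-invariants N = record
    { Carrier = InvariantHom N
    ; _≈_ = λ x y → ∀ g (g∈ : N g) → fun x g g∈ ≡ fun y g g∈ [mod p ]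
    ; isEquivalence = record
      { refl = λ _ _ → ≡⇒mod ≡.refl
      ; sym = λ x≈y g g∈ → mod-sym (x≈y g g∈)
      ; trans = λ x≈y y≈z g g∈ → mod-trans (x≈y g g∈) (y≈z g g∈)
      }
    }
    where open InvariantHom

pullback : ∀ {a b} {G : TopGroup a} {H : TopGroup b} {p} →
           ContinuousHom G H → Cocycle² H p → Cocycle² G p
pullback {G = G} {H} {p} φ c = record
  { fun = λ g h → fun ⟦ g ⟧ ⟦ h ⟧
  ; continuous = λ g h →
      let i , near = continuous ⟦ g ⟧ ⟦ h ⟧
          j , g≈   = ContinuousHom.continuous φ g i
          k , h≈   = ContinuousHom.continuous φ h i
          l , l≤   = G.directed j k
      in l , λ g≈g′ h≈h′ → near (g≈ (proj₁ (l≤ g≈g′))) (h≈ (proj₂ (l≤ h≈h′)))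
  ; cocycle = λ g h k → mod-trans
      (mod-+-cong (≡⇒mod {a = fun ⟦ h ⟧ ⟦ k ⟧} ≡.refl) (cong₂ (H.refl {⟦ g ⟧}) (homo h k)))
      (mod-trans (cocycle ⟦ g ⟧ ⟦ h ⟧ ⟦ k ⟧)
        (mod-+-cong (cong₂ (H.sym (homo g h)) H.refl) (≡⇒mod ≡.refl)))
  }
  where
  module G = TopGroup G
  module H = TopGroup H
  open ContinuousHom φ using (⟦_⟧; homo)
  open Cocycle² c
  cong₂ : ∀ {g g′ h h′} → g H.≈ g′ → h H.≈ h′ → fun g h ≡ fun g′ h′ [mod p ]
  cong₂ {g} {h = h} g≈g′ h≈h′ = proj₂ (continuous g h) (H.≈⇒≈[] g≈g′) (H.≈⇒≈[] h≈h′)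

module _ {ℓ} (S : TopGroup ℓ) (n p : ℕ) where
  open TopGroup S

  -- trg(x) = α.  That ∂y depends only on cosets modulo S^(n,p) is expressed
  -- by its being the inflation of a cocycle on S^[n,p].
  record Transgression (x : InvariantHom S p (lowerCentral S p n))
                       (α : Cocycle² (S /lowerCentral[ n , p ]) p) : Set ℓ where
    open Setoid (H² (S /lowerCentral[ n , p ]) p) using () renaming (_≈_ to _~_)
    field
      y            : Carrier → ℤ
      y-continuous : IsCochain¹ S p y
      y-extends    : ∀ {g} (g∈ : lowerCentral S p n g) → y g ≡ InvariantHom.fun x g g∈ [mod p ]
      c            : Cocycle² (S /lowerCentral[ n , p ]) p
      ∂y-inflated  : ∀ g h → coboundary S p y g h ≡ Cocycle².fun c g h [mod p ]
      c~α          : c ~ α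

  -- (σ,α)ₙ = a
  PairingIs : (σ : Carrier) → lowerCentral S p n σ →
              Cocycle² (S /lowerCentral[ n , p ]) p → ℤ → Set ℓ
  PairingIs σ σ∈ α a = The (H¹-invariants S p (lowerCentral S p n))
    (λ x → Transgression x α)
    (λ x → a ≡ ℤ.- InvariantHom.fun x σ σ∈ [mod p ])

module _ {ℓ} {X : Set ℓ} where

  -- It suffices to consider basic open normal subgroups, as every open
  -- subgroup contains one.
  ConvergesToOne : (G : ProfiniteGroup ℓ) → (X → ProfiniteGroup.Carrier G) → Set ℓ
  ConvergesToOne G φ = ∀ i → ∃[ xs ] (∀ x → x ∉ xs → φ x ≈[ i ] ε)
    where open ProfiniteGroup G

  record IsFreeProfinite (S : ProfiniteGroup ℓ) (ι : X → ProfiniteGroup.Carrier S) : Set (lsuc ℓ) where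
    open ProfiniteGroup S
    field
      ι-injective : ∀ {x y} → ι x ≈ ι y → x ≡ y
      generates   : ∀ σ → ClosedSubgroupGenerated topGroup (λ τ → ∃[ x ] τ ≡ ι x) σ
      converges   : ConvergesToOne S ι
      extend      : (G : ProfiniteGroup ℓ) (φ : X → ProfiniteGroup.Carrier G) →
                    ConvergesToOne G φ →
                    let open ProfiniteGroup G using () renaming (_≈_ to _≈ᴳ_)
                        open ContinuousHom {G = topGroup} {ProfiniteGroup.topGroup G}
                    in ∃[ Φ ] (∀ x → ⟦ Φ ⟧ (ι x) ≈ᴳ φ x) ×
                         (∀ Ψ → (∀ x → ⟦ Ψ ⟧ (ι x) ≈ᴳ φ x) → ∀ σ → ⟦ Ψ ⟧ σ ≈ᴳ ⟦ Φ ⟧ σ)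

module Words {ℓ} {X : Set ℓ} {_<_ : Rel X ℓ} (<-isSTO : IsStrictTotalOrder _≡_ _<_) where
  open IsStrictTotalOrder <-isSTO using (_≟_; _<?_)

  Word : Set ℓ
  Word = List X

  infix 4 _<alp_ _≤alp_ _⪯_ _≺_

  _<alp_ _≤alp_ _⪯_ _≺_ : Rel Word ℓ
  _<alp_ = Lex-< _≡_ _<_
  _≤alp_ = Lex-≤ _≡_ _<_
  v ⪯ w = length v ℕ.< length w ⊎ (length v ≡ length w × v ≤alp w)
  v ≺ w = v ⪯ w × v ≢ w

  IsLyndon : Word → Set ℓ
  IsLyndon w = w ≢ [] × (∀ u v → u ≢ [] → v ≢ [] → w ≡ u ++ v → w <alp v)

  private
    below-suffixes? : ∀ w t → Dec (∀ u v → v ≢ [] → t ≡ u ++ v → w <alp v)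
    below-suffixes? w [] = yes λ where
      []      v v≢[] eq → ⊥-elim (v≢[] (≡.sym eq))
      (_ ∷ _) v v≢[] ()
    below-suffixes? w (x ∷ t) = map′ to from (<-decidable _≟_ _<?_ w (x ∷ t) ×-dec below-suffixes? w t)
      where
      to : w <alp x ∷ t × (∀ u v → v ≢ [] → t ≡ u ++ v → w <alp v) →
           ∀ u v → v ≢ [] → x ∷ t ≡ u ++ v → w <alp v
      to (lt , _)    []      v _ ≡.refl = lt
      to (_ , below) (_ ∷ u) v v≢[] eq  = below u v v≢[] (Listₚ.∷-injectiveʳ eq)
      from : (∀ u v → v ≢ [] → x ∷ t ≡ u ++ v → w <alp v) →
             w <alp x ∷ t × (∀ u v → v ≢ [] → t ≡ u ++ v → w <alp v)
      from below = below [] (x ∷ t) (λ ()) ≡.refl ,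
                   λ u v v≢[] eq → below (x ∷ u) v v≢[] (≡.cong (x ∷_) eq)

  isLyndon? : ∀ w → Dec (IsLyndon w)
  isLyndon? []      = no λ (w≢[] , _) → w≢[] ≡.refl
  isLyndon? (x ∷ t) = map′ to from (below-suffixes? (x ∷ t) t)
    where
    to : (∀ u v → v ≢ [] → t ≡ u ++ v → x ∷ t <alp v) → IsLyndon (x ∷ t)
    to below = (λ ()) , λ where
      []      v u≢[] _ _     → ⊥-elim (u≢[] ≡.refl)
      (_ ∷ u) v _ v≢[] eq    → below u v v≢[] (Listₚ.∷-injectiveʳ eq)
    from : IsLyndon (x ∷ t) → ∀ u v → v ≢ [] → t ≡ u ++ v → x ∷ t <alp v
    from (_ , lyn) u v v≢[] eq = lyn (x ∷ u) v (λ ()) v≢[] (≡.cong (x ∷_) eq)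

  -- (uv₁ , v₂), where v₂ is the longest Lyndon suffix of v = v₁v₂.
  splitLyndon : Word → Word → Word × Word
  splitLyndon u [] = u , []
  splitLyndon u (x ∷ v) with isLyndon? (x ∷ v)
  ... | yes _ = u , x ∷ v
  ... | no  _ = splitLyndon (u ++ [ x ]) v

  -- (w′ , w″), for words of length at least 2.
  standardFactorization : Word → Word × Word
  standardFactorization []      = [] , []
  standardFactorization (x ∷ v) = splitLyndon [ x ] v

  Lyndon≤ : ℕ → Set ℓ
  Lyndon≤ n = Σ[ w ∈ Word ] IsLyndon w × length w ℕ.≤ n

  module _ {c ℓ′} (G : Group c ℓ′) (ι : X → Group.Carrier G) where

    -- The first argument bounds the length of the word: it serves only to
    -- make the recursion structural.
    bracketing : ℕ → Word → Group.Carrier G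
    bracketing zero    _           = Group.ε G
    bracketing (suc k) []          = Group.ε G
    bracketing (suc k) (x ∷ [])    = ι x
    bracketing (suc k) w@(_ ∷ _ ∷ _) =
      let w′ , w″ = standardFactorization w
      in commutator G (bracketing k w′) (bracketing k w″)

    τ : Word → Group.Carrier G
    τ w = bracketing (length w) w

module _ {c ℓ} (M : Monoid c ℓ) where
  open Monoid M
  open SetoidReasoning setoid

  record Unit : Set (c ⊔ ℓ) where
    field
      val     : Carrier
      inverse : Carrier
      inverseˡ : inverse ∙ val ≈ ε
      inverseʳ : val ∙ inverse ≈ ε

  open Unit

  inverse-cong : ∀ {f g} → val f ≈ val g → inverse f ≈ inverse g
  inverse-cong {f} {g} f≈g = begin
    inverse f                       ≈⟨ identityʳ _ ⟨
    inverse f ∙ ε                   ≈⟨ ∙-congˡ (inverseʳ g) ⟨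
    inverse f ∙ (val g ∙ inverse g) ≈⟨ assoc _ _ _ ⟨
    inverse f ∙ val g ∙ inverse g   ≈⟨ ∙-congʳ (∙-congˡ f≈g) ⟨
    inverse f ∙ val f ∙ inverse g   ≈⟨ ∙-congʳ (inverseˡ f) ⟩
    ε ∙ inverse g                   ≈⟨ identityˡ _ ⟩
    inverse g                       ∎

  cancel : ∀ {a b a′ b′} → a ∙ a′ ≈ ε → b ∙ b′ ≈ ε → (a ∙ b) ∙ (b′ ∙ a′) ≈ ε
  cancel {a} {b} {a′} {b′} aa′ bb′ = begin
    (a ∙ b) ∙ (b′ ∙ a′) ≈⟨ assoc _ _ _ ⟩
    a ∙ (b ∙ (b′ ∙ a′)) ≈⟨ ∙-congˡ (assoc _ _ _) ⟨
    a ∙ (b ∙ b′ ∙ a′)   ≈⟨ ∙-congˡ (trans (∙-congʳ bb′) (identityˡ _)) ⟩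
    a ∙ a′              ≈⟨ aa′ ⟩
    ε                   ∎

  units : Group (c ⊔ ℓ) ℓ
  units = record
    { Carrier = Unit
    ; _≈_ = λ f g → val f ≈ val g
    ; _∙_ = λ f g → record
      { val = val f ∙ val g
      ; inverse = inverse g ∙ inverse f
      ; inverseˡ = cancel (inverseˡ g) (inverseˡ f)
      ; inverseʳ = cancel (inverseʳ f) (inverseʳ g)
      }
    ; ε = record { val = ε ; inverse = ε ; inverseˡ = identityˡ ε ; inverseʳ = identityˡ ε }
    ; _⁻¹ = λ f → record
      { val = inverse f ; inverse = val f ; inverseˡ = inverseʳ f ; inverseʳ = inverseˡ f }
    ; isGroup = record
      { isMonoid = record
        { isSemigroup = record
          { isMagma = record
            { isEquivalence = record { refl = refl ; sym = sym ; trans = trans }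
            ; ∙-cong = ∙-cong
            }
          ; assoc = λ f g h → assoc _ _ _
          }
        ; identity = (λ f → identityˡ _) , (λ f → identityʳ _)
        }
      ; inverse = inverseˡ , inverseʳ
      ; ⁻¹-cong = λ {f} {g} → inverse-cong {f} {g}
      }
    }

funToFin-cong : ∀ {m n} {f g : Fin m → Fin n} → (∀ i → f i ≡ g i) → funToFin f ≡ funToFin g
funToFin-cong {zero}  f≗g = ≡.refl
funToFin-cong {suc m} f≗g = ≡.cong₂ Fin.combine (f≗g zero) (funToFin-cong (f≗g ∘ suc))

funToFin-injective : ∀ {m n} {f g : Fin m → Fin n} → funToFin f ≡ funToFin g → ∀ i → f i ≡ g i
funToFin-injective {f = f} {g} eq i = ≡.trans (≡.sym (Finₚ.finToFun-funToFin f i))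
  (≡.trans (≡.cong (λ k → finToFun k i) eq) (Finₚ.finToFun-funToFin g i))

module PowerSeries {ℓ} (X : Set ℓ) (R : CommutativeRing 0ℓ 0ℓ) where
  open CommutativeRing R hiding (zero)
  open SetoidReasoning setoid

  Series : Set ℓ
  Series = List X → Carrier

  one : Series
  one []      = 1#
  one (_ ∷ _) = 0#

  infixl 7 _⊛_
  infix 4 _≋_

  _≋_ : Rel Series ℓ
  f ≋ g = ∀ w → f w ≈ g w

  -- The sum of f u * g v over all factorizations w = uv: either u = [], or
  -- u starts with the first letter of w.
  _⊛_ : Series → Series → Series
  (f ⊛ g) []      = f [] * g []
  (f ⊛ g) (x ∷ w) = f [] * g (x ∷ w) + ((f ∘ (x ∷_)) ⊛ g) w

  ⊛-cong-at : ∀ w {f f′ g g′} → (∀ u v → w ≡ u ++ v → f u ≈ f′ u) →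
              (∀ u v → w ≡ u ++ v → g v ≈ g′ v) → (f ⊛ g) w ≈ (f′ ⊛ g′) w
  ⊛-cong-at []      f≈ g≈ = *-cong (f≈ [] [] ≡.refl) (g≈ [] [] ≡.refl)
  ⊛-cong-at (x ∷ w) f≈ g≈ = +-cong
    (*-cong (f≈ [] (x ∷ w) ≡.refl) (g≈ [] (x ∷ w) ≡.refl))
    (⊛-cong-at w (λ u v eq → f≈ (x ∷ u) v (≡.cong (x ∷_) eq))
                 (λ u v eq → g≈ (x ∷ u) v (≡.cong (x ∷_) eq)))

  ⊛-cong : ∀ {f f′ g g′} → f ≋ f′ → g ≋ g′ → f ⊛ g ≋ f′ ⊛ g′
  ⊛-cong f≈ g≈ w = ⊛-cong-at w (λ u _ _ → f≈ u) (λ _ v _ → g≈ v)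

  ⊛-linearˡ : ∀ a f f′ g w →
              ((λ u → a * f u + f′ u) ⊛ g) w ≈ a * (f ⊛ g) w + (f′ ⊛ g) w
  ⊛-linearˡ a f f′ g [] = begin
    (a * f [] + f′ []) * g []          ≈⟨ distribʳ _ _ _ ⟩
    a * f [] * g [] + f′ [] * g []     ≈⟨ +-congʳ (*-assoc _ _ _) ⟩
    a * (f [] * g []) + f′ [] * g []   ∎
  ⊛-linearˡ a f f′ g (x ∷ w) = begin
    (a * f [] + f′ []) * c + ((λ u → a * f (x ∷ u) + f′ (x ∷ u)) ⊛ g) w
      ≈⟨ +-cong (trans (distribʳ _ _ _) (+-congʳ (*-assoc _ _ _))) (⊛-linearˡ a _ _ g w) ⟩
    (a * (f [] * c) + f′ [] * c) + (a * s + s′)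
      ≈⟨ +-assoc _ _ _ ⟩
    a * (f [] * c) + (f′ [] * c + (a * s + s′))
      ≈⟨ +-congˡ (+-assoc _ _ _) ⟨
    a * (f [] * c) + ((f′ [] * c + a * s) + s′)
      ≈⟨ +-congˡ (+-congʳ (+-comm _ _)) ⟩
    a * (f [] * c) + ((a * s + f′ [] * c) + s′)
      ≈⟨ +-congˡ (+-assoc _ _ _) ⟩
    a * (f [] * c) + (a * s + (f′ [] * c + s′))
      ≈⟨ +-assoc _ _ _ ⟨
    (a * (f [] * c) + a * s) + (f′ [] * c + s′)
      ≈⟨ +-congʳ (distribˡ _ _ _) ⟨
    a * (f [] * c + s) + (f′ [] * c + s′) ∎
    where
    c  = g (x ∷ w)
    s  = ((f ∘ (x ∷_)) ⊛ g) w
    s′ = ((f′ ∘ (x ∷_)) ⊛ g) w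

  ⊛-zeroˡ : ∀ g → (λ _ → 0#) ⊛ g ≋ (λ _ → 0#)
  ⊛-zeroˡ g []      = zeroˡ _
  ⊛-zeroˡ g (x ∷ w) = trans (+-cong (zeroˡ _) (⊛-zeroˡ g w)) (+-identityˡ 0#)

  ⊛-identityˡ : ∀ f → one ⊛ f ≋ f
  ⊛-identityˡ f []      = *-identityˡ _
  ⊛-identityˡ f (x ∷ w) = trans (+-cong (*-identityˡ _) (⊛-zeroˡ f w)) (+-identityʳ _)

  ⊛-identityʳ : ∀ f → f ⊛ one ≋ f
  ⊛-identityʳ f []      = *-identityʳ _
  ⊛-identityʳ f (x ∷ w) = trans (+-cong (zeroʳ _) (⊛-identityʳ (f ∘ (x ∷_)) w)) (+-identityˡ _)

  ⊛-assoc : ∀ f g h → (f ⊛ g) ⊛ h ≋ f ⊛ (g ⊛ h)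
  ⊛-assoc f g h []      = *-assoc _ _ _
  ⊛-assoc f g h (x ∷ w) = begin
    f [] * g [] * c + ((λ u → f [] * g (x ∷ u) + (∂f ⊛ g) u) ⊛ h) w
      ≈⟨ +-cong (*-assoc _ _ _) (⊛-linearˡ (f []) (g ∘ (x ∷_)) (∂f ⊛ g) h w) ⟩
    f [] * (g [] * c) + (f [] * ((g ∘ (x ∷_)) ⊛ h) w + ((∂f ⊛ g) ⊛ h) w)
      ≈⟨ +-assoc _ _ _ ⟨
    f [] * (g [] * c) + f [] * ((g ∘ (x ∷_)) ⊛ h) w + ((∂f ⊛ g) ⊛ h) w
      ≈⟨ +-cong (sym (distribˡ _ _ _)) (⊛-assoc ∂f g h w) ⟩
    f [] * (g ⊛ h) (x ∷ w) + (∂f ⊛ (g ⊛ h)) w ∎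
    where
    c  = h (x ∷ w)
    ∂f = f ∘ (x ∷_)

  seriesMonoid : Monoid ℓ ℓ
  seriesMonoid = record
    { Carrier = Series
    ; _≈_ = _≋_
    ; _∙_ = _⊛_
    ; ε = one
    ; isMonoid = record
      { isSemigroup = record
        { isMagma = record
          { isEquivalence = record
            { refl  = λ _ → refl
            ; sym   = λ f≈g w → sym (f≈g w)
            ; trans = λ f≈g g≈h w → trans (f≈g w) (g≈h w)
            }
          ; ∙-cong = ⊛-cong
          }
        ; assoc = ⊛-assoc
        }
      ; identity = ⊛-identityˡ , ⊛-identityʳ
      }
    }

  open Unit {M = seriesMonoid} public using (val)

  infix 4 _⊑_

  _⊑_ : Rel (List X) ℓ
  u ⊑ w = ∃[ a ] ∃[ b ] w ≡ a ++ u ++ b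

  prefix-⊑ : ∀ {w u} v v′ → u ≡ v ++ v′ → u ⊑ w → v ⊑ w
  prefix-⊑ v v′ ≡.refl (a , b , ≡.refl) =
    a , v′ ++ b , ≡.cong (a ++_) (Listₚ.++-assoc v v′ b)

  suffix-⊑ : ∀ {w u} v v′ → u ≡ v ++ v′ → u ⊑ w → v′ ⊑ w
  suffix-⊑ v v′ ≡.refl (a , b , ≡.refl) =
    a ++ v , b , ≡.trans (≡.cong (a ++_) (Listₚ.++-assoc v v′ b)) (≡.sym (Listₚ.++-assoc a v (v′ ++ b)))

  ⊑-refl : ∀ w → w ⊑ w
  ⊑-refl w = [] , [] , ≡.sym (Listₚ.++-identityʳ w)

  -- R⟨⟨X⟩⟩ˣ with the product topology, R being discrete.  Any finite set of
  -- words consists of factors of a single word (their concatenation), so a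
  -- basis of neighbourhoods of f is given by the sets of all g with the same
  -- coefficients as f at the factors of some word w.
  seriesUnits : TopGroup ℓ
  seriesUnits = record
    { group = units seriesMonoid
    ; Nbhd = List X
    ; someNbhd = []
    ; _≈[_]_ = λ f w g → ∀ u → u ⊑ w → val f u ≈ val g u
    ; ≈[]-isEquivalence = λ w → record
      { refl  = λ _ _ → refl
      ; sym   = λ f≈g u u⊑w → sym (f≈g u u⊑w)
      ; trans = λ f≈g g≈h u u⊑w → trans (f≈g u u⊑w) (g≈h u u⊑w)
      }
    ; ≈⇒≈[] = λ f≈g u _ → f≈g u
    ; ∙-cong[] = λ f≈f′ g≈g′ u u⊑w → ⊛-cong-at u
        (λ v v′ eq → f≈f′ v (prefix-⊑ v v′ eq u⊑w))
        (λ v v′ eq → g≈g′ v′ (suffix-⊑ v v′ eq u⊑w))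
    ; directed = λ w w′ → w ++ w′ , λ f≈g →
        (λ { u (a , b , ≡.refl) → f≈g u (a , b ++ w′ ,
               ≡.trans (Listₚ.++-assoc a (u ++ b) w′) (≡.cong (a ++_) (Listₚ.++-assoc u b w′))) }) ,
        (λ { u (a , b , ≡.refl) → f≈g u (w ++ a , b , ≡.sym (Listₚ.++-assoc w a (u ++ b))) })
    }

  take-drop-⊑ : ∀ i j w → take j (drop i w) ⊑ w
  take-drop-⊑ i j w = take i w , drop j (drop i w) ,
    ≡.sym (≡.trans (≡.cong (take i w ++_) (Listₚ.take++drop≡id j (drop i w))) (Listₚ.take++drop≡id i w))

  ⊑-take-drop : ∀ (a u b : List X) → take (length u) (drop (length a) (a ++ u ++ b)) ≡ u
  ⊑-take-drop (_ ∷ a) u       b = ⊑-take-drop a u b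
  ⊑-take-drop []      []      b = ≡.refl
  ⊑-take-drop []      (x ∷ u) b = ≡.cong (x ∷_) (⊑-take-drop [] u b)

  module _ (R-finite : Finite setoid) where
    private
      k      = proj₁ R-finite
      module code = Injection (proj₂ R-finite)

    seriesUnits-finite : ∀ w → Finite (TopGroup.coset-setoid seriesUnits w)
    seriesUnits-finite w = _ , record
      { to = λ f → funToFin (λ i → funToFin (λ j → code.to (val f (factor i j))))
      ; cong = λ f≈g → funToFin-cong (λ i → funToFin-cong (λ j →
          code.cong (f≈g (factor i j) (take-drop-⊑ (toℕ i) (toℕ j) w))))
      ; injective = λ {f} {g} eq u u⊑w →
          let i , j , factor≡u = position u u⊑w
          in ≡.subst (λ v → val f v ≈ val g v) factor≡u
               (code.injective (funToFin-injective
                 {f = λ j → code.to (val f (factor i j))} {λ j → code.to (val g (factor i j))}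
                 (funToFin-injective
                   {f = λ i → funToFin (λ j → code.to (val f (factor i j)))}
                   {λ i → funToFin (λ j → code.to (val g (factor i j)))} eq i) j))
      }
      where
      N = suc (length w)
      factor : Fin N → Fin N → List X
      factor i j = take (toℕ j) (drop (toℕ i) w)
      position : ∀ u → u ⊑ w → ∃[ i ] ∃[ j ] factor i j ≡ u
      position u (a , b , eq) = fromℕ< (ℕ.s≤s |a|≤) , fromℕ< (ℕ.s≤s |u|≤) , ≡.trans
        (≡.cong₂ (λ i j → take j (drop i w)) (Finₚ.toℕ-fromℕ< (ℕ.s≤s |a|≤)) (Finₚ.toℕ-fromℕ< (ℕ.s≤s |u|≤)))
        (≡.trans (≡.cong (λ w → take (length u) (drop (length a) w)) eq) (⊑-take-drop a u b))
        where
        |w|≡ : length w ≡ length a ℕ.+ (length u ℕ.+ length b)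
        |w|≡ = ≡.trans (≡.cong length eq) (≡.trans (Listₚ.length-++ a)
                 (≡.cong (length a ℕ.+_) (Listₚ.length-++ u)))
        |a|≤ : length a ℕ.≤ length w
        |a|≤ = ≡.subst (length a ℕ.≤_) (≡.sym |w|≡) (ℕₚ.m≤m+n _ _)
        |u|≤ : length u ℕ.≤ length w
        |u|≤ = ≡.subst (length u ℕ.≤_) (≡.sym |w|≡)
                 (ℕₚ.≤-trans (ℕₚ.m≤m+n _ _) (ℕₚ.m≤n+m _ (length a)))

    seriesUnits-profinite : ProfiniteGroup ℓ
    seriesUnits-profinite = record
      { topGroup = seriesUnits
      ; separated = λ f≈g w → f≈g w w (⊑-refl w)
      ; finite = seriesUnits-finite
      ; complete = λ f compatible →
          let
            -- The coefficients of f w and of its inverse at a factor u of w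
            -- are those of f u.
            val≈ : ∀ u w → u ⊑ w → val (f w) u ≈ val (f u) u
            val≈ u w u⊑w = compatible u w (λ a≈b v v⊑u → a≈b v (⊑-trans v⊑u u⊑w)) u (⊑-refl u)
            inv≈ : ∀ u w → u ⊑ w → inverse (f w) u ≈ inverse (f u) u
            inv≈ u w u⊑w = ⁻¹-cong[] {u} {f w} {f u}
              (compatible u w (λ a≈b v v⊑u → a≈b v (⊑-trans v⊑u u⊑w))) u (⊑-refl u)
          in record
            { val = λ w → val (f w) w
            ; inverse = λ w → inverse (f w) w
            ; inverseˡ = λ w → trans
                (⊛-cong-at w (λ u v eq → sym (inv≈ u w (prefix-⊑ u v eq (⊑-refl w))))
                             (λ u v eq → sym (val≈ v w (suffix-⊑ u v eq (⊑-refl w)))))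
                (inverseˡ (f w) w)
            ; inverseʳ = λ w → trans
                (⊛-cong-at w (λ u v eq → sym (val≈ u w (prefix-⊑ u v eq (⊑-refl w))))
                             (λ u v eq → sym (inv≈ v w (suffix-⊑ u v eq (⊑-refl w)))))
                (inverseʳ (f w) w)
            } , λ w u u⊑w → sym (val≈ u w u⊑w)
      }
      where
      open Unit using (inverse; inverseˡ; inverseʳ)
      open TopGroup seriesUnits using (⁻¹-cong[])
      ⊑-trans : ∀ {u v w} → u ⊑ v → v ⊑ w → u ⊑ w
      ⊑-trans {u} (a , b , eq) v⊑w = prefix-⊑ u b ≡.refl (suffix-⊑ a (u ++ b) eq v⊑w)

  module _ (_≟_ : (x y : X) → Dec (x ≡ y)) where

    1+ : X → Series
    1+ x []      = 1#
    1+ x (y ∷ w) = if does (x ≟ y) then one w else 0#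

    -- Σ (-1)ⁿ xⁿ
    1+⁻¹ : X → Series
    1+⁻¹ x []      = 1#
    1+⁻¹ x (y ∷ w) = if does (x ≟ y) then - 1+⁻¹ x w else 0#

    1+-unit : X → Unit seriesMonoid
    1+-unit x = record { val = 1+ x ; inverse = 1+⁻¹ x ; inverseˡ = invˡ ; inverseʳ = invʳ }
      where
      open RingProperties ring using (-1*x≈-x)
      zero-at : ∀ g {a} → a ≈ 0# → ∀ w → a + ((λ _ → 0#) ⊛ g) w ≈ 0#
      zero-at g a≈0 w = trans (+-cong a≈0 (⊛-zeroˡ g w)) (+-identityˡ 0#)
      negate : ∀ f g w → ((λ u → - f u) ⊛ g) w ≈ - (f ⊛ g) w
      negate f g w = begin
        ((λ u → - f u) ⊛ g) w
          ≈⟨ ⊛-cong (λ u → trans (sym (-1*x≈-x _)) (sym (+-identityʳ _))) (λ _ → refl) w ⟩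
        ((λ u → - 1# * f u + 0#) ⊛ g) w        ≈⟨ ⊛-linearˡ (- 1#) f (λ _ → 0#) g w ⟩
        - 1# * (f ⊛ g) w + ((λ _ → 0#) ⊛ g) w  ≈⟨ +-cong (-1*x≈-x _) (⊛-zeroˡ g w) ⟩
        - (f ⊛ g) w + 0#                       ≈⟨ +-identityʳ _ ⟩
        - (f ⊛ g) w                            ∎
      invˡ : 1+⁻¹ x ⊛ 1+ x ≋ one
      invˡ [] = *-identityˡ _
      invˡ (y ∷ w) with x ≟ y
      ... | no _ = zero-at (1+ x) (zeroʳ _) w
      ... | yes _ = begin
        1# * one w + ((λ u → - 1+⁻¹ x u) ⊛ 1+ x) w
          ≈⟨ +-cong (*-identityˡ _) (trans (negate (1+⁻¹ x) (1+ x) w) (-‿cong (invˡ w))) ⟩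
        one w + - one w  ≈⟨ -‿inverseʳ _ ⟩
        0# ∎
      invʳ : 1+ x ⊛ 1+⁻¹ x ≋ one
      invʳ [] = *-identityˡ _
      invʳ (y ∷ w) with x ≟ y
      ... | no _ = zero-at (1+⁻¹ x) (zeroʳ _) w
      ... | yes _ = trans (+-cong (*-identityˡ _) (⊛-identityˡ (1+⁻¹ x) w)) (-‿inverseˡ _)

    1+-converges : (R-finite : Finite setoid) →
                   ConvergesToOne (seriesUnits-profinite R-finite) 1+-unit
    1+-converges _ w = w , converges
      where
      off : ∀ x y u → x ∉ w → y ∷ u ⊑ w → 1+ x (y ∷ u) ≈ 0#
      off x y u x∉w (a , b , ≡.refl) with x ≟ y
      ... | no _       = refl
      ... | yes ≡.refl = ⊥-elim (x∉w (Anyₚ.++⁺ʳ a (here ≡.refl)))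
      converges : ∀ x → x ∉ w → ∀ u → u ⊑ w → 1+ x u ≈ one u
      converges x x∉w []      _   = refl
      converges x x∉w (y ∷ u) u⊑w = off x y u x∉w u⊑w

module Matrices (R : CommutativeRing 0ℓ 0ℓ) where
  open CommutativeRing R hiding (zero)
  open SemiringSum semiring using (sum; sum-syntax; sum-cong-≋; *-distribˡ-sum; *-distribʳ-sum; ∑-comm; sum-replicate-zero)
  open SetoidReasoning setoid

  Matrix : ℕ → Set
  Matrix k = Fin k → Fin k → Carrier

  infix 4 _≈ᴹ_
  infixl 7 _⊗_

  _≈ᴹ_ : ∀ {k} → Rel (Matrix k) 0ℓ
  A ≈ᴹ B = ∀ i j → A i j ≈ B i j

  _⊗_ : ∀ {k} → Matrix k → Matrix k → Matrix k
  _⊗_ {k} A B i j = ∑[ l < k ] (A i l * B l j)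

  I : ∀ {k} → Matrix k
  I i j = if does (i Finₚ.≟ j) then 1# else 0#

  -- I + aE, where E has entry 1 in the top right corner and 0 elsewhere.
  I+_E : ∀ {s} → Carrier → Matrix (suc s)
  I+_E {s} a i j = I i j + (if does (i Finₚ.≟ zero) then (if does (j Finₚ.≟ fromℕ s) then a else 0#) else 0#)

  record IsUnitriangular {k} (A : Matrix k) : Set where
    field
      diagonal : ∀ i → A i i ≈ 1#
      below    : ∀ {i j} → j Fin.< i → A i j ≈ 0#

  sum-zero : ∀ {k} {t : Fin k → Carrier} → (∀ i → t i ≈ 0#) → sum t ≈ 0#
  sum-zero {k} t≈0 = trans (sum-cong-≋ t≈0) (sum-replicate-zero k)

  sum-single : ∀ {k} {t : Fin k → Carrier} i → (∀ j → j ≢ i → t j ≈ 0#) → sum t ≈ t i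
  sum-single {suc k} {t} zero    t≈0 =
    trans (+-congˡ (sum-zero (λ j → t≈0 (suc j) (λ ())))) (+-identityʳ _)
  sum-single {suc k} {t} (suc i) t≈0 =
    trans (+-cong (t≈0 zero (λ ())) (sum-single i (λ j j≢i → t≈0 (suc j) (j≢i ∘ Finₚ.suc-injective))))
          (+-identityˡ _)

  I-diagonal : ∀ {k} (i : Fin k) → I i i ≈ 1#
  I-diagonal i with i Finₚ.≟ i
  ... | yes _  = refl
  ... | no i≢i = ⊥-elim (i≢i ≡.refl)

  I-off-diagonal : ∀ {k} {i j : Fin k} → i ≢ j → I i j ≈ 0#
  I-off-diagonal {i = i} {j} i≢j with i Finₚ.≟ j
  ... | yes i≡j = ⊥-elim (i≢j i≡j)
  ... | no _    = refl

  ⊗-assoc : ∀ {k} (A B C : Matrix k) → (A ⊗ B) ⊗ C ≈ᴹ A ⊗ (B ⊗ C)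
  ⊗-assoc {k} A B C i j = begin
    ∑[ l < k ] ((∑[ m < k ] (A i m * B m l)) * C l j)
      ≈⟨ sum-cong-≋ (λ l → *-distribʳ-sum (C l j) (λ m → A i m * B m l)) ⟩
    ∑[ l < k ] (∑[ m < k ] (A i m * B m l * C l j))
      ≈⟨ ∑-comm (λ l m → A i m * B m l * C l j) ⟩
    ∑[ m < k ] (∑[ l < k ] (A i m * B m l * C l j))
      ≈⟨ sum-cong-≋ (λ m → sum-cong-≋ (λ l → *-assoc (A i m) (B m l) (C l j))) ⟩
    ∑[ m < k ] (∑[ l < k ] (A i m * (B m l * C l j)))
      ≈⟨ sum-cong-≋ (λ m → *-distribˡ-sum (A i m) (λ l → B m l * C l j)) ⟨
    ∑[ m < k ] (A i m * (∑[ l < k ] (B m l * C l j))) ∎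

  ⊗-identityˡ : ∀ {k} (A : Matrix k) → I ⊗ A ≈ᴹ A
  ⊗-identityˡ A i j = trans
    (sum-single i (λ l l≢i → trans (*-congʳ (I-off-diagonal (l≢i ∘ ≡.sym))) (zeroˡ _)))
    (trans (*-congʳ (I-diagonal i)) (*-identityˡ _))

  ⊗-identityʳ : ∀ {k} (A : Matrix k) → A ⊗ I ≈ᴹ A
  ⊗-identityʳ A i j = trans
    (sum-single j (λ l l≢j → trans (*-congˡ (I-off-diagonal l≢j)) (zeroʳ _)))
    (trans (*-congˡ (I-diagonal j)) (*-identityʳ _))

  module _ {k} {A B : Matrix k} (A-ut : IsUnitriangular A) (B-ut : IsUnitriangular B) where
    private
      module A = IsUnitriangular A-ut
      module B = IsUnitriangular B-ut

    ⊗-isUnitriangular : IsUnitriangular (A ⊗ B)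
    ⊗-isUnitriangular = record
      { diagonal = λ i → trans (sum-single i (off i))
          (trans (*-cong (A.diagonal i) (B.diagonal i)) (*-identityˡ 1#))
      ; below = λ {i} {j} j<i → sum-zero (low j<i)
      }
      where
      off : ∀ i l → l ≢ i → A i l * B l i ≈ 0#
      off i l l≢i with Finₚ.<-cmp l i
      ... | tri< l<i _ _ = trans (*-congʳ (A.below l<i)) (zeroˡ _)
      ... | tri≈ _ l≡i _ = ⊥-elim (l≢i l≡i)
      ... | tri> _ _ i<l = trans (*-congˡ (B.below i<l)) (zeroʳ _)
      low : ∀ {i j} → j Fin.< i → ∀ l → A i l * B l j ≈ 0#
      low {i} {j} j<i l with Finₚ.<-cmp l i
      ... | tri< l<i _ _    = trans (*-congʳ (A.below l<i)) (zeroˡ _)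
      ... | tri≈ _ ≡.refl _ = trans (*-congˡ (B.below j<i)) (zeroʳ _)
      ... | tri> _ _ i<l    = trans (*-congˡ (B.below (ℕₚ.<-trans j<i i<l))) (zeroʳ _)

  unitriangularMonoid : ℕ → Monoid 0ℓ 0ℓ
  unitriangularMonoid k = record
    { Carrier = Σ (Matrix k) IsUnitriangular
    ; _≈_ = λ A B → proj₁ A ≈ᴹ proj₁ B
    ; _∙_ = λ (A , A-ut) (B , B-ut) → A ⊗ B , ⊗-isUnitriangular A-ut B-ut
    ; ε = I , record
      { diagonal = I-diagonal
      ; below = λ j<i → I-off-diagonal (λ i≡j → Finₚ.<-irrefl (≡.sym i≡j) j<i)
      }
    ; isMonoid = record
      { isSemigroup = record
        { isMagma = record
          { isEquivalence = record
            { refl  = λ _ _ → refl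
            ; sym   = λ A≈B i j → sym (A≈B i j)
            ; trans = λ A≈B B≈C i j → trans (A≈B i j) (B≈C i j)
            }
          ; ∙-cong = λ A≈A′ B≈B′ i j → sum-cong-≋ (λ l → *-cong (A≈A′ i l) (B≈B′ l j))
          }
        ; assoc = λ (A , _) (B , _) (C , _) → ⊗-assoc A B C
        }
      ; identity = (λ (A , _) → ⊗-identityˡ A) , (λ (A , _) → ⊗-identityʳ A)
      }
    }

  -- 𝕌ₖ(R).  Every unitriangular matrix has a unique inverse, which is again
  -- unitriangular; it is carried along as data.
  𝕌 : ℕ → Group 0ℓ 0ℓ
  𝕌 k = units (unitriangularMonoid k)

  toMatrix : ∀ {k} → Group.Carrier (𝕌 k) → Matrix k
  toMatrix u = proj₁ (Unit.val u)

module SeriesMatrix {ℓ} (X : Set ℓ) (R : CommutativeRing 0ℓ 0ℓ) where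
  open CommutativeRing R hiding (zero)
  open Matrices R
  open PowerSeries X R
  open SemiringSum semiring using (sum; sum-cong-≋)

  -- For w = x₁⋯xₛ and (in the numbering from 1) i ≤ j, the (i,j) entry is
  -- the coefficient of f at xᵢ⋯xⱼ₋₁.
  seriesMatrix : Series → (w : List X) → Matrix (suc (length w))
  seriesMatrix f w i j =
    if toℕ i ≤ᵇ toℕ j then f (take (toℕ j ∸ toℕ i) (drop (toℕ i) w)) else 0#

  ≤ᵇ-suc : ∀ m n → (suc m ≤ᵇ suc n) ≡ (m ≤ᵇ n)
  ≤ᵇ-suc zero    n = ≡.refl
  ≤ᵇ-suc (suc m) n = ≡.refl

  seriesMatrix-suc : ∀ f x w i j → seriesMatrix f (x ∷ w) (suc i) (suc j) ≡ seriesMatrix f w i j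
  seriesMatrix-suc f x w i j rewrite ≤ᵇ-suc (toℕ i) (toℕ j) = ≡.refl

  seriesMatrix-⊛ : ∀ f g w → seriesMatrix (f ⊛ g) w ≈ᴹ seriesMatrix f w ⊗ seriesMatrix g w
  seriesMatrix-⊛ f g []      zero    zero    = sym (+-identityʳ _)
  seriesMatrix-⊛ f g (x ∷ w) zero    zero    = sym (trans
    (+-congˡ {f [] * g []} (sum-zero {suc (length w)} {λ l → f (x ∷ take (toℕ l) w) * 0#}
      (λ l → zeroʳ (f (x ∷ take (toℕ l) w))))) (+-identityʳ _))
  seriesMatrix-⊛ f g (x ∷ w) zero    (suc j) = +-congˡ (trans
    (seriesMatrix-⊛ (f ∘ (x ∷_)) g w zero j)
    (sum-cong-≋ (λ l → *-congˡ {f (x ∷ take (toℕ l) w)}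
      (reflexive (≡.sym (seriesMatrix-suc g x w l j))))))
  seriesMatrix-⊛ f g (x ∷ w) (suc i) zero    = sym (trans
    (+-cong (zeroˡ _) (sum-zero (λ l → zeroʳ (seriesMatrix f (x ∷ w) (suc i) (suc l)))))
    (+-identityˡ 0#))
  seriesMatrix-⊛ f g (x ∷ w) (suc i) (suc j) = trans
    (reflexive (seriesMatrix-suc (f ⊛ g) x w i j))
    (trans (seriesMatrix-⊛ f g w i j)
    (trans (sum-cong-≋ (λ l → reflexive (≡.sym (≡.cong₂ _*_ (seriesMatrix-suc f x w i l) (seriesMatrix-suc g x w l j)))))
    (sym (trans (+-congʳ (zeroˡ (g (x ∷ take (toℕ j) w)))) (+-identityˡ _)))))

  seriesMatrix-one : ∀ w → seriesMatrix one w ≈ᴹ I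
  seriesMatrix-one []      zero    zero    = refl
  seriesMatrix-one (x ∷ w) zero    zero    = refl
  seriesMatrix-one (x ∷ w) zero    (suc j) = refl
  seriesMatrix-one (x ∷ w) (suc i) zero    = refl
  seriesMatrix-one (x ∷ w) (suc i) (suc j) = trans
    (reflexive (seriesMatrix-suc one x w i j))
    (trans (seriesMatrix-one w i j) (I-suc i j))
    where
    I-suc : ∀ {k} (i j : Fin k) → I i j ≈ I (suc i) (suc j)
    I-suc i j with i Finₚ.≟ j
    ... | yes _ = refl
    ... | no _  = refl

  seriesMatrix-isUnitriangular : ∀ f w → f [] ≈ 1# → IsUnitriangular (seriesMatrix f w)
  seriesMatrix-isUnitriangular f w f[]≈1 = record { diagonal = diagonal w ; below = below w }
    where
    diagonal : ∀ w i → seriesMatrix f w i i ≈ 1#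
    diagonal w       zero    = f[]≈1
    diagonal (x ∷ w) (suc i) = trans (reflexive (seriesMatrix-suc f x w i i)) (diagonal w i)
    below : ∀ w {i j} → j Fin.< i → seriesMatrix f w i j ≈ 0#
    below (x ∷ w) {suc i} {zero}  _   = refl
    below (x ∷ w) {suc i} {suc j} j<i =
      trans (reflexive (seriesMatrix-suc f x w i j)) (below w (ℕ.s<s⁻¹ j<i))

  seriesMatrix-cong : ∀ {f g} w → (∀ u → u ⊑ w → f u ≈ g u) → seriesMatrix f w ≈ᴹ seriesMatrix g w
  seriesMatrix-cong w f≈g i j with toℕ i ≤ᵇ toℕ j
  ... | true  = f≈g _ (take-drop-⊑ (toℕ i) (toℕ j ∸ toℕ i) w)
  ... | false = refl

module Magnus {ℓ} {X : Set ℓ} (_≟_ : (x y : X) → Dec (x ≡ y))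
              (S : ProfiniteGroup ℓ) (ι : X → ProfiniteGroup.Carrier S)
              (S-free : IsFreeProfinite S ι)
              (R : CommutativeRing 0ℓ 0ℓ) (R-finite : Finite (CommutativeRing.setoid R)) where
  open CommutativeRing R hiding (zero)
  open PowerSeries X R
  open Matrices R
  open SeriesMatrix X R
  private
    module S = ProfiniteGroup S
    module S-free = IsFreeProfinite S-free
    extension = S-free.extend (seriesUnits-profinite R-finite) (1+-unit _≟_) (1+-converges _≟_ R-finite)

  Λ : ContinuousHom S.topGroup seriesUnits
  Λ = proj₁ extension

  open ContinuousHom Λ

  Λ-ι : ∀ x → val (⟦ ι x ⟧) ≋ 1+ _≟_ x
  Λ-ι = proj₁ (proj₂ extension)

  coefficient : List X → S.Carrier → Carrier
  coefficient w σ = val ⟦ σ ⟧ w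

  coefficient-[] : ∀ σ → coefficient [] σ ≈ 1#
  coefficient-[] σ =
    let i , near = continuous σ []
        τ , τ∈ , σ≈τ = S-free.generates σ i
    in trans (near σ≈τ [] (⊑-refl [])) (on-generated τ∈)
    where
    on-generated : ∀ {τ} → Generated S.group (λ τ → ∃[ x ] τ ≡ ι x) τ → coefficient [] τ ≈ 1#
    on-generated (gen (x , ≡.refl)) = Λ-ι x []
    on-generated unit               = ε-homo []
    on-generated (mul s t)          = trans (homo _ _ [])
      (trans (*-cong (on-generated s) (on-generated t)) (*-identityˡ 1#))
    on-generated (inv {g} s)        = trans (sym (*-identityʳ _))
      (trans (*-congˡ (sym (on-generated s)))
      (trans (*-congʳ (⁻¹-homo g [])) (Unit.inverseˡ ⟦ g ⟧ [])))
    on-generated (resp g≈h s)       = trans (sym (⟦⟧-cong g≈h [])) (on-generated s)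

  ρ : (w : List X) → ContinuousHom S.topGroup (discrete (𝕌 (suc (length w))))
  ρ w = record
    { ⟦_⟧ = λ σ → record
      { val      = matrix σ
      ; inverse  = matrix (σ S.⁻¹)
      ; inverseˡ = inverse-matrix (σ S.⁻¹) σ (S.inverseˡ σ)
      ; inverseʳ = inverse-matrix σ (σ S.⁻¹) (S.inverseʳ σ)
      }
    ; isHom = record
      { isMonoidHomomorphism = record
        { isMagmaHomomorphism = record
          { isRelHomomorphism = record
            { cong = λ σ≈τ → seriesMatrix-cong w (λ u _ → ⟦⟧-cong σ≈τ u) }
          ; homo = matrix-homo
          }
        ; ε-homo = matrix-ε
        }
      ; ⁻¹-homo = λ σ i j → refl
      }
    ; continuous = λ σ _ →
        let i , near = continuous σ w
        in i , λ σ≈τ → seriesMatrix-cong w (near σ≈τ)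
    }
    where
    matrix : S.Carrier → Monoid.Carrier (unitriangularMonoid (suc (length w)))
    matrix σ = seriesMatrix (val ⟦ σ ⟧) w , seriesMatrix-isUnitriangular (val ⟦ σ ⟧) w (coefficient-[] σ)
    matrix-homo : ∀ σ τ → proj₁ (matrix (σ S.∙ τ)) ≈ᴹ proj₁ (matrix σ) ⊗ proj₁ (matrix τ)
    matrix-homo σ τ i j = trans (seriesMatrix-cong w (λ u _ → homo σ τ u) i j)
      (seriesMatrix-⊛ (val ⟦ σ ⟧) (val ⟦ τ ⟧) w i j)
    matrix-ε : proj₁ (matrix S.ε) ≈ᴹ I
    matrix-ε i j = trans (seriesMatrix-cong w (λ u _ → ε-homo u) i j) (seriesMatrix-one w i j)
    inverse-matrix : ∀ σ τ → σ S.∙ τ S.≈ S.ε → proj₁ (matrix σ) ⊗ proj₁ (matrix τ) ≈ᴹ I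
    inverse-matrix σ τ στ≈ε i j = trans (sym (matrix-homo σ τ i j))
      (trans (seriesMatrix-cong w (λ u _ → ⟦⟧-cong στ≈ε u) i j) (matrix-ε i j))

-- γ is the class of the extension 0 → ℤ/p → U → U^[n,p] → 1, the kernel
-- being identified with ℤ/p by means of the relation
-- κ a u: "u is the image of a mod p".  It is represented by the cocycle
-- λ(ū)λ(ū′)λ(ūū′)⁻¹ for some section λ of U → U^[n,p] with λ(1) = 1.
module _ {ℓ} (U : TopGroup ℓ) (n p : ℕ) (κ : ℤ → TopGroup.Carrier U → Set ℓ) where
  open TopGroup U
  private module Q = TopGroup (U /lowerCentral[ n , p ])

  record IsExtensionClass (γ : Cocycle² (U /lowerCentral[ n , p ]) p) : Set ℓ where
    field
      section      : Carrier → Carrier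
      section-cong : ∀ {u v} → u Q.≈ v → section u ≈ section v
      is-section   : ∀ u → section u Q.≈ u
      section-ε    : section ε ≈ ε
      c            : Cocycle² (U /lowerCentral[ n , p ]) p
      c-section    : ∀ u v → κ (Cocycle².fun c u v) (section u ∙ section v ∙ section (u ∙ v) ⁻¹)
      c~γ          : Cohomologous (U /lowerCentral[ n , p ]) p c γ

𝕌-modulus : (p n s : ℕ) → ℕ
𝕌-modulus p n s = p ℕ.^ suc (n ∸ s)

-- 𝕌ₛ₊₁(ℤ/pⁿ⁻ˢ⁺¹)
𝕌ₙ,ₛ : (p n s : ℕ) → TopGroup 0ℓ
𝕌ₙ,ₛ p n s = discrete (Matrices.𝕌 (ℤ/ 𝕌-modulus p n s) (suc s))

𝕌-kernel : (p n s : ℕ) → ℤ → TopGroup.Carrier (𝕌ₙ,ₛ p n s) → Set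
𝕌-kernel p n s a u = Matrices._≈ᴹ_ R (Matrices.toMatrix R u) (Matrices.I+_E R (a ℤ.* + (p ℕ.^ (n ∸ s))))
  where R = ℤ/ 𝕌-modulus p n s

Isγ : (p n s : ℕ) → Cocycle² (𝕌ₙ,ₛ p n s /lowerCentral[ n , p ]) p → Set
Isγ p n s = IsExtensionClass (𝕌ₙ,ₛ p n s) n p (𝕌-kernel p n s)

module Pairing {ℓ} {p} (p-prime : Prime p) {X : Set ℓ} {_<_ : Rel X ℓ}
               (<-isSTO : IsStrictTotalOrder _≡_ _<_)
               (S : ProfiniteGroup ℓ) (ι : X → ProfiniteGroup.Carrier S)
               (S-free : IsFreeProfinite S ι) (n : ℕ) where
  open ProfiniteGroup S
  open Words <-isSTO

  private instance
    p≢0 : NonZero p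
    p≢0 = prime⇒nonZero p-prime

  ρ : (w : Word) → ContinuousHom topGroup (𝕌ₙ,ₛ p n (length w))
  ρ w = Magnus.ρ (IsStrictTotalOrder._≟_ <-isSTO) S ι S-free
    (ℤ/ 𝕌-modulus p n (length w))
    (ℤ/-finite (𝕌-modulus p n (length w)) {{ℕₚ.m^n≢0 p (suc (n ∸ length w))}}) w

  -- The class α_{w,n} as a function of the class γ_{n,|w|}.
  α : (w : Word) → Cocycle² (𝕌ₙ,ₛ p n (length w) /lowerCentral[ n , p ]) p →
      Cocycle² (topGroup /lowerCentral[ n , p ]) p
  α w γ = pullback (induced (ρ w) n p) γ

  τ-power : Word → Carrier
  τ-power w = power group (τ group ι w) (p ℕ.^ (n ∸ length w))

  -- (τ_w^(p^(n-|w|)), α_{w′,n})ₙ = a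
  EntryIs : Word → Word → ℤ → Set ℓ
  EntryIs w w′ a =
    Σ[ τ∈ ∈ lowerCentral topGroup p n (τ-power w) ]
      The (H² (𝕌ₙ,ₛ p n (length w′) /lowerCentral[ n , p ]) p)
        (Isγ p n (length w′))
        (λ γ → PairingIs topGroup n p (τ-power w) τ∈ (α w′ γ) a)

  IsUpperTriangularUnipotent : (Lyndon≤ n → Lyndon≤ n → ℤ) → Set ℓ
  IsUpperTriangularUnipotent M =
    (∀ w w′ → proj₁ w ≡ proj₁ w′ → M w w′ ≡ 1ℤ [mod p ]) ×
    (∀ w w′ → proj₁ w′ ≺ proj₁ w → M w w′ ≡ 0ℤ [mod p ])

{-# OPTIONS --safe #-}

-- Write ρ for ρ^{w′}, s = |w′|, U = 𝕌ₛ₊₁(ℤ/pⁿ⁻ˢ⁺¹), and for u ∈ U let t(u) be the integral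
-- part of u₁,ₛ₊₁/pⁿ⁻ˢ, taken mod p.  As t(uz) = t(u) + a for z = I + apⁿ⁻ˢE ∈ U^(n,p),
-- the class γ is represented by −∂t, hence α_{w′,n} is the transgression of the restriction
-- of −t ∘ ρ to S^(n,p).  So (σ,α_{w′,n})ₙ = t(ρ(σ)), which is ε_{w′}(σ)/pⁿ⁻ˢ.
-- For a Lyndon word w with standard factorization w′w″ one has w < w″ < w″w′, and it
-- follows inductively from [g,h] = 1 + g⁻¹h⁻¹(gh − hg) that Λ(τ_w) = 1 + w + (terms at
-- words after w).  Raised to the power N = p^(n−|w|) this is 1 + Nw + (terms at
-- words after w), so that the entry (w,w) is N/N = 1 and the entries (w,w′) with w′ ≺ w vanish.
-- Applied to a word with distinct increasing letters, whose τ is taken in U itself, the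
-- same computation produces the generator I + pⁿ⁻ˢE of U^(n,p).

module Submission where

open import Defs
open import Algebra.Bundles using (Group; CommutativeRing)
import Algebra.Definitions.RawMonoid as RawMonoidOps
import Algebra.Properties.Group as GroupProperties
import Algebra.Properties.Monoid.Mult as MonoidMult
import Algebra.Properties.Semiring.Sum as SemiringSum
open import Data.Bool.Base using (Bool; true; false; if_then_else_; not)
import Data.Bool.Properties as Boolₚ
open import Data.Empty using (⊥-elim)
open import Data.Fin.Base using (Fin; zero; suc; toℕ; fromℕ)
import Data.Fin.Base as Fin
import Data.Fin.Properties as Finₚ
open import Data.Integer.Base as ℤ using (ℤ; +_; 0ℤ; 1ℤ)
import Data.Integer.DivMod as ℤD
import Data.Integer.Divisibility.Signed as ℤ∣
import Data.Integer.Properties as ℤₚ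
open import Data.Integer.Tactic.RingSolver using (solve-∀)
open import Data.List.Base using (List; []; _∷_; [_]; _++_; length; take; drop; applyUpTo)
import Data.List.Properties as Listₚ
import Data.List.Relation.Binary.Lex.Strict as Lex
import Data.List.Relation.Binary.Pointwise as Pointwise
open import Data.List.Relation.Unary.All using (All; []; _∷_)
import Data.List.Relation.Unary.All.Properties as Allₚ
open import Data.Nat.Base as ℕ using (ℕ; zero; suc; z≤n; s≤s; _∸_; _⊓_; _≤_; NonZero)
import Data.Nat.DivMod as ℕD
import Data.Nat.Divisibility as ℕ∣
open import Data.Nat.Primality using (Prime; prime⇒nonZero)
import Data.Nat.Properties as ℕₚ
open import Data.Product.Base using (∃-syntax; _×_; _,_; proj₁; proj₂)
open import Data.Sum.Base using (_⊎_; inj₁; inj₂)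
open import Data.Unit.Polymorphic.Base using (tt)
open import Data.Vec.Base using (Vec; []; _∷_; lookup)
open import Function.Base using (_∘_)
open import Function.Bundles using (Injection)
open import Level using (0ℓ)
open import Relation.Binary.Bundles using (Setoid)
open import Relation.Binary.Core using (Rel)
open import Relation.Binary.Definitions using (tri<; tri≈; tri>)
open import Relation.Binary.PropositionalEquality as ≡ using (_≡_; _≢_)
import Relation.Binary.Reasoning.Setoid as SetoidReasoning
open import Relation.Binary.Structures using (IsStrictTotalOrder)
open import Relation.Nullary using (Dec; yes; no; does; ¬_)
open Words using (Lyndon≤)
open Pairing using (EntryIs; IsUpperTriangularUnipotent)

-- Words in groups

-- The overview leaves open why U^(n,p) contains nothing but corner matrices. This bound comes from
-- a filtration of U whose level e demands that an entry at distance d above the diagonal be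
-- divisible by p^(e-d). Commutators with arbitrary elements and p-th powers raise e by one, and at
-- e = n every entry above the diagonal other than the corner is forced to vanish modulo pⁿ⁻ˢ⁺¹. The
-- pairing is a definite description twice over, so two uniqueness statements accompany the
-- computation. For γ, sections differ by values in U^(n,p). For the preimage under transgression, n
-- ≥ 2 enters: a continuous homomorphism S → ℤ/p vanishes on S^(n,p) only from level 2 on. Λ is
-- accessible only through its values on the generators. Leading terms are therefore computed for a
-- copy of τ_w in the unit group of the power series ring, and transported along the homomorphism
-- afterwards.

module GroupSolver {c ℓ} (G : Group c ℓ) where
  open Group G
  open GroupProperties G
  open SetoidReasoning setoid

  infixl 7 _⊕_

  data Expr (n : ℕ) : Set where
    var : Fin n → Expr n
    _⊕_ : Expr n → Expr n → Expr n
    inv : Expr n → Expr n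

  ⁅_,_⁆ : ∀ {n} → Expr n → Expr n → Expr n
  ⁅ e , f ⁆ = inv e ⊕ inv f ⊕ e ⊕ f

  Letter : ℕ → Set
  Letter n = Bool × Fin n

  cons : ∀ {n} → Letter n → List (Letter n) → List (Letter n)
  cons a [] = a ∷ []
  cons (b , i) ((b′ , i′) ∷ as) with b Boolₚ.≟ not b′ | i Finₚ.≟ i′
  ... | yes _ | yes _ = as
  ... | _     | _     = (b , i) ∷ (b′ , i′) ∷ as

  -- The boolean is the sign of the exponent and the list an accumulator, so that inverses are
  -- pushed to the variables and cancelled in a single pass.
  reduce : ∀ {n} → Bool → Expr n → List (Letter n) → List (Letter n)
  reduce b     (var i) as = cons (b , i) as
  reduce true  (e ⊕ f) as = reduce true e (reduce true f as)
  reduce false (e ⊕ f) as = reduce false f (reduce false e as)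
  reduce b     (inv e) as = reduce (not b) e as

  module _ {n} (ρ : Vec Carrier n) where

    ⟦_⟧ : Expr n → Carrier
    ⟦ var i ⟧ = lookup ρ i
    ⟦ e ⊕ f ⟧ = ⟦ e ⟧ ∙ ⟦ f ⟧
    ⟦ inv e ⟧ = ⟦ e ⟧ ⁻¹

    signed : Bool → Carrier → Carrier
    signed true  g = g
    signed false g = g ⁻¹

    ⟦_⟧ʷ : List (Letter n) → Carrier
    ⟦ [] ⟧ʷ           = ε
    ⟦ (b , i) ∷ as ⟧ʷ = signed b (lookup ρ i) ∙ ⟦ as ⟧ʷ

    signed-not : ∀ b g h → signed (not b) g ∙ (signed b g ∙ h) ≈ h
    signed-not true  g h = \\-leftDividesʳ g h
    signed-not false g h = \\-leftDividesˡ g h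

    signed-inv : ∀ b g → signed b (g ⁻¹) ≈ signed (not b) g
    signed-inv true  g = refl
    signed-inv false g = ⁻¹-involutive g

    cons-correct : ∀ a as → ⟦ cons a as ⟧ʷ ≈ ⟦ a ∷ as ⟧ʷ
    cons-correct a [] = refl
    cons-correct (b , i) ((b′ , i′) ∷ as) with b Boolₚ.≟ not b′ | i Finₚ.≟ i′
    ... | yes ≡.refl | yes ≡.refl = sym (signed-not b′ (lookup ρ i) ⟦ as ⟧ʷ)
    ... | yes _      | no _       = refl
    ... | no _       | yes _      = refl
    ... | no _       | no _       = refl

    reduce-correct : ∀ b e as → ⟦ reduce b e as ⟧ʷ ≈ signed b ⟦ e ⟧ ∙ ⟦ as ⟧ʷ
    reduce-correct b     (var i) as = cons-correct (b , i) as
    reduce-correct true  (e ⊕ f) as = begin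
      ⟦ reduce true e (reduce true f as) ⟧ʷ ≈⟨ reduce-correct true e _ ⟩
      ⟦ e ⟧ ∙ ⟦ reduce true f as ⟧ʷ         ≈⟨ ∙-congˡ (reduce-correct true f as) ⟩
      ⟦ e ⟧ ∙ (⟦ f ⟧ ∙ ⟦ as ⟧ʷ)             ≈⟨ assoc _ _ _ ⟨
      ⟦ e ⟧ ∙ ⟦ f ⟧ ∙ ⟦ as ⟧ʷ               ∎
    reduce-correct false (e ⊕ f) as = begin
      ⟦ reduce false f (reduce false e as) ⟧ʷ ≈⟨ reduce-correct false f _ ⟩
      ⟦ f ⟧ ⁻¹ ∙ ⟦ reduce false e as ⟧ʷ       ≈⟨ ∙-congˡ (reduce-correct false e as) ⟩
      ⟦ f ⟧ ⁻¹ ∙ (⟦ e ⟧ ⁻¹ ∙ ⟦ as ⟧ʷ)         ≈⟨ assoc _ _ _ ⟨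
      ⟦ f ⟧ ⁻¹ ∙ ⟦ e ⟧ ⁻¹ ∙ ⟦ as ⟧ʷ           ≈⟨ ∙-congʳ (⁻¹-anti-homo-∙ _ _) ⟨
      (⟦ e ⟧ ∙ ⟦ f ⟧) ⁻¹ ∙ ⟦ as ⟧ʷ            ∎
    reduce-correct b (inv e) as =
      trans (reduce-correct (not b) e as) (∙-congʳ (sym (signed-inv b ⟦ e ⟧)))

    -- Normal forms are freely reduced words, so for an identity valid in free groups the hypothesis
    -- holds by computation and `≡.refl` proves it.
    solve : ∀ e f → reduce true e [] ≡ reduce true f [] → ⟦ e ⟧ ≈ ⟦ f ⟧
    solve e f eq = begin
      ⟦ e ⟧                    ≈⟨ identityʳ _ ⟨
      ⟦ e ⟧ ∙ ε                ≈⟨ reduce-correct true e [] ⟨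
      ⟦ reduce true e [] ⟧ʷ    ≡⟨ ≡.cong ⟦_⟧ʷ eq ⟩
      ⟦ reduce true f [] ⟧ʷ    ≈⟨ reduce-correct true f [] ⟩
      ⟦ f ⟧ ∙ ε                ≈⟨ identityʳ _ ⟩
      ⟦ f ⟧                    ∎

-- The descending p-central series

module _ {ℓ} (G : TopGroup ℓ) where
  open TopGroup G
  open GroupSolver group

  private
    ⟨_,_⟩ : Carrier → Carrier → Carrier
    ⟨ g , h ⟩ = commutator group g h

    pattern #0 = var zero
    pattern #1 = var (suc zero)
    pattern #2 = var (suc (suc zero))

  module _ {N : Carrier → Set ℓ} (isNormal : IsNormalSubgroup G N) where
    open IsNormalSubgroup isNormal

    commutator-sym : ∀ g h → N ⟨ g , h ⟩ → N ⟨ h , g ⟩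
    commutator-sym g h [g,h]∈ = N-resp
      (solve (g ∷ h ∷ []) (inv ⁅ #0 , #1 ⁆) ⁅ #1 , #0 ⁆ ≡.refl) (N-⁻¹ [g,h]∈)

    -- [g⁻¹,h] is the conjugate of [g,h]⁻¹ by g⁻¹.
    commutator-inverseˡ : ∀ g h → N ⟨ g , h ⟩ → N ⟨ g ⁻¹ , h ⟩
    commutator-inverseˡ g h [g,h]∈ = N-resp
      (solve (g ∷ h ∷ []) (inv (inv #0) ⊕ inv ⁅ #0 , #1 ⁆ ⊕ inv #0) ⁅ inv #0 , #1 ⁆ ≡.refl)
      (N-conj (g ⁻¹) (N-⁻¹ [g,h]∈))

    -- The Hall–Witt identity.
    three-subgroups : ∀ a b h → N ⟨ a , ⟨ b ⁻¹ , h ⁻¹ ⟩ ⟩ → N ⟨ b ⁻¹ , ⟨ h , a ⁻¹ ⟩ ⟩ →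
                      N ⟨ ⟨ a , b ⟩ , h ⟩
    three-subgroups a b h r∈ s∈ = N-resp
      (solve (a ∷ b ∷ h ∷ [])
        (inv #1 ⊕ (inv #0 ⊕ ⁅ inv #1 , ⁅ #2 , inv #0 ⁆ ⁆ ⊕ #0 ⊕ (inv #2 ⊕ ⁅ #0 , ⁅ inv #1 , inv #2 ⁆ ⁆ ⊕ #2)) ⊕ #1)
        ⁅ ⁅ #0 , #1 ⁆ , #2 ⁆ ≡.refl)
      (N-conj b (N-∙ (N-conj a s∈) (N-conj h r∈)))

  module _ (p : ℕ) where
    private
      N : ℕ → Carrier → Set ℓ
      N = lowerCentral G p

    commutator∈ : ∀ k g {h} → N (suc k) h → N (suc (suc k)) ⟨ g , h ⟩
    commutator∈ k g h∈ i = _ , gen (comm g h∈) , ≈[]-refl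

    pth-power∈ : ∀ k {h} → N (suc k) h → N (suc (suc k)) (power group h p)
    pth-power∈ k h∈ i = _ , gen (pth-power h∈) , ≈[]-refl

    p^-power∈ : ∀ m k {h} → N (suc k) h → N (suc (m ℕ.+ k)) (power group h (p ℕ.^ m))
    p^-power∈ zero    k     h∈ = IsNormalSubgroup.N-resp (lowerCentral-isNormal G p (suc k))
      (sym (identityʳ _)) h∈
    p^-power∈ (suc m) k {h} h∈ = IsNormalSubgroup.N-resp (lowerCentral-isNormal G p (suc (suc (m ℕ.+ k))))
      (MonoidMult.×-assocˡ monoid h p (p ℕ.^ m)) (pth-power∈ (m ℕ.+ k) (p^-power∈ m k h∈))

    -- All that is needed to know about g ∈ γ_k(G), the ordinary lower central series.
    -- With N in place of Deep, commutator-deep would have to deal with p-th powers and closures.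
    Deep : ℕ → Carrier → Set ℓ
    Deep k g = N k g × (∀ j {h} → N (suc j) h → N (k ℕ.+ suc j) ⟨ g , h ⟩)

    deep-1 : ∀ g → Deep 1 g
    deep-1 g = tt , λ j h∈ → commutator∈ j g h∈

    -- By the Hall-Witt identity [[a,b],h] is controlled by [a,[b⁻¹,h⁻¹]] and [b⁻¹,[h,a⁻¹]]. In each
    -- of these the inner and the outer commutator raise the level of h by i + 1 and k + 1 in some
    -- order.
    commutator-deep : ∀ {i k a b} → Deep (suc i) a → Deep (suc k) b →
                      Deep (suc i ℕ.+ suc k) ⟨ a , b ⟩
    commutator-deep {i} {k} {a} {b} (_ , [a,-]∈) (b∈ , [b,-]∈) = [a,-]∈ k b∈ , λ j {h} h∈ →
      let
        [b⁻¹,h⁻¹]∈ = commutator-inverseˡ (lowerCentral-isNormal G p (suc (k ℕ.+ suc j))) b (h ⁻¹)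
          ([b,-]∈ j (IsNormalSubgroup.N-⁻¹ (lowerCentral-isNormal G p (suc j)) h∈))
        [h,a⁻¹]∈ = commutator-sym (lowerCentral-isNormal G p (suc (i ℕ.+ suc j))) (a ⁻¹) h
          (commutator-inverseˡ (lowerCentral-isNormal G p (suc (i ℕ.+ suc j))) a h ([a,-]∈ j h∈))
        isNormal = lowerCentral-isNormal G p (suc (i ℕ.+ suc k ℕ.+ suc j))
      in three-subgroups isNormal a b h
           (≡.subst (λ m → N m ⟨ a , ⟨ b ⁻¹ , h ⁻¹ ⟩ ⟩) (≡.sym (ℕₚ.+-assoc (suc i) (suc k) (suc j)))
             ([a,-]∈ (k ℕ.+ suc j) [b⁻¹,h⁻¹]∈))
           (commutator-inverseˡ isNormal b ⟨ h , a ⁻¹ ⟩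
             (≡.subst (λ m → N m ⟨ b , ⟨ h , a ⁻¹ ⟩ ⟩)
               (≡.trans (≡.sym (ℕₚ.+-assoc (suc k) (suc i) (suc j)))
                 (≡.cong (ℕ._+ suc j) (ℕₚ.+-comm (suc k) (suc i))))
               ([b,-]∈ (i ℕ.+ suc j) [h,a⁻¹]∈)))

-- Lyndon words

module StandardFactorization {ℓ} {X : Set ℓ} {_<_ : Rel X ℓ} (<-isSTO : IsStrictTotalOrder _≡_ _<_) where
  open Words <-isSTO

  private
    module < = IsStrictTotalOrder <-isSTO
    module <alp = IsStrictTotalOrder (Lex.<-isStrictTotalOrder <-isSTO)

  <alp-trans : ∀ {u v w} → u <alp v → v <alp w → u <alp w
  <alp-trans = <alp.trans

  <alp-irrefl : ∀ {u} → ¬ u <alp u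
  <alp-irrefl = <alp.irrefl (Pointwise.refl ≡.refl)

  <alp-cmp : ∀ u v → u <alp v ⊎ u ≡ v ⊎ v <alp u
  <alp-cmp u v with <alp.compare u v
  ... | tri< u<v _ _ = inj₁ u<v
  ... | tri≈ _ u≋v _ = inj₂ (inj₁ (Pointwise.Pointwise-≡⇒≡ u≋v))
  ... | tri> _ _ v<u = inj₂ (inj₂ v<u)

  <alp-++ˡ : ∀ w {u v} → u <alp v → w ++ u <alp w ++ v
  <alp-++ˡ []      u<v = u<v
  <alp-++ˡ (x ∷ w) u<v = Lex.next ≡.refl (<alp-++ˡ w u<v)

  <alp-++ˡ⁻ : ∀ w {u v} → w ++ u <alp w ++ v → u <alp v
  <alp-++ˡ⁻ []      u<v               = u<v
  <alp-++ˡ⁻ (x ∷ w) (Lex.this x<x)    = ⊥-elim (<.irrefl ≡.refl x<x)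
  <alp-++ˡ⁻ (x ∷ w) (Lex.next _ u<v)  = <alp-++ˡ⁻ w u<v

  <alp-++ʳ : ∀ {u v} w → u <alp v → u <alp v ++ w
  <alp-++ʳ w Lex.halt           = Lex.halt
  <alp-++ʳ w (Lex.this x<y)     = Lex.this x<y
  <alp-++ʳ w (Lex.next x≡y u<v) = Lex.next x≡y (<alp-++ʳ w u<v)

  -- A comparison u <alp v is decided by a letter unless u is a prefix of v,
  -- so that it survives appending words on both sides.
  <alp-++ : ∀ {u v} a b → length v ℕ.≤ length u → u <alp v → u ++ a <alp v ++ b
  <alp-++ a b (s≤s |v|≤|u|) (Lex.this x<y)     = Lex.this x<y
  <alp-++ a b (s≤s |v|≤|u|) (Lex.next x≡y u<v) = Lex.next x≡y (<alp-++ a b |v|≤|u| u<v)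

  IsSmallestSuffix : Rel Word ℓ
  IsSmallestSuffix m w = ∀ u v → v ≢ [] → w ≡ u ++ v → m ≡ v ⊎ m <alp v

  smallestSuffix-isLyndon : ∀ {m} → m ≢ [] → IsSmallestSuffix m m → IsLyndon m
  smallestSuffix-isLyndon {m} m≢[] m≤ = m≢[] , λ u v u≢[] v≢[] m≡uv →
    strict u≢[] m≡uv (m≤ u v v≢[] m≡uv)
    where
    strict : ∀ {u v} → u ≢ [] → m ≡ u ++ v → m ≡ v ⊎ m <alp v → m <alp v
    strict u≢[] m≡uv (inj₁ ≡.refl) = ⊥-elim (u≢[] (Listₚ.++-identityˡ-unique _ m≡uv))
    strict _    _    (inj₂ m<v)    = m<v

  -- The longest proper Lyndon suffix is also the alphabetically least nonempty proper suffix. The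
  -- second description is the one recorded, because comparisons alone then show that the factors
  -- are Lyndon words.
  record IsStandard (w w′ w″ : Word) : Set ℓ where
    field
      factors  : w ≡ w′ ++ w″
      left≢[]  : w′ ≢ []
      right≢[] : w″ ≢ []
      smallest : ∀ u v → u ≢ [] → v ≢ [] → w ≡ u ++ v → w″ ≡ v ⊎ w″ <alp v

    length-factors : length w ≡ length w′ ℕ.+ length w″
    length-factors = ≡.trans (≡.cong length factors) (Listₚ.length-++ w′)

    right-isLyndon : IsLyndon w″
    right-isLyndon = smallestSuffix-isLyndon right≢[] λ u v v≢[] w″≡uv →
      smallest (w′ ++ u) v (λ w′u≡[] → left≢[] (Listₚ.++-conicalˡ w′ u w′u≡[])) v≢[]
        (≡.trans factors (≡.trans (≡.cong (w′ ++_) w″≡uv) (≡.sym (Listₚ.++-assoc w′ u v))))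

    -- If a proper suffix v of w′ came before w′, then w < vw″ would force v to be a prefix, w′ =
    -- vt. Cancelling v leaves tw″ < w″, against the minimality of w″ among the proper suffixes of
    -- w.
    left-isLyndon : IsLyndon w → IsLyndon w′
    left-isLyndon (_ , w<) = left≢[] , below
      where
      below : ∀ u v → u ≢ [] → v ≢ [] → w′ ≡ u ++ v → w′ <alp v
      below u v u≢[] v≢[] w′≡uv with <alp-cmp w′ v
      ... | inj₁ w′<v = w′<v
      ... | inj₂ (inj₁ w′≡v) = ⊥-elim (u≢[] (Listₚ.++-identityˡ-unique u (≡.trans (≡.sym w′≡v) w′≡uv)))
      ... | inj₂ (inj₂ v<w′) = ⊥-elim (contradiction (prefix v w′ v<w′ w<vw″))
        where
        w≡u,vw″ : w ≡ u ++ (v ++ w″)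
        w≡u,vw″ = ≡.trans factors (≡.trans (≡.cong (_++ w″) w′≡uv) (Listₚ.++-assoc u v w″))
        w<vw″ : w′ ++ w″ <alp v ++ w″
        w<vw″ = ≡.subst (_<alp v ++ w″) factors
          (w< u (v ++ w″) u≢[] (λ vw″≡[] → v≢[] (Listₚ.++-conicalˡ v w″ vw″≡[])) w≡u,vw″)
        -- Otherwise v and w′ differ at a letter, so that vw″ < w′w″ = w.
        prefix : ∀ v w′ → v <alp w′ → w′ ++ w″ <alp v ++ w″ → ∃[ t ] t ≢ [] × w′ ≡ v ++ t
        prefix []      (y ∷ w′) Lex.halt lt = y ∷ w′ , (λ ()) , ≡.refl
        prefix (x ∷ v) (y ∷ w′) (Lex.this x<y) lt =
          ⊥-elim (<alp-irrefl (<alp-trans (Lex.this x<y) lt))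
        prefix (x ∷ v) (x ∷ w′) (Lex.next ≡.refl v<w′) lt =
          let t , t≢[] , w′≡vt = prefix v w′ v<w′ (<alp-++ˡ⁻ (x ∷ []) lt)
          in t , t≢[] , ≡.cong (x ∷_) w′≡vt
        contradiction : ¬ (∃[ t ] t ≢ [] × w′ ≡ v ++ t)
        contradiction (t , t≢[] , w′≡vt) with
          smallest v (t ++ w″) v≢[] (λ tw″≡[] → t≢[] (Listₚ.++-conicalˡ t w″ tw″≡[]))
            (≡.trans factors (≡.trans (≡.cong (_++ w″) w′≡vt) (Listₚ.++-assoc v t w″)))
        ... | inj₁ w″≡tw″ = t≢[] (Listₚ.++-identityˡ-unique t w″≡tw″)
        ... | inj₂ w″<tw″ = <alp-irrefl (<alp-trans w″<tw″ tw″<w″)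
          where
          tw″<w″ : t ++ w″ <alp w″
          tw″<w″ = <alp-++ˡ⁻ v (≡.subst (_<alp v ++ w″)
            (≡.trans (≡.cong (_++ w″) w′≡vt) (Listₚ.++-assoc v t w″)) w<vw″)

  -- The scan stops at the first, hence longest, Lyndon suffix, and this is the least suffix.
  -- Indeed, if xv is not Lyndon, the least suffix b of v satisfies b ≤ xv; otherwise xv would
  -- precede b and so all suffixes of v, which makes it Lyndon.
  splitLyndon-smallest : ∀ u v → v ≢ [] → ∃[ a ] ∃[ b ]
    splitLyndon u v ≡ (u ++ a , b) × v ≡ a ++ b × b ≢ [] × IsSmallestSuffix b v
  splitLyndon-smallest u [] v≢[] = ⊥-elim (v≢[] ≡.refl)
  splitLyndon-smallest u (x ∷ v) _ with isLyndon? (x ∷ v)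
  ... | yes (xv≢[] , below) =
    [] , x ∷ v , ≡.cong (_, x ∷ v) (≡.sym (Listₚ.++-identityʳ u)) , ≡.refl , xv≢[] , λ where
      []      t _    eq → inj₁ eq
      (_ ∷ s) t t≢[] eq → inj₂ (below (_ ∷ s) t (λ ()) t≢[] eq)
  splitLyndon-smallest u (x ∷ []) _ | no ¬lyndon =
    ⊥-elim (¬lyndon (smallestSuffix-isLyndon (λ ()) λ where
      []      t _    eq → inj₁ eq
      (_ ∷ s) t t≢[] eq → ⊥-elim (t≢[] (Listₚ.++-conicalʳ s t (≡.sym (Listₚ.∷-injectiveʳ eq))))))
  splitLyndon-smallest u (x ∷ v@(_ ∷ _)) _ | no ¬lyndon
    with splitLyndon-smallest (u ++ [ x ]) v (λ ())
  ... | a , b , split≡ , v≡ab , b≢[] , b≤ =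
    x ∷ a , b , ≡.trans split≡ (≡.cong (_, b) (Listₚ.++-assoc u [ x ] a)) , ≡.cong (x ∷_) v≡ab , b≢[] , λ where
      []      t _    eq → ≡.subst (λ t → b ≡ t ⊎ b <alp t) eq b≤xv
      (_ ∷ s) t t≢[] eq → b≤ s t t≢[] (Listₚ.∷-injectiveʳ eq)
    where
    b≤xv : b ≡ x ∷ v ⊎ b <alp x ∷ v
    b≤xv with <alp-cmp b (x ∷ v)
    ... | inj₁ b<xv         = inj₂ b<xv
    ... | inj₂ (inj₁ b≡xv)  = inj₁ b≡xv
    ... | inj₂ (inj₂ xv<b)  = ⊥-elim (¬lyndon (smallestSuffix-isLyndon (λ ()) λ where
      []      t _    eq → inj₁ eq
      (_ ∷ s) t t≢[] eq → inj₂ (below (b≤ s t t≢[] (Listₚ.∷-injectiveʳ eq)))))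
      where
      below : ∀ {t} → b ≡ t ⊎ b <alp t → x ∷ v <alp t
      below (inj₁ ≡.refl) = xv<b
      below (inj₂ b<t)    = <alp-trans xv<b b<t

  standardFactorization-isStandard : ∀ x y v → let w = x ∷ y ∷ v in
    IsStandard w (proj₁ (standardFactorization w)) (proj₂ (standardFactorization w))
  standardFactorization-isStandard x y v with splitLyndon-smallest [ x ] (y ∷ v) (λ ())
  ... | a , b , split≡ , yv≡ab , b≢[] , b≤ rewrite split≡ = record
    { factors  = ≡.cong (x ∷_) yv≡ab
    ; left≢[]  = λ ()
    ; right≢[] = b≢[]
    ; smallest = λ where
        []      t u≢[] _    _  → ⊥-elim (u≢[] ≡.refl)
        (_ ∷ s) t _    t≢[] eq → b≤ s t t≢[] (Listₚ.∷-injectiveʳ eq)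
    }

  module _ {c ℓ′} (G : Group c ℓ′) (ι : X → Group.Carrier G) where
    open Group G using (Carrier)

    -- This hides the fuel of `bracketing`. The factors of a word are bracketed with more fuel than
    -- `τ` would give them, so `go` has to treat every k ≥ |w|.
    τ-induction : ∀ {q} (Q : Word → Carrier → Set q) → (∀ x → Q [ x ] (ι x)) →
      (∀ {w w′ w″ g h} → IsStandard w w′ w″ → Q w′ g → Q w″ h → Q w (commutator G g h)) →
      ∀ w → w ≢ [] → Q w (τ G ι w)
    τ-induction Q Q-ι Q-commutator w w≢[] = go (length w) w ℕₚ.≤-refl w≢[]
      where
      go : ∀ k w → length w ℕ.≤ k → w ≢ [] → Q w (bracketing G ι k w)
      go zero    []          _    w≢[] = ⊥-elim (w≢[] ≡.refl)
      go (suc k) []          _    w≢[] = ⊥-elim (w≢[] ≡.refl)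
      go (suc k) (x ∷ [])    _    _    = Q-ι x
      go (suc k) w@(x ∷ y ∷ v) |w|≤ _  = Q-commutator standard
        (go k _ (bound |w′|<|w|) left≢[]) (go k _ (bound |w″|<|w|) right≢[])
        where
        standard = standardFactorization-isStandard x y v
        open IsStandard standard
        w′ = proj₁ (standardFactorization w)
        w″ = proj₂ (standardFactorization w)
        bound : ∀ {m} → m ℕ.< length w → m ℕ.≤ k
        bound m<|w| = ℕ.s≤s⁻¹ (ℕₚ.≤-trans m<|w| |w|≤)
        positive : ∀ {u : Word} → u ≢ [] → 0 ℕ.< length u
        positive {[]}    u≢[] = ⊥-elim (u≢[] ≡.refl)
        positive {_ ∷ _} _    = s≤s z≤n
        |w′|<|w| : length w′ ℕ.< length w
        |w′|<|w| = ≡.subst (length w′ ℕ.<_) (≡.sym length-factors) (ℕₚ.m<m+n _ (positive right≢[]))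
        |w″|<|w| : length w″ ℕ.< length w
        |w″|<|w| = ≡.subst (length w″ ℕ.<_) (≡.sym length-factors) (ℕₚ.m<n+m _ (positive left≢[]))

  module _ {c ℓ₁ d ℓ₂} {G : Group c ℓ₁} {H : Group d ℓ₂} {r}
           (_∼_ : Group.Carrier G → Group.Carrier H → Set r)
           (∼-ε : Group.ε G ∼ Group.ε H)
           (∼-∙ : ∀ {g g′ h h′} → g ∼ h → g′ ∼ h′ → Group._∙_ G g g′ ∼ Group._∙_ H h h′)
           (∼-⁻¹ : ∀ {g h} → g ∼ h → Group._⁻¹ G g ∼ Group._⁻¹ H h) where

    power-related : ∀ {g h} n → g ∼ h → power G g n ∼ power H h n
    power-related zero    _   = ∼-ε
    power-related (suc n) g∼h = ∼-∙ g∼h (power-related n g∼h)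

    -- Stated for relations rather than homomorphisms, so that it covers both the graph of a
    -- homomorphism and the relation `_represents_` between matrices and series.
    bracketing-related : ∀ {ι κ} → (∀ x → ι x ∼ κ x) → ∀ k w → bracketing G ι k w ∼ bracketing H κ k w
    bracketing-related ι∼κ zero    w             = ∼-ε
    bracketing-related ι∼κ (suc k) []            = ∼-ε
    bracketing-related ι∼κ (suc k) (x ∷ [])      = ι∼κ x
    bracketing-related ι∼κ (suc k) (_ ∷ _ ∷ _)   =
      ∼-∙ (∼-∙ (∼-∙ (∼-⁻¹ rec₁) (∼-⁻¹ rec₂)) rec₁) rec₂
      where
      rec₁ = bracketing-related ι∼κ k _
      rec₂ = bracketing-related ι∼κ k _

  module _ {ℓ′} (G : TopGroup ℓ′) (ι : X → TopGroup.Carrier G) (p : ℕ) where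
    open TopGroup G using (group)

    τ-deep : ∀ w → w ≢ [] → Deep G p (length w) (τ group ι w)
    τ-deep = τ-induction group ι (λ w → Deep G p (length w)) (λ x → deep-1 G p (ι x)) step
      where
      step : ∀ {w w′ w″ g h} → IsStandard w w′ w″ → Deep G p (length w′) g → Deep G p (length w″) h →
             Deep G p (length w) (commutator group g h)
      step {w′ = []}            standard _ _ = ⊥-elim (IsStandard.left≢[] standard ≡.refl)
      step {w′ = _ ∷ _} {[]}    standard _ _ = ⊥-elim (IsStandard.right≢[] standard ≡.refl)
      step {w′ = x ∷ w′} {y ∷ w″} standard g∈ h∈ =
        ≡.subst (λ k → Deep G p k _) (≡.sym (IsStandard.length-factors standard))
          (commutator-deep G p {length w′} {length w″} g∈ h∈)

    τ-power∈lowerCentral : ∀ n w → w ≢ [] → length w ℕ.≤ n →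
      lowerCentral G p n (power group (τ group ι w) (p ℕ.^ (n ℕ.∸ length w)))
    τ-power∈lowerCentral n []      w≢[] _ = ⊥-elim (w≢[] ≡.refl)
    τ-power∈lowerCentral n w@(_ ∷ v) w≢[] |w|≤n = ≡.subst
      (λ k → lowerCentral G p k (power group (τ group ι w) (p ℕ.^ (n ℕ.∸ length w))))
      (≡.trans (≡.sym (ℕₚ.+-suc (n ℕ.∸ length w) (length v))) (ℕₚ.m∸n+n≡m |w|≤n))
      (p^-power∈ G p (n ℕ.∸ length w) (length v) (proj₁ (τ-deep w w≢[])))

-- Coefficients of the Magnus expansion

module SeriesSplitting {ℓ} (X : Set ℓ) (R : CommutativeRing 0ℓ 0ℓ) where
  open CommutativeRing R hiding (zero)
  open PowerSeries X R
  open SetoidReasoning setoid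

  reduced : Series → Series
  reduced f []      = 0#
  reduced f (x ∷ w) = f (x ∷ w)

  reduced-* : ∀ f g u v → (u ≢ [] → v ≢ [] → f u * g v ≈ 0#) → reduced f u * reduced g v ≈ 0#
  reduced-* f g []      v       _ = zeroˡ _
  reduced-* f g (_ ∷ _) []      _ = zeroʳ _
  reduced-* f g (_ ∷ _) (_ ∷ _) h = h (λ ()) (λ ())

  ⊛-vanish : ∀ f g w → (∀ u v → w ≡ u ++ v → f u * g v ≈ 0#) → (f ⊛ g) w ≈ 0#
  ⊛-vanish f g []      fg≈0 = fg≈0 [] [] ≡.refl
  ⊛-vanish f g (x ∷ w) fg≈0 = trans
    (+-cong (fg≈0 [] (x ∷ w) ≡.refl)
            (⊛-vanish (f ∘ (x ∷_)) g w (λ u v eq → fg≈0 (x ∷ u) v (≡.cong (x ∷_) eq))))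
    (+-identityˡ 0#)

  ⊛-single : ∀ f g a b → (∀ u v → a ++ b ≡ u ++ v → u ≢ a → f u * g v ≈ 0#) →
             (f ⊛ g) (a ++ b) ≈ f a * g b
  ⊛-single f g []      []      fg≈0 = refl
  ⊛-single f g []      (x ∷ b) fg≈0 = trans
    (+-congˡ (⊛-vanish (f ∘ (x ∷_)) g b (λ u v eq → fg≈0 (x ∷ u) v (≡.cong (x ∷_) eq) (λ ()))))
    (+-identityʳ _)
  ⊛-single f g (x ∷ a) b       fg≈0 = trans
    (+-cong (fg≈0 [] (x ∷ a ++ b) ≡.refl (λ ()))
            (⊛-single (f ∘ (x ∷_)) g a b (λ u v eq u≢a →
              fg≈0 (x ∷ u) v (≡.cong (x ∷_) eq) (u≢a ∘ Listₚ.∷-injectiveʳ))))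
    (+-identityˡ _)

  ⊛-reducedʳ : ∀ f g w → (f ⊛ g) w ≈ (f ⊛ reduced g) w + f w * g []
  ⊛-reducedʳ f g []      = sym (trans (+-congʳ (zeroʳ _)) (+-identityˡ _))
  ⊛-reducedʳ f g (x ∷ w) = trans (+-congˡ (⊛-reducedʳ (f ∘ (x ∷_)) g w)) (sym (+-assoc _ _ _))

  -- (1 + f)(1 + g) = 1 + f + g + fg
  ⊛-expand : ∀ f g w → f [] ≈ 1# → g [] ≈ 1# → w ≢ [] →
             (f ⊛ g) w ≈ f w + g w + (reduced f ⊛ reduced g) w
  ⊛-expand f g []      _     _     w≢[] = ⊥-elim (w≢[] ≡.refl)
  ⊛-expand f g (x ∷ w) f[]≈1 g[]≈1 _    = begin
    (f ⊛ g) (x ∷ w)                            ≈⟨ ⊛-reducedʳ f g (x ∷ w) ⟩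
    f [] * g (x ∷ w) + s + f (x ∷ w) * g []    ≈⟨ +-cong
      (+-congʳ (trans (*-congʳ f[]≈1) (*-identityˡ _))) (trans (*-congˡ g[]≈1) (*-identityʳ _)) ⟩
    g (x ∷ w) + s + f (x ∷ w)                  ≈⟨ +-comm _ _ ⟩
    f (x ∷ w) + (g (x ∷ w) + s)                ≈⟨ +-assoc _ _ _ ⟨
    f (x ∷ w) + g (x ∷ w) + s                  ≈⟨ +-congˡ (trans (+-congʳ (zeroˡ _)) (+-identityˡ _)) ⟨
    f (x ∷ w) + g (x ∷ w) + (0# * g (x ∷ w) + s) ∎
    where s = ((f ∘ (x ∷_)) ⊛ reduced g) w

-- Leading terms of commutators and powers

module LeadingWords {ℓ} {X : Set ℓ} {_<_ : Rel X ℓ} (<-isSTO : IsStrictTotalOrder _≡_ _<_)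
                    (R : CommutativeRing 0ℓ 0ℓ) where
  open Words <-isSTO
  open StandardFactorization <-isSTO
  open CommutativeRing R hiding (zero; -_)
  open GroupProperties +-group using () renaming (∙-cancelˡ to +-cancelˡ)
  open PowerSeries X R
  open SeriesSplitting X R
  open SetoidReasoning setoid
  private
    module < = IsStrictTotalOrder <-isSTO
    module Units = Group (units seriesMonoid)

  infix 4 _⊰_ _⊴_

  -- `_⊰_` is ≺ with the disequality absorbed into a strict alphabetical comparison.
  _⊰_ _⊴_ : Rel Word ℓ
  u ⊰ w = length u ℕ.< length w ⊎ (length u ≡ length w × u <alp w)
  u ⊴ w = u ⊰ w ⊎ u ≡ w

  ≺⇒⊰ : ∀ {u w} → u ≺ w → u ⊰ w
  ≺⇒⊰ (inj₁ |u|<|w| , _) = inj₁ |u|<|w|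
  ≺⇒⊰ (inj₂ (|u|≡|w| , u≤w) , u≢w) = inj₂ (|u|≡|w| , strict u≤w u≢w)
    where
    strict : ∀ {u w} → u ≤alp w → u ≢ w → u <alp w
    strict (Lex.base _)         u≢w = ⊥-elim (u≢w ≡.refl)
    strict Lex.halt             _   = Lex.halt
    strict (Lex.this x<y)       _   = Lex.this x<y
    strict (Lex.next ≡.refl u≤w) u≢w = Lex.next ≡.refl (strict u≤w (u≢w ∘ ≡.cong (_ ∷_)))

  ⊴⇒≤ : ∀ {u w} → u ⊴ w → length u ℕ.≤ length w
  ⊴⇒≤ (inj₁ (inj₁ |u|<|w|))       = ℕₚ.<⇒≤ |u|<|w|
  ⊴⇒≤ (inj₁ (inj₂ (|u|≡|w| , _))) = ℕₚ.≤-reflexive |u|≡|w|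
  ⊴⇒≤ (inj₂ ≡.refl)               = ℕₚ.≤-refl

  ⊴⇒≯ : ∀ {u w} → u ⊴ w → length u ≡ length w → ¬ w <alp u
  ⊴⇒≯ (inj₁ (inj₁ |u|<|w|))   |u|≡|w| _   = ℕₚ.<-irrefl |u|≡|w| |u|<|w|
  ⊴⇒≯ (inj₁ (inj₂ (_ , u<w))) _       w<u = <alp-irrefl (<alp-trans u<w w<u)
  ⊴⇒≯ (inj₂ ≡.refl)           _       w<u = <alp-irrefl w<u

  ⊰-irrefl : ∀ {u} → ¬ u ⊰ u
  ⊰-irrefl (inj₁ |u|<|u|)   = ℕₚ.<-irrefl ≡.refl |u|<|u|
  ⊰-irrefl (inj₂ (_ , u<u)) = <alp-irrefl u<u

  -- If f and g have leading words v and w, the first two alternatives are those in which f a * g b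
  -- vanishes. The length bound excludes that one factor is longer and the other not shorter. If
  -- both lengths agree, the first difference between the factors decides the comparison of the
  -- concatenations.
  ++-compare : ∀ a b v w → length (a ++ b) ℕ.≤ length (v ++ w) →
    a ⊰ v ⊎ b ⊰ w ⊎ (a ≡ v × b ≡ w) ⊎ (length (a ++ b) ≡ length (v ++ w) × v ++ w <alp a ++ b)
  ++-compare a b v w |ab|≤|vw| with ℕₚ.<-cmp (length a) (length v) | ℕₚ.<-cmp (length b) (length w)
  ... | tri< |a|<|v| _ _ | _                = inj₁ (inj₁ |a|<|v|)
  ... | _                | tri< |b|<|w| _ _ = inj₂ (inj₁ (inj₁ |b|<|w|))
  ... | tri> _ _ |v|<|a| | tri≈ _ |b|≡|w| _ = ⊥-elim (ℕₚ.<⇒≱ (ℕₚ.+-mono-<-≤ |v|<|a| (ℕₚ.≤-reflexive (≡.sym |b|≡|w|)))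
    (≡.subst₂ ℕ._≤_ (Listₚ.length-++ a) (Listₚ.length-++ v) |ab|≤|vw|))
  ... | tri> _ _ |v|<|a| | tri> _ _ |w|<|b| = ⊥-elim (ℕₚ.<⇒≱ (ℕₚ.+-mono-< |v|<|a| |w|<|b|)
    (≡.subst₂ ℕ._≤_ (Listₚ.length-++ a) (Listₚ.length-++ v) |ab|≤|vw|))
  ... | tri≈ _ |a|≡|v| _ | tri> _ _ |w|<|b| = ⊥-elim (ℕₚ.<⇒≱ (ℕₚ.+-mono-≤-< (ℕₚ.≤-reflexive (≡.sym |a|≡|v|)) |w|<|b|)
    (≡.subst₂ ℕ._≤_ (Listₚ.length-++ a) (Listₚ.length-++ v) |ab|≤|vw|))
  ... | tri≈ _ |a|≡|v| _ | tri≈ _ |b|≡|w| _ with <alp-cmp a v | <alp-cmp b w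
  ... | inj₁ a<v           | _                   = inj₁ (inj₂ (|a|≡|v| , a<v))
  ... | inj₂ _             | inj₁ b<w            = inj₂ (inj₁ (inj₂ (|b|≡|w| , b<w)))
  ... | inj₂ (inj₁ a≡v)    | inj₂ (inj₁ b≡w)     = inj₂ (inj₂ (inj₁ (a≡v , b≡w)))
  ... | inj₂ (inj₁ ≡.refl) | inj₂ (inj₂ w<b)     = inj₂ (inj₂ (inj₂ (|ab|≡|vw| , <alp-++ˡ a w<b)))
    where
    |ab|≡|vw| = ≡.trans (Listₚ.length-++ a) (≡.trans (≡.cong (length a ℕ.+_) |b|≡|w|) (≡.sym (Listₚ.length-++ a)))
  ... | inj₂ (inj₂ v<a)    | _                   = inj₂ (inj₂ (inj₂ (|ab|≡|vw| ,
      <alp-++ w b (ℕₚ.≤-reflexive |a|≡|v|) v<a)))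
    where
    |ab|≡|vw| = ≡.trans (Listₚ.length-++ a) (≡.trans (≡.cong₂ ℕ._+_ |a|≡|v| |b|≡|w|) (≡.sym (Listₚ.length-++ v)))

  -- f = 1 + aw + (terms at words after w in ≺)
  record Leading (w : Word) (a : Carrier) (f : Series) : Set ℓ where
    field
      constant : f [] ≈ 1#
      small    : ∀ u → u ≢ [] → u ⊰ w → f u ≈ 0#
      leading  : f w ≈ a

  module _ (g h : Units.Carrier) (g[]≈1 : val g [] ≈ 1#) (h[]≈1 : val h [] ≈ 1#) where
    private
      [g,h] = commutator (units seriesMonoid) g h
      hg = h Units.∙ g

      -- The coefficients of c = [g,h] are determined by (hg)c = gh.
      hgc≈gh : val hg ⊛ val [g,h] ≋ val g ⊛ val h
      hgc≈gh = solve (g ∷ h ∷ [])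
        (var (suc zero) ⊕ var zero ⊕ ⁅ var zero , var (suc zero) ⁆) (var zero ⊕ var (suc zero)) ≡.refl
        where open GroupSolver (units seriesMonoid)

      hg[]≈1 : val hg [] ≈ 1#
      hg[]≈1 = trans (*-cong h[]≈1 g[]≈1) (*-identityˡ 1#)

    commutator-constant : val [g,h] [] ≈ 1#
    commutator-constant = begin
      val [g,h] []             ≈⟨ *-identityˡ _ ⟨
      1# * val [g,h] []        ≈⟨ *-congʳ hg[]≈1 ⟨
      val hg [] * val [g,h] [] ≈⟨ hgc≈gh [] ⟩
      val g [] * val h []      ≈⟨ *-cong g[]≈1 h[]≈1 ⟩
      1# * 1#                  ≈⟨ *-identityˡ 1# ⟩
      1#                       ∎

    -- Coefficients at u are compared in (hg)c = gh, so that no coefficient of an inverse has to be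
    -- known. The terms g u + h u occur on both sides, and the mixed product of hg and c involves c
    -- only at shorter nonempty words.
    commutator-coefficient : ∀ u → u ≢ [] →
      (∀ v → v ≢ [] → length v ℕ.< length u → val [g,h] v ≈ 0#) →
      (reduced (val h) ⊛ reduced (val g)) u ≈ 0# →
      val [g,h] u ≈ (reduced (val g) ⊛ reduced (val h)) u
    commutator-coefficient u u≢[] c≈0 hg≈0 = +-cancelˡ (val g u + val h u) _ _ (begin
      val g u + val h u + val [g,h] u             ≈⟨ +-congʳ (+-comm _ _) ⟩
      val h u + val g u + val [g,h] u             ≈⟨ +-congʳ (+-identityʳ _) ⟨
      val h u + val g u + 0# + val [g,h] u        ≈⟨ +-congʳ (+-congˡ hg≈0) ⟨
      val h u + val g u + (reduced (val h) ⊛ reduced (val g)) u + val [g,h] u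
        ≈⟨ +-congʳ (⊛-expand (val h) (val g) u h[]≈1 g[]≈1 u≢[]) ⟨
      val hg u + val [g,h] u                      ≈⟨ +-identityʳ _ ⟨
      val hg u + val [g,h] u + 0#                 ≈⟨ +-congˡ rest ⟨
      val hg u + val [g,h] u + (reduced (val hg) ⊛ reduced (val [g,h])) u
        ≈⟨ ⊛-expand (val hg) (val [g,h]) u hg[]≈1 commutator-constant u≢[] ⟨
      (val hg ⊛ val [g,h]) u                      ≈⟨ hgc≈gh u ⟩
      (val g ⊛ val h) u                           ≈⟨ ⊛-expand (val g) (val h) u g[]≈1 h[]≈1 u≢[] ⟩
      val g u + val h u + (reduced (val g) ⊛ reduced (val h)) u ∎)
      where
      rest : (reduced (val hg) ⊛ reduced (val [g,h])) u ≈ 0#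
      rest = ⊛-vanish (reduced (val hg)) (reduced (val [g,h])) u λ a b u≡ab →
        reduced-* (val hg) (val [g,h]) a b λ a≢[] b≢[] →
          trans (*-congˡ (c≈0 b b≢[] (shorter a b u≡ab a≢[]))) (zeroʳ _)
        where
        shorter : ∀ a b → u ≡ a ++ b → a ≢ [] → length b ℕ.< length u
        shorter []      b _      a≢[] = ⊥-elim (a≢[] ≡.refl)
        shorter (x ∷ a) b ≡.refl _    =
          s≤s (≡.subst (length b ℕ.≤_) (≡.sym (Listₚ.length-++ a)) (ℕₚ.m≤n+m _ _))

  small-* : ∀ {f g v w a b} → Leading v 1# f → Leading w 1# g → a ≢ [] → b ≢ [] →
            a ⊰ v ⊎ b ⊰ w → f a * g b ≈ 0#
  small-* f-leading _ a≢[] _ (inj₁ a⊰v) = trans (*-congʳ (Leading.small f-leading _ a≢[] a⊰v)) (zeroˡ _)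
  small-* _ g-leading _ b≢[] (inj₂ b⊰w) = trans (*-congˡ (Leading.small g-leading _ b≢[] b⊰w)) (zeroʳ _)

  module _ {w w′ w″} (standard : IsStandard w w′ w″) (w-isLyndon : IsLyndon w) {g h}
           (g-leading : Leading w′ 1# (val g)) (h-leading : Leading w″ 1# (val h)) where
    open IsStandard standard
    private
      module G = Leading g-leading
      module H = Leading h-leading
      [g,h] = commutator (units seriesMonoid) g h

    product-split : ∀ {u} a b → u ⊴ w → u ≡ a ++ b → a ≢ [] → b ≢ [] → ¬ (a ≡ w′ × b ≡ w″) →
                    val g a * val h b ≈ 0#
    product-split a b u⊴w ≡.refl a≢[] b≢[] ab≢ with
      ++-compare a b w′ w″ (≡.subst (λ w → _ ℕ.≤ length w) factors (⊴⇒≤ u⊴w))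
    ... | inj₁ a⊰w′ = small-* g-leading h-leading a≢[] b≢[] (inj₁ a⊰w′)
    ... | inj₂ (inj₁ b⊰w″) = small-* g-leading h-leading a≢[] b≢[] (inj₂ b⊰w″)
    ... | inj₂ (inj₂ (inj₁ ab≡)) = ⊥-elim (ab≢ ab≡)
    ... | inj₂ (inj₂ (inj₂ (|ab|≡ , w<ab))) =
      ⊥-elim (⊴⇒≯ (≡.subst (a ++ b ⊴_) factors u⊴w) |ab|≡ w<ab)

    -- w < w″ < w″w′, as w is a Lyndon word.
    w<w″w′ : w <alp w″ ++ w′
    w<w″w′ = <alp-++ʳ w′ (proj₂ w-isLyndon w′ w″ left≢[] right≢[] factors)

    -- A factorization that contributes to hg would put u at or after w″w′, hence after w. Up to w
    -- the commutator therefore sees only the product gh.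
    swapped-split : ∀ {u} a b → u ⊴ w → u ≡ a ++ b → a ≢ [] → b ≢ [] → val h a * val g b ≈ 0#
    swapped-split {u} a b u⊴w ≡.refl a≢[] b≢[] with
      ++-compare a b w″ w′ (≡.subst (length u ℕ.≤_) |w|≡|w″w′| (⊴⇒≤ u⊴w))
      where
      |w|≡|w″w′| : length w ≡ length (w″ ++ w′)
      |w|≡|w″w′| = ≡.trans length-factors
        (≡.trans (ℕₚ.+-comm (length w′) (length w″)) (≡.sym (Listₚ.length-++ w″)))
    ... | inj₁ a⊰w″ = small-* h-leading g-leading a≢[] b≢[] (inj₁ a⊰w″)
    ... | inj₂ (inj₁ b⊰w′) = small-* h-leading g-leading a≢[] b≢[] (inj₂ b⊰w′)
    ... | inj₂ (inj₂ (inj₁ (≡.refl , ≡.refl))) = ⊥-elim (⊴⇒≯ u⊴w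
      (≡.trans (Listₚ.length-++ w″) (≡.trans (ℕₚ.+-comm (length w″) (length w′)) (≡.sym length-factors))) w<w″w′)
    ... | inj₂ (inj₂ (inj₂ (|ab|≡ , w″w′<ab))) = ⊥-elim (⊴⇒≯ u⊴w
      (≡.trans |ab|≡ (≡.trans (Listₚ.length-++ w″)
        (≡.trans (ℕₚ.+-comm (length w″) (length w′)) (≡.sym length-factors))))
      (<alp-trans w<w″w′ w″w′<ab))

    coefficient-⊴ : ∀ u → u ≢ [] → u ⊴ w →
      (∀ v → v ≢ [] → length v ℕ.< length u → val [g,h] v ≈ 0#) →
      val [g,h] u ≈ (reduced (val g) ⊛ reduced (val h)) u
    coefficient-⊴ u u≢[] u⊴w c≈0 = commutator-coefficient g h G.constant H.constant u u≢[] c≈0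
      (⊛-vanish (reduced (val h)) (reduced (val g)) u λ a b u≡ab →
        reduced-* (val h) (val g) a b (swapped-split a b u⊴w u≡ab))

    -- The induction is on length, since `commutator-coefficient` asks for vanishing at all shorter
    -- nonempty words; these precede w because u does. A surviving factorization of u would be w′w″
    -- itself, that is, u = w.
    commutator-small : ∀ u → u ≢ [] → u ⊰ w → val [g,h] u ≈ 0#
    commutator-small u u≢[] u⊰w = go (length u) u ℕₚ.≤-refl u≢[] u⊰w
      where
      go : ∀ k u → length u ℕ.≤ k → u ≢ [] → u ⊰ w → val [g,h] u ≈ 0#
      go k       []        _    u≢[] _   = ⊥-elim (u≢[] ≡.refl)
      go (suc k) u@(_ ∷ _) |u|≤ u≢[] u⊰w = trans
        (coefficient-⊴ u u≢[] (inj₁ u⊰w) λ v v≢[] |v|<|u| →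
          go k v (ℕ.s≤s⁻¹ (ℕₚ.≤-trans |v|<|u| |u|≤)) v≢[]
            (inj₁ (ℕₚ.<-≤-trans |v|<|u| (⊴⇒≤ (inj₁ u⊰w)))))
        (⊛-vanish (reduced (val g)) (reduced (val h)) u λ a b u≡ab →
          reduced-* (val g) (val h) a b λ a≢[] b≢[] →
            product-split a b (inj₁ u⊰w) u≡ab a≢[] b≢[] λ { (≡.refl , ≡.refl) →
              ⊰-irrefl (≡.subst (_⊰ w) (≡.trans u≡ab (≡.sym factors)) u⊰w) })

    commutator-leading : Leading w 1# (val [g,h])
    commutator-leading = record
      { constant = commutator-constant g h G.constant H.constant
      ; small    = commutator-small
      ; leading  = begin
          val [g,h] w
            ≈⟨ coefficient-⊴ w (proj₁ w-isLyndon) (inj₂ ≡.refl)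
                 (λ v v≢[] |v|<|w| → commutator-small v v≢[] (inj₁ |v|<|w|)) ⟩
          (reduced (val g) ⊛ reduced (val h)) w
            ≡⟨ ≡.cong (reduced (val g) ⊛ reduced (val h)) factors ⟩
          (reduced (val g) ⊛ reduced (val h)) (w′ ++ w″)
            ≈⟨ ⊛-single (reduced (val g)) (reduced (val h)) w′ w″ (λ a b eq a≢w′ →
                 reduced-* (val g) (val h) a b λ a≢[] b≢[] →
                   product-split a b (inj₂ ≡.refl) (≡.trans factors eq) a≢[] b≢[] (a≢w′ ∘ proj₁)) ⟩
          reduced (val g) w′ * reduced (val h) w″
            ≈⟨ *-cong (trans (reduced-≢[] (val g) left≢[]) G.leading)
                      (trans (reduced-≢[] (val h) right≢[]) H.leading) ⟩
          1# * 1#   ≈⟨ *-identityˡ 1# ⟩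
          1#        ∎
      }
      where
      reduced-≢[] : ∀ f {u} → u ≢ [] → reduced f u ≈ f u
      reduced-≢[] f {[]}    u≢[] = ⊥-elim (u≢[] ≡.refl)
      reduced-≢[] f {_ ∷ _} _    = refl

  private
    _·_ : ℕ → Carrier → Carrier
    _·_ = RawMonoidOps._×_ +-rawMonoid

  -- Up to w the coefficients of f and fᵐ simply add: in a mixed term the left factor is shorter
  -- than u, so it precedes w and its coefficient is 0.
  power-leading : ∀ {w} f → w ≢ [] → Leading w 1# (val f) →
                  ∀ m → Leading w (m · 1#) (val (power (units seriesMonoid) f m))
  power-leading f w≢[] f-leading zero = record
    { constant = refl
    ; small    = λ u u≢[] _ → one-≢[] u≢[]
    ; leading  = one-≢[] w≢[]
    }
    where
    one-≢[] : ∀ {u} → u ≢ [] → one u ≈ 0#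
    one-≢[] {[]}    u≢[] = ⊥-elim (u≢[] ≡.refl)
    one-≢[] {_ ∷ _} _    = refl
  power-leading {w} f w≢[] f-leading (suc m) = record
    { constant = trans (*-cong F.constant Fᵐ.constant) (*-identityˡ 1#)
    ; small    = λ u u≢[] u⊰w → trans (coefficient u u≢[] (inj₁ u⊰w))
        (trans (+-cong (F.small u u≢[] u⊰w) (Fᵐ.small u u≢[] u⊰w)) (+-identityˡ 0#))
    ; leading  = trans (coefficient w w≢[] (inj₂ ≡.refl)) (+-cong F.leading Fᵐ.leading)
    }
    where
    module F = Leading f-leading
    module Fᵐ = Leading (power-leading f w≢[] f-leading m)
    fᵐ = val (power (units seriesMonoid) f m)
    coefficient : ∀ u → u ≢ [] → u ⊴ w → (val f ⊛ fᵐ) u ≈ val f u + fᵐ u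
    coefficient u u≢[] u⊴w = trans (⊛-expand (val f) fᵐ u F.constant Fᵐ.constant u≢[])
      (trans (+-congˡ (⊛-vanish (reduced (val f)) (reduced fᵐ) u λ a b u≡ab →
        reduced-* (val f) fᵐ a b λ a≢[] b≢[] →
          trans (*-congʳ (F.small a a≢[] (inj₁ (ℕₚ.<-≤-trans (shorter a b u≡ab b≢[]) (⊴⇒≤ u⊴w)))))
                (zeroˡ _)))
        (+-identityʳ _))
      where
      shorter : ∀ a b → u ≡ a ++ b → b ≢ [] → length a ℕ.< length u
      shorter a []      _      b≢[] = ⊥-elim (b≢[] ≡.refl)
      shorter a (x ∷ b) ≡.refl _    =
        ≡.subst (length a ℕ.<_) (≡.sym (Listₚ.length-++ a)) (ℕₚ.m<m+n _ (s≤s z≤n))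

  1+-leading : ∀ x → Leading [ x ] 1# (1+ <._≟_ x)
  1+-leading x = record { constant = refl ; small = small ; leading = leading }
    where
    leading : 1+ <._≟_ x [ x ] ≈ 1#
    leading with x <.≟ x
    ... | yes _  = refl
    ... | no x≢x = ⊥-elim (x≢x ≡.refl)
    small : ∀ u → u ≢ [] → u ⊰ [ x ] → 1+ <._≟_ x u ≈ 0#
    small []      u≢[] _ = ⊥-elim (u≢[] ≡.refl)
    small (y ∷ u) _ (inj₁ (s≤s ()))
    small (y ∷ []) _ (inj₂ (_ , Lex.this y<x)) with x <.≟ y
    ... | yes ≡.refl = ⊥-elim (<.irrefl ≡.refl y<x)
    ... | no _       = refl
    small (y ∷ []) _ (inj₂ (_ , Lex.next _ (Lex.base ())))
    small (y ∷ z ∷ u) _ (inj₂ (() , _))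

  τ-leading : ∀ {w} → IsLyndon w → Leading w 1# (val (τ (units seriesMonoid) (1+-unit <._≟_) w))
  τ-leading {w} w-isLyndon = τ-induction (units seriesMonoid) (1+-unit <._≟_)
    (λ w f → IsLyndon w → Leading w 1# (val f)) (λ x _ → 1+-leading x)
    (λ {_} {_} {_} {g} {h} standard g-leading h-leading w-isLyndon →
      commutator-leading standard w-isLyndon {g} {h}
        (g-leading (IsStandard.left-isLyndon standard w-isLyndon))
        (h-leading (IsStandard.right-isLyndon standard)))
    w (proj₁ w-isLyndon) w-isLyndon

  τ-power-leading : ∀ {w} → IsLyndon w → ∀ m →
    Leading w (m · 1#) (val (power (units seriesMonoid) (τ (units seriesMonoid) (1+-unit <._≟_) w) m))
  τ-power-leading {w} w-isLyndon = power-leading (τ (units seriesMonoid) (1+-unit <._≟_) w)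
    (proj₁ w-isLyndon) (τ-leading w-isLyndon)

-- Transgression and central extensions

-- All congruences that enter an argument are added up on one side; what remains is one integral
-- identity between differences, which the ring solver checks.
mod-difference : ∀ {m a b c d} → c ℤ.- d ≡ a ℤ.- b → a ≡ b [mod m ] → c ≡ d [mod m ]
mod-difference {m} eq (mod m∣a-b) = mod (≡.subst (+ m ℤ∣.∣_) (≡.sym eq) m∣a-b)

mod-refl : ∀ {m a} → a ≡ a [mod m ]
mod-refl = ≡⇒mod ≡.refl

module _ {ℓ} (S : TopGroup ℓ) (p : ℕ) (f : TopGroup.Carrier S → ℤ) (f-continuous : IsCochain¹ S p f)
         (∂f≡0 : ∀ g h → coboundary S p f g h ≡ 0ℤ [mod p ]) where
  open TopGroup S

  cochain-cong : ∀ {g h} → g ≈ h → f g ≡ f h [mod p ]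
  cochain-cong {g} g≈h = proj₂ (f-continuous g) (≈⇒≈[] g≈h)

  cochain-homo : ∀ g h → f (g ∙ h) ≡ f g ℤ.+ f h [mod p ]
  cochain-homo g h = mod-difference (lemma (f g) (f h) (f (g ∙ h))) (mod-sym (∂f≡0 g h))
    where
    lemma : ∀ a b c → c ℤ.- (a ℤ.+ b) ≡ 0ℤ ℤ.- (a ℤ.+ b ℤ.- c)
    lemma = solve-∀

  cochain-ε : f ε ≡ 0ℤ [mod p ]
  cochain-ε = mod-difference (lemma (f ε))
    (mod-trans (mod-sym (cochain-homo ε ε)) (cochain-cong (identityˡ ε)))
    where
    lemma : ∀ a → a ℤ.- 0ℤ ≡ (a ℤ.+ a) ℤ.- a
    lemma = solve-∀

  cochain-⁻¹ : ∀ g → f (g ⁻¹) ≡ ℤ.- f g [mod p ]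
  cochain-⁻¹ g = mod-difference (lemma (f (g ⁻¹)) (f g))
    (mod-trans (mod-sym (cochain-homo (g ⁻¹) g)) (mod-trans (cochain-cong (inverseˡ g)) cochain-ε))
    where
    lemma : ∀ a b → a ℤ.- (ℤ.- b) ≡ (a ℤ.+ b) ℤ.- 0ℤ
    lemma = solve-∀

  cochain-power : ∀ g m → f (power group g m) ≡ + m ℤ.* f g [mod p ]
  cochain-power g zero    = mod-trans cochain-ε (≡⇒mod (≡.sym (ℤₚ.*-zeroˡ (f g))))
  cochain-power g (suc m) = mod-trans (cochain-homo g (power group g m))
    (mod-trans (mod-+-cong (mod-refl {a = f g}) (cochain-power g m))
      (≡⇒mod (≡.sym (ℤₚ.suc-* (+ m) (f g)))))

  cochain-commutator : ∀ g h → f (commutator group g h) ≡ 0ℤ [mod p ]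
  cochain-commutator g h = mod-trans (cochain-homo _ _) (mod-trans
    (mod-+-cong (mod-trans (cochain-homo _ _)
      (mod-+-cong (mod-trans (cochain-homo _ _) (mod-+-cong (cochain-⁻¹ g) (cochain-⁻¹ h))) (mod-refl {a = f g})))
      (mod-refl {a = f h}))
    (≡⇒mod (lemma (f g) (f h))))
    where
    lemma : ∀ a b → ℤ.- a ℤ.+ (ℤ.- b) ℤ.+ a ℤ.+ b ≡ 0ℤ
    lemma = solve-∀

  -- A homomorphism to ℤ/p kills p-th powers and commutators, and by continuity the closed subgroup
  -- generated by them.
  cochain-lowerCentral : ∀ n {g} → lowerCentral S p (suc (suc n)) g → f g ≡ 0ℤ [mod p ]
  cochain-lowerCentral n {g} g∈ =
    let i , near = f-continuous g
        h , h∈ , g≈h = g∈ i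
    in mod-trans (near g≈h) (on-generated h∈)
    where
    on-generated : ∀ {h} →
      Generated group (PowerOrCommutator S p (lowerCentral S p (suc n))) h → f h ≡ 0ℤ [mod p ]
    on-generated (gen (pth-power {h} _)) = mod-trans (cochain-power h p)
      (mod (ℤ∣.divides (f h) (≡.trans (ℤₚ.+-identityʳ _) (ℤₚ.*-comm (+ p) (f h)))))
    on-generated (gen (comm g {h} _))    = cochain-commutator g h
    on-generated unit                    = cochain-ε
    on-generated (mul {g} {h} s t)       =
      mod-trans (cochain-homo g h) (mod-+-cong (on-generated s) (on-generated t))
    on-generated (inv {g} s)             = mod-trans (cochain-⁻¹ g) (mod-neg-cong (on-generated s))
    on-generated (resp g≈h s)            = mod-trans (mod-sym (cochain-cong g≈h)) (on-generated s)

module _ {ℓ} (S : TopGroup ℓ) (n p : ℕ) where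
  open TopGroup S
  private
    Q = S /lowerCentral[ suc (suc n) , p ]
    module Q = TopGroup Q
    isNormal = lowerCentral-isNormal S p (suc (suc n))
    open IsNormalSubgroup isNormal

  -- The cochains y₁, y₂ and the cochain z on S^[n,p] relating ∂y₁ and ∂y₂ give the
  -- homomorphism y₁ − y₂ − z, which vanishes on S^(n,p) because n ≥ 2.
  transgression-injective : ∀ {x₁ x₂ α} → Transgression S (suc (suc n)) p x₁ α →
    Transgression S (suc (suc n)) p x₂ α →
    Setoid._≈_ (H¹-invariants S p (lowerCentral S p (suc (suc n)))) x₁ x₂
  transgression-injective {x₁} {x₂} T₁ T₂ g g∈ = mod-trans (mod-sym (T₁.y-extends g∈))
    -- On S^(n,p) the cochain z takes the constant value z ε, as it factors through the quotient.
    -- This value is 0 because f, y₁ and y₂ all vanish at ε.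
    (mod-trans (mod-difference (lemma (T₁.y g) (T₂.y g) (z g) (T₁.y ε) (T₂.y ε) (z ε))
      (mod-+-cong (cochain-lowerCentral S p f f-continuous ∂f≡0 n g∈)
        (mod-+-cong (mod-sym (cochain-lowerCentral S p f f-continuous ∂f≡0 n N-ε))
          (mod-+-cong zg≡zε (mod-+-cong (y-ε x₁ T₁) (mod-sym (y-ε x₂ T₂)))))))
      (T₂.y-extends g∈))
    where
    module T₁ = Transgression T₁
    module T₂ = Transgression T₂
    open Cohomologous (Setoid.trans (H² Q p) {T₁.c} T₁.c~α (Setoid.sym (H² Q p) {T₂.c} T₂.c~α))
      using () renaming (cochain to z; continuous to z-continuous; difference to c₁-c₂≡∂z)
    f : Carrier → ℤ
    f g = T₁.y g ℤ.- T₂.y g ℤ.- z g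
    y-ε : ∀ x {α} (T : Transgression S (suc (suc n)) p x α) → Transgression.y T ε ≡ 0ℤ [mod p ]
    y-ε x T = mod-difference (lemma (y ε)) (mod-trans
      (mod-+-cong (y-extends N-ε) (y-extends N-ε))
      (mod-trans (mod-sym (InvariantHom.homo x N-ε N-ε (N-∙ N-ε N-ε)))
      (mod-trans (mod-sym (y-extends (N-∙ N-ε N-ε)))
        (proj₂ (y-continuous (ε ∙ ε)) (≈⇒≈[] (identityˡ ε))))))
      where
      open Transgression T
      lemma : ∀ a → a ℤ.- 0ℤ ≡ (a ℤ.+ a) ℤ.- a
      lemma = solve-∀
    zg≡zε : z g ≡ z ε [mod p ]
    zg≡zε = proj₂ (z-continuous g) (Q.≈⇒≈[] (N-resp (sym (identityʳ _)) (N-⁻¹ g∈)))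
    f-continuous : IsCochain¹ S p f
    f-continuous g =
      let i , near₁ = T₁.y-continuous g
          j , near₂ = T₂.y-continuous g
          k , near₃ = z-continuous g
          l , l≤ = directed i j
          m , m≤ = directed k l
      in m , λ g≈h → mod-+-cong
           (mod-+-cong (near₁ (proj₁ (l≤ (proj₂ (m≤ g≈h)))))
                       (mod-neg-cong (near₂ (proj₂ (l≤ (proj₂ (m≤ g≈h)))))))
           (mod-neg-cong (near₃ (ε , N-ε , ≈[]-trans (≈⇒≈[] (identityʳ g)) (proj₁ (m≤ g≈h)))))
    ∂f≡0 : ∀ g h → coboundary S p f g h ≡ 0ℤ [mod p ]
    ∂f≡0 g h = mod-difference
      (lemma′ (T₁.y g) (T₁.y h) (T₁.y (g ∙ h)) (T₂.y g) (T₂.y h) (T₂.y (g ∙ h)) (z g) (z h) (z (g ∙ h))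
        (Cocycle².fun T₁.c g h) (Cocycle².fun T₂.c g h))
      (mod-+-cong (T₁.∂y-inflated g h)
        (mod-+-cong (mod-sym (T₂.∂y-inflated g h)) (c₁-c₂≡∂z g h)))
      where
      lemma′ : ∀ a b c a′ b′ c′ x y z k k′ →
        ((a ℤ.- a′ ℤ.- x) ℤ.+ (b ℤ.- b′ ℤ.- y) ℤ.- (c ℤ.- c′ ℤ.- z)) ℤ.- 0ℤ ≡
        ((a ℤ.+ b ℤ.- c) ℤ.+ (k′ ℤ.+ (k ℤ.- k′))) ℤ.- (k ℤ.+ ((a′ ℤ.+ b′ ℤ.- c′) ℤ.+ (x ℤ.+ y ℤ.- z)))
      lemma′ = solve-∀
    lemma : ∀ a b c d e o → a ℤ.- b ≡
      ((a ℤ.- b ℤ.- c) ℤ.+ (0ℤ ℤ.+ (c ℤ.+ (d ℤ.+ 0ℤ)))) ℤ.- (0ℤ ℤ.+ ((d ℤ.- e ℤ.- o) ℤ.+ (o ℤ.+ (0ℤ ℤ.+ e))))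
    lemma = solve-∀

-- U is discrete, z identifies ℤ/p with the central subgroup U^(n,p), κ is the graph of z,
-- and t is a retraction U → ℤ/p of sets, compatible with translation by U^(n,p).
record IsCentralℤ/ {ℓ} (p n : ℕ) (U : TopGroup ℓ) (κ : ℤ → TopGroup.Carrier U → Set ℓ)
                   (z : ℤ → TopGroup.Carrier U) (t : TopGroup.Carrier U → ℤ) : Set ℓ where
  open TopGroup U
  field
    trivialNbhd    : Nbhd
    near⇒≈         : ∀ {u v} → u ≈[ trivialNbhd ] v → u ≈ v
    κ⇒≈            : ∀ {a u} → κ a u → u ≈ z a
    ≈⇒κ            : ∀ {a u} → u ≈ z a → κ a u
    z-cong         : ∀ {a b} → a ≡ b [mod p ] → z a ≈ z b
    z-homo         : ∀ a b → z (a ℤ.+ b) ≈ z a ∙ z b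
    z-central      : ∀ a u → z a ∙ u ≈ u ∙ z a
    z∈lowerCentral : ∀ a → lowerCentral U p n (z a)
    lowerCentral⇒z : ∀ {u} → lowerCentral U p n u → ∃[ a ] u ≈ z a
    t-cong         : ∀ {u v} → u ≈ v → t u ≡ t v [mod p ]
    t-∙z           : ∀ u a → t (u ∙ z a) ≡ t u ℤ.+ a [mod p ]
    t-ε            : t ε ≡ 0ℤ [mod p ]

module CentralExtension {ℓ} {n p} {U : TopGroup ℓ} {κ z t} (central : IsCentralℤ/ p n U κ z t) where
  open IsCentralℤ/ central
  open TopGroup U
  open GroupProperties group using (\\-leftDividesˡ; \\-leftDividesʳ; //-rightDividesʳ; //-rightDividesˡ; identityˡ-unique)
  open SetoidReasoning setoid
  private
    Q = U /lowerCentral[ n , p ]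
    module Q = TopGroup Q
    isNormal = lowerCentral-isNormal U p n
    open IsNormalSubgroup isNormal

  z-ε : z 0ℤ ≈ ε
  z-ε = identityˡ-unique (z 0ℤ) (z 0ℤ) (sym (z-homo 0ℤ 0ℤ))

  z-⁻¹ : ∀ a → z (ℤ.- a) ∙ z a ≈ ε
  z-⁻¹ a = trans (sym (z-homo _ _)) (trans (z-cong (≡⇒mod (ℤₚ.+-inverseˡ a))) z-ε)

  t-z : ∀ {u a} → u ≈ z a → t u ≡ a [mod p ]
  t-z {u} {a} u≈za = mod-trans (t-cong (trans u≈za (sym (identityˡ _)))) (mod-trans (t-∙z ε a)
    (mod-trans (mod-+-cong t-ε (mod-refl {a = a})) (≡⇒mod (ℤₚ.+-identityˡ a))))

  merge : ∀ u v a b → u ∙ z a ∙ (v ∙ z b) ≈ u ∙ v ∙ z (a ℤ.+ b)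
  merge u v a b = begin
    u ∙ z a ∙ (v ∙ z b)     ≈⟨ assoc _ _ _ ⟩
    u ∙ (z a ∙ (v ∙ z b))   ≈⟨ ∙-congˡ (assoc _ _ _) ⟨
    u ∙ (z a ∙ v ∙ z b)     ≈⟨ ∙-congˡ (∙-congʳ (z-central a v)) ⟩
    u ∙ (v ∙ z a ∙ z b)     ≈⟨ ∙-congˡ (trans (assoc _ _ _) (∙-congˡ (sym (z-homo a b)))) ⟩
    u ∙ (v ∙ z (a ℤ.+ b))   ≈⟨ assoc _ _ _ ⟨
    u ∙ v ∙ z (a ℤ.+ b)     ∎

  z∙ : ∀ u a b → z a ∙ (u ∙ z b) ≈ u ∙ z (a ℤ.+ b)
  z∙ u a b = trans (∙-congʳ (sym (identityˡ _))) (trans (merge ε u a b) (∙-congʳ (identityˡ u)))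

  ∼⇒z : ∀ {u v} → u Q.≈ v → ∃[ a ] v ≈ u ∙ z a
  ∼⇒z {u} {v} u∼v =
    let a , u⁻¹v≈za = lowerCentral⇒z u∼v
    in a , trans (sym (\\-leftDividesˡ u v)) (∙-congˡ u⁻¹v≈za)

  z⇒∼ : ∀ {u v a} → v ≈ u ∙ z a → u Q.≈ v
  z⇒∼ {u} {v} {a} v≈uza = N-resp (trans (sym (\\-leftDividesʳ u (z a))) (∙-congˡ (sym v≈uza))) (z∈lowerCentral a)

  near⇒∼ : ∀ {u v} → u Q.≈[ trivialNbhd ] v → u Q.≈ v
  near⇒∼ {u} {v} (k , k∈ , uk≈v) = N-resp (trans (sym (\\-leftDividesʳ u k)) (∙-congˡ (near⇒≈ uk≈v))) k∈

  -- The cocycle of the section u ↦ u z(−t u).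
  c : Cocycle² Q p
  c = record
    { fun = λ u v → t (u ∙ v) ℤ.- t u ℤ.- t v
    -- This also contains that c is well defined on cosets: translating u and v by z a and z b
    -- shifts the three terms by a + b, a and b, which cancel.
    ; continuous = λ u v → trivialNbhd , λ u≈u′ v≈v′ →
        let a , u′≈uza = ∼⇒z (near⇒∼ u≈u′)
            b , v′≈vzb = ∼⇒z (near⇒∼ v≈v′)
        in mod-sym (mod-trans (mod-+-cong (mod-+-cong
             (mod-trans (t-cong (trans (∙-cong u′≈uza v′≈vzb) (merge u v a b))) (t-∙z (u ∙ v) (a ℤ.+ b)))
             (mod-neg-cong (mod-trans (t-cong u′≈uza) (t-∙z u a))))
             (mod-neg-cong (mod-trans (t-cong v′≈vzb) (t-∙z v b))))
           (≡⇒mod (lemma₁ (t u) (t v) (t (u ∙ v)) a b)))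
    ; cocycle = λ u v w → mod-difference
        (lemma₂ (t u) (t v) (t w) (t (v ∙ w)) (t (u ∙ v)) (t (u ∙ (v ∙ w))) (t (u ∙ v ∙ w)))
        (t-cong (sym (assoc u v w)))
    }
    where
    lemma₁ : ∀ x y k a b → k ℤ.+ (a ℤ.+ b) ℤ.- (x ℤ.+ a) ℤ.- (y ℤ.+ b) ≡ k ℤ.- x ℤ.- y
    lemma₁ = solve-∀
    lemma₂ : ∀ u v w vw uv uvw uvw′ →
      ((vw ℤ.- v ℤ.- w) ℤ.+ (uvw ℤ.- u ℤ.- vw)) ℤ.- ((uvw′ ℤ.- uv ℤ.- w) ℤ.+ (uv ℤ.- u ℤ.- v)) ≡ uvw ℤ.- uvw′
    lemma₂ = solve-∀

  IsClass : Cocycle² Q p → Set ℓ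
  IsClass = IsExtensionClass U n p κ

  c-isClass : IsClass c
  c-isClass = record
    { section = section
    ; section-cong = λ {u} {v} u∼v →
        let a , v≈uza = ∼⇒z u∼v
        in sym (begin
          v ∙ z (ℤ.- t v)                   ≈⟨ ∙-cong v≈uza (z-cong (mod-neg-cong (mod-trans (t-cong v≈uza) (t-∙z u a)))) ⟩
          u ∙ z a ∙ z (ℤ.- (t u ℤ.+ a))     ≈⟨ assoc _ _ _ ⟩
          u ∙ (z a ∙ z (ℤ.- (t u ℤ.+ a)))   ≈⟨ ∙-congˡ (z-homo _ _) ⟨
          u ∙ z (a ℤ.- (t u ℤ.+ a))         ≡⟨ ≡.cong (λ b → u ∙ z b) (lemma₁ (t u) a) ⟩
          u ∙ z (ℤ.- t u)                   ∎)
    ; is-section = λ u → z⇒∼ {a = t u} (sym (trans (assoc _ _ _) (trans (∙-congˡ (z-⁻¹ (t u))) (identityʳ u))))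
    ; section-ε = trans (identityˡ _) (trans (z-cong (mod-neg-cong t-ε)) z-ε)
    ; c = c
    ; c-section = λ u v → ≈⇒κ (begin
        section u ∙ section v ∙ section (u ∙ v) ⁻¹
          ≈⟨ ∙-congʳ (merge u v (ℤ.- t u) (ℤ.- t v)) ⟩
        u ∙ v ∙ z (ℤ.- t u ℤ.+ (ℤ.- t v)) ∙ section (u ∙ v) ⁻¹
          ≡⟨ ≡.cong (λ b → u ∙ v ∙ z b ∙ section (u ∙ v) ⁻¹) (lemma₂ (t u) (t v) (t (u ∙ v))) ⟩
        u ∙ v ∙ z ((t (u ∙ v) ℤ.- t u ℤ.- t v) ℤ.+ (ℤ.- t (u ∙ v))) ∙ section (u ∙ v) ⁻¹
          ≈⟨ ∙-congʳ (z∙ (u ∙ v) _ _) ⟨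
        z (t (u ∙ v) ℤ.- t u ℤ.- t v) ∙ section (u ∙ v) ∙ section (u ∙ v) ⁻¹
          ≈⟨ //-rightDividesʳ (section (u ∙ v)) _ ⟩
        z (t (u ∙ v) ℤ.- t u ℤ.- t v) ∎)
    ; c~γ = Setoid.refl (H² Q p) {c}
    }
    where
    section : Carrier → Carrier
    section u = u ∙ z (ℤ.- t u)
    lemma₁ : ∀ x a → a ℤ.- (x ℤ.+ a) ≡ ℤ.- x
    lemma₁ = solve-∀
    lemma₂ : ∀ x y k → ℤ.- x ℤ.+ (ℤ.- y) ≡ (k ℤ.- x ℤ.- y) ℤ.+ (ℤ.- k)
    lemma₂ = solve-∀

  -- Another section s gives the cocycle c + ∂(t ∘ s).
  isClass-unique : ∀ {γ} → IsClass γ → Cohomologous Q p γ c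
  isClass-unique {γ} γ-isClass = Setoid.trans (H² Q p) {γ} {C.c} {c}
    (Setoid.sym (H² Q p) {C.c} {γ} C.c~γ) (record
    { cochain = λ u → t (s u)
    ; continuous = λ u → trivialNbhd , λ u≈v → t-cong (C.section-cong (near⇒∼ u≈v))
    ; difference = difference
    })
    where
    module C = IsExtensionClass γ-isClass
    s = C.section
    difference : ∀ u v → Cocycle².fun C.c u v ℤ.- (t (u ∙ v) ℤ.- t u ℤ.- t v) ≡
                         t (s u) ℤ.+ t (s v) ℤ.- t (s (u ∙ v)) [mod p ]
    difference u v =
      let a , su≈uza = ∼⇒z (Q.sym (C.is-section u))
          b , sv≈vzb = ∼⇒z (Q.sym (C.is-section v))
          d , suv≈uvzd = ∼⇒z (Q.sym (C.is-section (u ∙ v)))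
          k = Cocycle².fun C.c u v
          uvz[a+b]≈uvz[k+d] : u ∙ v ∙ z (a ℤ.+ b) ≈ u ∙ v ∙ z (k ℤ.+ d)
          uvz[a+b]≈uvz[k+d] = begin
            u ∙ v ∙ z (a ℤ.+ b)                     ≈⟨ merge u v a b ⟨
            u ∙ z a ∙ (v ∙ z b)                     ≈⟨ ∙-cong su≈uza sv≈vzb ⟨
            s u ∙ s v                               ≈⟨ //-rightDividesˡ (s (u ∙ v)) _ ⟨
            s u ∙ s v ∙ s (u ∙ v) ⁻¹ ∙ s (u ∙ v)    ≈⟨ ∙-cong (κ⇒≈ (C.c-section u v)) suv≈uvzd ⟩
            z k ∙ (u ∙ v ∙ z d)                     ≈⟨ z∙ (u ∙ v) k d ⟩
            u ∙ v ∙ z (k ℤ.+ d)                     ∎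
          t[su]≡ : t (s u) ≡ t u ℤ.+ a [mod p ]
          t[su]≡ = mod-trans (t-cong su≈uza) (t-∙z u a)
          t[sv]≡ = mod-trans (t-cong sv≈vzb) (t-∙z v b)
          t[suv]≡ = mod-trans (t-cong suv≈uvzd) (t-∙z (u ∙ v) d)
      -- `t` recovers exponents of z, so it turns the identity above into a + b ≡ k + d modulo p.
      in mod-difference
           (lemma (t u) (t v) (t (u ∙ v)) a b d k (t (s u)) (t (s v)) (t (s (u ∙ v))))
           (mod-+-cong (mod-sym (mod-trans (mod-sym (t-∙z (u ∙ v) (a ℤ.+ b)))
                         (mod-trans (t-cong uvz[a+b]≈uvz[k+d]) (t-∙z (u ∙ v) (k ℤ.+ d)))))
             (mod-+-cong (mod-sym t[su]≡) (mod-+-cong (mod-sym t[sv]≡) t[suv]≡)))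
      where
      lemma : ∀ x y xy a b d k X Y XY →
        (k ℤ.- (xy ℤ.- x ℤ.- y)) ℤ.- (X ℤ.+ Y ℤ.- XY) ≡
        ((xy ℤ.+ (k ℤ.+ d)) ℤ.+ ((x ℤ.+ a) ℤ.+ ((y ℤ.+ b) ℤ.+ XY))) ℤ.-
        ((xy ℤ.+ (a ℤ.+ b)) ℤ.+ (X ℤ.+ (Y ℤ.+ (xy ℤ.+ d))))
      lemma = solve-∀

  module _ {ℓ′} {S : TopGroup ℓ′} (φ : ContinuousHom S U) where
    private
      module S = TopGroup S
      open ContinuousHom φ

      φ-z : ∀ {g} → lowerCentral S p n g → ∃[ a ] ⟦ g ⟧ ≈ z a
      φ-z g∈ = lowerCentral⇒z (lowerCentral-map φ p n g∈)

    -- Since c = −∂t, the cochain −t ∘ φ has coboundary φ*c.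
    -t∘φ : InvariantHom S p (lowerCentral S p n)
    -t∘φ = record
      { fun = λ g _ → ℤ.- t ⟦ g ⟧
      ; continuous = λ {g} _ →
          let i , near = continuous g trivialNbhd
          in i , λ _ g≈h → mod-neg-cong (t-cong (near⇒≈ (near g≈h)))
      -- `t` is not additive on U, but φ maps S^(n,p) into the image of z, and translation by that
      -- is additive.
      ; homo = λ {g} {h} g∈ h∈ _ →
          let b , φh≈zb = φ-z h∈
          in mod-trans (mod-neg-cong (mod-trans (t-cong (trans (homo g h) (∙-congˡ φh≈zb)))
               (mod-trans (t-∙z ⟦ g ⟧ b) (mod-+-cong (mod-refl {a = t ⟦ g ⟧}) (mod-sym (t-z φh≈zb))))))
               (≡⇒mod (ℤₚ.neg-distrib-+ (t ⟦ g ⟧) (t ⟦ h ⟧)))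
      ; invariant = λ σ {g} g∈ _ →
          let a , φg≈za = φ-z g∈
          in mod-neg-cong (t-cong (begin
            ⟦ σ S.⁻¹ S.∙ g S.∙ σ ⟧         ≈⟨ trans (homo _ _) (∙-congʳ (trans (homo _ _) (∙-congʳ (⁻¹-homo σ)))) ⟩
            ⟦ σ ⟧ ⁻¹ ∙ ⟦ g ⟧ ∙ ⟦ σ ⟧       ≈⟨ ∙-congʳ (∙-congˡ φg≈za) ⟩
            ⟦ σ ⟧ ⁻¹ ∙ z a ∙ ⟦ σ ⟧         ≈⟨ trans (assoc _ _ _) (∙-congˡ (z-central a ⟦ σ ⟧)) ⟩
            ⟦ σ ⟧ ⁻¹ ∙ (⟦ σ ⟧ ∙ z a)       ≈⟨ \\-leftDividesʳ ⟦ σ ⟧ (z a) ⟩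
            z a                            ≈⟨ φg≈za ⟨
            ⟦ g ⟧                          ∎))
      }

    -t∘φ-transgression : Transgression S n p -t∘φ (pullback (induced φ n p) c)
    -t∘φ-transgression = record
      { y = λ g → ℤ.- t ⟦ g ⟧
      ; y-continuous = λ g →
          let i , near = continuous g trivialNbhd
          in i , λ g≈h → mod-neg-cong (t-cong (near⇒≈ (near g≈h)))
      ; y-extends = λ _ → mod-refl
      ; c = pullback (induced φ n p) c
      ; ∂y-inflated = λ g h → mod-difference
          (lemma (t ⟦ g ⟧) (t ⟦ h ⟧) (t ⟦ g S.∙ h ⟧) (t (⟦ g ⟧ ∙ ⟦ h ⟧))) (t-cong (homo g h))
      ; c~α = Setoid.refl (H² (S /lowerCentral[ n , p ]) p) {pullback (induced φ n p) c}
      }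
      where
      lemma : ∀ x y k k′ → (ℤ.- x ℤ.+ (ℤ.- y) ℤ.- (ℤ.- k)) ℤ.- (k′ ℤ.- x ℤ.- y) ≡ k ℤ.- k′
      lemma = solve-∀

    pairing : 2 ℕ.≤ n → ∀ σ σ∈ → PairingIs S n p σ σ∈ (pullback (induced φ n p) c) (t ⟦ σ ⟧)
    pairing (s≤s (s≤s {n = n} z≤n)) σ σ∈ =
      -t∘φ , -t∘φ-transgression ,
      (λ x x-transgression → transgression-injective S n p x-transgression -t∘φ-transgression) ,
      -- The sign in the definition of the pairing undoes the one in `-t∘φ`.
      ≡⇒mod (≡.sym (ℤₚ.neg-involutive (t ⟦ σ ⟧)))

-- Unitriangular matrices

fromℕ-maximal : ∀ {s} {j : Fin (suc s)} → j ≢ fromℕ s → j Fin.< fromℕ s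
fromℕ-maximal {s} {j} j≢s = Finₚ.≤∧≢⇒< (Finₚ.≤fromℕ j) j≢s

zero≢fromℕ : ∀ {s} .{{_ : NonZero s}} → zero ≢ fromℕ s
zero≢fromℕ {suc s} ()

off-corner-distance : ∀ {s} (i j : Fin (suc s)) → i Fin.< j → ¬ (i ≡ zero × j ≡ fromℕ s) → toℕ j ∸ toℕ i ℕ.< s
off-corner-distance {s} zero    j       _ ij≢ = ≡.subst (toℕ j ℕ.<_) (Finₚ.toℕ-fromℕ s)
  (fromℕ-maximal (λ j≡s → ij≢ (≡.refl , j≡s)))
off-corner-distance     (suc i) (suc j) _ _   = ℕₚ.≤-<-trans (ℕₚ.m∸n≤m (toℕ j) (toℕ i)) (Finₚ.toℕ<n j)

module Corner (R : CommutativeRing 0ℓ 0ℓ) where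
  open CommutativeRing R hiding (zero)
  open Matrices R
  open SemiringSum semiring using (sum; sum-cong-≋; ∑-distrib-+)
  open SetoidReasoning setoid

  -- The summand aE to which `I+_E` unfolds.
  corner : ∀ {s} → Carrier → Matrix (suc s)
  corner {s} a i j = if does (i Finₚ.≟ zero) then (if does (j Finₚ.≟ fromℕ s) then a else 0#) else 0#

  corner-cong : ∀ {s a b} → a ≈ b → corner {s} a ≈ᴹ corner b
  corner-cong {s} a≈b (suc i) j = refl
  corner-cong {s} a≈b zero    j with j Finₚ.≟ fromℕ s
  ... | yes _ = a≈b
  ... | no _  = refl

  corner-+ : ∀ {s} a b i j → corner {s} (a + b) i j ≈ corner a i j + corner b i j
  corner-+ {s} a b (suc i) j = sym (+-identityˡ 0#)
  corner-+ {s} a b zero    j with j Finₚ.≟ fromℕ s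
  ... | yes _ = refl
  ... | no _  = sym (+-identityˡ 0#)

  corner-0 : ∀ {s} i j → corner {s} 0# i j ≈ 0#
  corner-0 {s} (suc i) j = refl
  corner-0 {s} zero    j with j Finₚ.≟ fromℕ s
  ... | yes _ = refl
  ... | no _  = refl

  corner-corner : ∀ {s} a → corner {s} a zero (fromℕ s) ≈ a
  corner-corner {s} a with fromℕ s Finₚ.≟ fromℕ s
  ... | yes _  = refl
  ... | no s≢s = ⊥-elim (s≢s ≡.refl)

  corner-off : ∀ {s} a i j → ¬ (i ≡ zero × j ≡ fromℕ s) → corner {s} a i j ≈ 0#
  corner-off {s} a (suc i) j _ = refl
  corner-off {s} a zero    j ij≢ with j Finₚ.≟ fromℕ s
  ... | yes j≡s = ⊥-elim (ij≢ (≡.refl , j≡s))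
  ... | no _    = refl

  ⊗-distribˡ-+ : ∀ {k} (A B C : Matrix k) i j → (A ⊗ (λ i j → B i j + C i j)) i j ≈ (A ⊗ B) i j + (A ⊗ C) i j
  ⊗-distribˡ-+ A B C i j = trans (sum-cong-≋ (λ l → distribˡ (A i l) (B l j) (C l j)))
    (∑-distrib-+ (λ l → A i l * B l j) (λ l → A i l * C l j))

  ⊗-distribʳ-+ : ∀ {k} (A B C : Matrix k) i j → ((λ i j → B i j + C i j) ⊗ A) i j ≈ (B ⊗ A) i j + (C ⊗ A) i j
  ⊗-distribʳ-+ A B C i j = trans (sum-cong-≋ (λ l → distribʳ (A l j) (B i l) (C i l)))
    (∑-distrib-+ (λ l → B i l * A l j) (λ l → C i l * A l j))

  module _ {s} {A : Matrix (suc s)} (A-ut : IsUnitriangular A) where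
    open IsUnitriangular A-ut

    -- Only the first column of A matters here, and only the last row in `corner-⊗`; both are unit
    -- vectors as A is unitriangular. That E is fixed from either side is why corner matrices are
    -- central.
    ⊗-corner : ∀ a → A ⊗ corner a ≈ᴹ corner a
    ⊗-corner a i j = trans (sum-single {t = λ l → A i l * corner a l j} zero off) (row i)
      where
      off : ∀ l → l ≢ zero → A i l * corner a l j ≈ 0#
      off zero    l≢0 = ⊥-elim (l≢0 ≡.refl)
      off (suc l) _   = zeroʳ (A i (suc l))
      row : ∀ i → A i zero * corner a zero j ≈ corner a i j
      row zero    = trans (*-congʳ (diagonal zero)) (*-identityˡ _)
      row (suc i) = trans (*-congʳ (below (s≤s z≤n))) (zeroˡ _)

    corner-⊗ : ∀ a → corner a ⊗ A ≈ᴹ corner a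
    corner-⊗ a (suc i) j = sum-zero (λ l → zeroˡ (A l j))
    corner-⊗ a zero    j = trans (sum-single (fromℕ s) off) (trans (*-congʳ (corner-corner {s} a)) column)
      where
      off : ∀ l → l ≢ fromℕ s → corner a zero l * A l j ≈ 0#
      off l l≢s = trans (*-congʳ (corner-off a zero l (l≢s ∘ proj₂))) (zeroˡ _)
      column : a * A (fromℕ s) j ≈ corner a zero j
      column with j Finₚ.≟ fromℕ s
      ... | yes ≡.refl = trans (*-congˡ (diagonal (fromℕ s))) (*-identityʳ a)
      ... | no j≢s     = trans (*-congˡ (below (fromℕ-maximal j≢s))) (zeroʳ a)

    ⊗-I+E : ∀ a i j → (A ⊗ I+ a E) i j ≈ A i j + corner a i j
    ⊗-I+E a i j = trans (⊗-distribˡ-+ A I (corner a) i j) (+-cong (⊗-identityʳ A i j) (⊗-corner a i j))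

    I+E-⊗ : ∀ a i j → (I+ a E ⊗ A) i j ≈ A i j + corner a i j
    I+E-⊗ a i j = trans (⊗-distribʳ-+ A I (corner a) i j) (+-cong (⊗-identityˡ A i j) (corner-⊗ a i j))

  I+E-cong : ∀ {s a b} → a ≈ b → I+_E {s} a ≈ᴹ I+ b E
  I+E-cong {s} {a} {b} a≈b i j = +-congˡ (corner-cong {s} {a} {b} a≈b i j)

  I+0E : ∀ {s} → I+_E {s} 0# ≈ᴹ I
  I+0E i j = trans (+-congˡ (corner-0 i j)) (+-identityʳ _)

  unitriangular-≈ : ∀ {k} {A B : Matrix k} → IsUnitriangular A → IsUnitriangular B →
    (∀ {i j} → i Fin.< j → A i j ≈ B i j) → A ≈ᴹ B
  unitriangular-≈ A-ut B-ut A≈B i j with Finₚ.<-cmp i j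
  ... | tri< i<j _ _    = A≈B i<j
  ... | tri≈ _ ≡.refl _ = trans (IsUnitriangular.diagonal A-ut i) (sym (IsUnitriangular.diagonal B-ut i))
  ... | tri> _ _ j<i    = trans (IsUnitriangular.below A-ut j<i) (sym (IsUnitriangular.below B-ut j<i))

  I-isUnitriangular : ∀ {k} → IsUnitriangular (I {k})
  I-isUnitriangular = record
    { diagonal = I-diagonal
    ; below    = λ j<i → I-off-diagonal (λ i≡j → Finₚ.<-irrefl (≡.sym i≡j) j<i)
    }

  module _ {s} .{{_ : NonZero s}} where

    -- For s = 0 the corner would lie on the diagonal, whence the instance argument.
    I+E-isUnitriangular : ∀ a → IsUnitriangular (I+_E {s} a)
    I+E-isUnitriangular a = record
      { diagonal = λ i → trans
          (+-cong (I-diagonal i) (corner-off a i i (λ (i≡0 , i≡s) → zero≢fromℕ (≡.trans (≡.sym i≡0) i≡s))))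
          (+-identityʳ 1#)
      ; below    = λ {i} {j} j<i → trans
          (+-cong (I-off-diagonal (λ i≡j → Finₚ.<-irrefl (≡.sym i≡j) j<i))
                  (corner-off a i j (λ { (≡.refl , ≡.refl) → ℕₚ.n≮0 j<i })))
          (+-identityʳ 0#)
      }

    I+E-+ : ∀ a b → I+_E {s} a ⊗ I+ b E ≈ᴹ I+ (a + b) E
    I+E-+ a b i j = begin
      (I+ a E ⊗ I+ b E) i j                    ≈⟨ ⊗-I+E (I+E-isUnitriangular a) b i j ⟩
      I i j + corner a i j + corner b i j      ≈⟨ +-assoc _ _ _ ⟩
      I i j + (corner a i j + corner b i j)    ≈⟨ +-congˡ (corner-+ a b i j) ⟨
      I i j + corner (a + b) i j               ∎

    ≈I+E : ∀ {A : Matrix (suc s)} {a} → IsUnitriangular A →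
      (∀ {i j} → i Fin.< j → ¬ (i ≡ zero × j ≡ fromℕ s) → A i j ≈ 0#) →
      A zero (fromℕ s) ≈ a → A ≈ᴹ I+ a E
    ≈I+E {A} {a} A-ut off at-corner = unitriangular-≈ A-ut (I+E-isUnitriangular a) entries
      where
      entries : ∀ {i j} → i Fin.< j → A i j ≈ (I+ a E) i j
      entries {i} {j} i<j = by-cases (i Finₚ.≟ zero) (j Finₚ.≟ fromℕ s)
        where
        Iij≈0 : I i j ≈ 0#
        Iij≈0 = I-off-diagonal (λ i≡j → Finₚ.<-irrefl i≡j i<j)
        off-corner : ¬ (i ≡ zero × j ≡ fromℕ s) → A i j ≈ (I+ a E) i j
        off-corner ij≢ = trans (off i<j ij≢) (sym (trans (+-cong Iij≈0 (corner-off a i j ij≢)) (+-identityˡ 0#)))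
        by-cases : Dec (i ≡ zero) → Dec (j ≡ fromℕ s) → A i j ≈ (I+ a E) i j
        by-cases (yes ≡.refl) (yes ≡.refl) =
          trans at-corner (sym (trans (+-cong Iij≈0 (corner-corner {s} a)) (+-identityˡ a)))
        by-cases (no i≢0)     _            = off-corner (i≢0 ∘ proj₁)
        by-cases _            (no j≢s)     = off-corner (j≢s ∘ proj₂)

-- The divisibility filtration of unitriangular matrices

mod-weaken : ∀ {m m′ a b} → m′ ℕ∣.∣ m → a ≡ b [mod m ] → a ≡ b [mod m′ ]
mod-weaken m′∣m (mod m∣a-b) = mod (ℤ∣.∣-trans (ℤ∣.∣ᵤ⇒∣ m′∣m) m∣a-b)

mod-*-0 : ∀ {m m′ a b} → a ≡ 0ℤ [mod m ] → b ≡ 0ℤ [mod m′ ] → a ℤ.* b ≡ 0ℤ [mod m ℕ.* m′ ]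
mod-*-0 {m} {m′} {a} {b} (mod (ℤ∣.divides q a≡qm)) (mod (ℤ∣.divides r b≡rm′)) = mod (ℤ∣.divides (q ℤ.* r)
  (≡.trans (lemma₁ a b) (≡.trans (≡.cong₂ ℤ._*_ a≡qm b≡rm′)
    (≡.trans (lemma₂ q r (+ m) (+ m′)) (≡.cong (q ℤ.* r ℤ.*_) (≡.sym (ℤₚ.pos-* m m′)))))))
  where
  lemma₁ : ∀ a b → a ℤ.* b ℤ.- 0ℤ ≡ (a ℤ.- 0ℤ) ℤ.* (b ℤ.- 0ℤ)
  lemma₁ = solve-∀
  lemma₂ : ∀ q r m m′ → (q ℤ.* m) ℤ.* (r ℤ.* m′) ≡ q ℤ.* r ℤ.* (m ℤ.* m′)
  lemma₂ = solve-∀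

p^∣p^ : ∀ p {e f} → e ℕ.≤ f → p ℕ.^ e ℕ∣.∣ p ℕ.^ f
p^∣p^ p {e} {f} e≤f = ℕ∣.divides (p ℕ.^ (f ∸ e))
  (≡.trans (≡.cong (p ℕ.^_) (≡.sym (ℕₚ.m∸n+n≡m e≤f))) (ℕₚ.^-distribˡ-+-* p (f ∸ e) e))

-- A descending chain of normal subgroups { g ∣ g ∼[ e ] ε }, given by congruences, which is
-- central with exponent p successive quotients.
record IsCentralFiltration {ℓ} (p : ℕ) (G : Group ℓ ℓ)
                           (_∼[_]_ : Group.Carrier G → ℕ → Group.Carrier G → Set ℓ) : Set ℓ where
  open Group G
  field
    ∼-sym     : ∀ {e g h} → g ∼[ e ] h → h ∼[ e ] g
    ∼-trans   : ∀ {e g h k} → g ∼[ e ] h → h ∼[ e ] k → g ∼[ e ] k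
    ∼-reflexive       : ∀ {e g h} → g ≈ h → g ∼[ e ] h
    ∼-congˡ   : ∀ {e g h} k → g ∼[ e ] h → (k ∙ g) ∼[ e ] (k ∙ h)
    level-1   : ∀ g → g ∼[ 1 ] ε
    commute   : ∀ {e} g {h} → h ∼[ suc e ] ε → (g ∙ h) ∼[ suc (suc e) ] (h ∙ g)
    ∼-pth-power : ∀ {e h} → h ∼[ suc e ] ε → power G h p ∼[ suc (suc e) ] ε

  private
    commutator-≈ : ∀ g h → (h ∙ g) ⁻¹ ∙ (g ∙ h) ≈ commutator G g h
    commutator-≈ g h = solve (g ∷ h ∷ [])
      ((var (suc zero) ⊕ var zero) ⁻ ⊕ (var zero ⊕ var (suc zero))) ⁅ var zero , var (suc zero) ⁆ ≡.refl
      where open GroupSolver G renaming (inv to _⁻)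

  lowerCentral⇒∼ε : ∀ n {g} → lowerCentral (discrete G) p (suc n) g → g ∼[ suc n ] ε
  lowerCentral⇒∼ε zero    {g} _  = level-1 g
  lowerCentral⇒∼ε (suc n) {g} g∈ =
    let h , h∈ , g≈h = g∈ tt in ∼-trans (∼-reflexive g≈h) (on-generated h∈)
    where
    on-generated : ∀ {h} → Generated G
      (PowerOrCommutator (discrete G) p (lowerCentral (discrete G) p (suc n))) h → h ∼[ suc (suc n) ] ε
    on-generated (gen (pth-power h∈)) = ∼-pth-power (lowerCentral⇒∼ε n h∈)
    on-generated (gen (comm g {h} h∈)) = ∼-trans (∼-reflexive (sym (commutator-≈ g h)))
      (∼-trans (∼-congˡ ((h ∙ g) ⁻¹) (commute g (lowerCentral⇒∼ε n h∈))) (∼-reflexive (inverseˡ (h ∙ g))))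
    on-generated unit                 = ∼-reflexive refl
    on-generated (mul {g} {h} s t)    =
      ∼-trans (∼-congˡ g (on-generated t)) (∼-trans (∼-reflexive (identityʳ g)) (on-generated s))
    on-generated (inv {g} s)          = ∼-trans (∼-reflexive (sym (identityʳ (g ⁻¹))))
      (∼-trans (∼-congˡ (g ⁻¹) (∼-sym (on-generated s))) (∼-reflexive (inverseˡ g)))
    on-generated (resp g≈h s)         = ∼-trans (∼-reflexive (sym g≈h)) (on-generated s)

-- Matrices over ℤ/m, where pᴺ ∣ m, are filtered by the condition that the (i,j) entry,
-- at distance d = j - i > 0 from the diagonal, be divisible by p^(e-d).
module Filtration (p N m : ℕ) (p^N∣m : p ℕ.^ N ℕ∣.∣ m) where
  private
    R = ℤ/ m
    open SemiringSum (CommutativeRing.semiring R) using (sum)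
  open Matrices R
  open Corner R using (I-isUnitriangular; ⊗-distribˡ-+)

  -- The cap N is there because an entry known modulo m has a residue modulo p^N but perhaps not
  -- modulo higher powers. Truncated subtraction imposes no condition at distance d ≥ e.
  exponent : ℕ → ℕ → ℕ
  exponent e d = (e ∸ d) ⊓ N

  exponent-antimono : ∀ e {d d′} → d ℕ.≤ d′ → exponent e d′ ℕ.≤ exponent e d
  exponent-antimono e d≤d′ = ℕₚ.⊓-monoˡ-≤ N (ℕₚ.∸-monoʳ-≤ e d≤d′)

  exponent-mono : ∀ d {e e′} → e ℕ.≤ e′ → exponent e d ℕ.≤ exponent e′ d
  exponent-mono d e≤e′ = ℕₚ.⊓-monoˡ-≤ N (ℕₚ.∸-monoˡ-≤ d e≤e′)

  exponent≤N : ∀ e d → exponent e d ℕ.≤ N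
  exponent≤N e d = ℕₚ.m⊓n≤n (e ∸ d) N

  -- This makes the filtration multiplicative: in a matrix product the levels add while the
  -- distances from the diagonal add.
  exponent-+ : ∀ e f c d → exponent (e ℕ.+ f) (c ℕ.+ d) ℕ.≤ exponent e c ℕ.+ exponent f d
  exponent-+ e f c d = ℕₚ.≤-trans (ℕₚ.⊓-monoˡ-≤ N sub) (⊓-subadditive (e ∸ c) (f ∸ d))
    where
    ⊓-subadditive : ∀ x y → (x ℕ.+ y) ⊓ N ℕ.≤ x ⊓ N ℕ.+ y ⊓ N
    ⊓-subadditive x y = begin
      (x ℕ.+ y) ⊓ N                                   ≤⟨ ℕₚ.⊓-glb (ℕₚ.⊓-glb (ℕₚ.m⊓n≤m _ N)
        (ℕₚ.≤-trans (ℕₚ.m⊓n≤n (x ℕ.+ y) N) (ℕₚ.m≤n+m N x)))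
        (ℕₚ.≤-trans (ℕₚ.m⊓n≤n (x ℕ.+ y) N) (ℕₚ.m≤m+n N (y ⊓ N))) ⟩
      ((x ℕ.+ y) ⊓ (x ℕ.+ N)) ⊓ (N ℕ.+ y ⊓ N)         ≡⟨ ≡.cong (_⊓ (N ℕ.+ y ⊓ N)) (ℕₚ.+-distribˡ-⊓ x y N) ⟨
      (x ℕ.+ y ⊓ N) ⊓ (N ℕ.+ y ⊓ N)                   ≡⟨ ℕₚ.+-distribʳ-⊓ (y ⊓ N) x N ⟨
      x ⊓ N ℕ.+ y ⊓ N                                 ∎
      where open ℕₚ.≤-Reasoning
    sub : (e ℕ.+ f) ∸ (c ℕ.+ d) ℕ.≤ (e ∸ c) ℕ.+ (f ∸ d)
    sub = ℕₚ.m≤n+o⇒m∸n≤o (e ℕ.+ f) (c ℕ.+ d) (begin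
      e ℕ.+ f                                   ≤⟨ ℕₚ.+-mono-≤ (ℕₚ.m≤n+m∸n e c) (ℕₚ.m≤n+m∸n f d) ⟩
      (c ℕ.+ (e ∸ c)) ℕ.+ (d ℕ.+ (f ∸ d))       ≡⟨ +-interchange c (e ∸ c) d (f ∸ d) ⟩
      c ℕ.+ d ℕ.+ ((e ∸ c) ℕ.+ (f ∸ d))         ∎)
      where
      open ℕₚ.≤-Reasoning
      open import Algebra.Properties.CommutativeSemigroup ℕₚ.+-commutativeSemigroup
        using () renaming (interchange to +-interchange)

  exponent-suc : ∀ e d → exponent (suc e) d ℕ.≤ suc (exponent e d)
  exponent-suc e d = ℕₚ.≤-trans (exponent-+ 1 e 0 d) (ℕₚ.+-monoˡ-≤ (exponent e d) (ℕₚ.m⊓n≤m 1 N))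

  infix 4 _≡_[level_]

  weaken : ∀ {e f a b} → e ℕ.≤ f → a ≡ b [mod p ℕ.^ f ] → a ≡ b [mod p ℕ.^ e ]
  weaken e≤f = mod-weaken (p^∣p^ p e≤f)

  reduce-modulus : ∀ {e a b} → e ℕ.≤ N → a ≡ b [mod m ] → a ≡ b [mod p ℕ.^ e ]
  reduce-modulus e≤N = mod-weaken (ℕ∣.∣-trans (p^∣p^ p e≤N) p^N∣m)

  record _≡_[level_] {k} (A B : Matrix k) (e : ℕ) : Set where
    constructor entrywise
    field entry : ∀ {i j} → i Fin.< j → A i j ≡ B i j [mod p ℕ.^ exponent e (toℕ j ∸ toℕ i) ]

  open _≡_[level_]

  ≈⇒level : ∀ {k e} {A B : Matrix k} → A ≈ᴹ B → A ≡ B [level e ]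
  ≈⇒level {e = e} A≈B = entrywise λ {i} {j} _ → reduce-modulus (exponent≤N e (toℕ j ∸ toℕ i)) (A≈B i j)

  level-trans : ∀ {k e} {A B C : Matrix k} → A ≡ B [level e ] → B ≡ C [level e ] → A ≡ C [level e ]
  level-trans A≡B B≡C = entrywise λ i<j → mod-trans (entry A≡B i<j) (entry B≡C i<j)

  level-sym : ∀ {k e} {A B : Matrix k} → A ≡ B [level e ] → B ≡ A [level e ]
  level-sym A≡B = entrywise λ i<j → mod-sym (entry A≡B i<j)

  level-1 : ∀ {k} {A B : Matrix k} → A ≡ B [level 1 ]
  level-1 {A = A} {B} = entrywise λ {i} {j} i<j → weaken {f = 0}
    (ℕₚ.≤-trans (ℕₚ.m⊓n≤m _ N) (ℕₚ.≤-reflexive (ℕₚ.m≤n⇒m∸n≡0 (ℕₚ.m<n⇒0<n∸m i<j))))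
    (mod (ℤ∣.divides (A i j ℤ.- B i j) (≡.sym (ℤₚ.*-identityʳ _))))

  level-weaken : ∀ {k e f} {A B : Matrix k} → e ℕ.≤ f → A ≡ B [level f ] → A ≡ B [level e ]
  level-weaken e≤f A≡B = entrywise λ {i} {j} i<j →
    weaken (exponent-mono (toℕ j ∸ toℕ i) e≤f) (entry A≡B i<j)

  module _ {k} {A B : Matrix k} (A-ut : IsUnitriangular A) (B-ut : IsUnitriangular B) where
    private
      module A = IsUnitriangular A-ut
      module B = IsUnitriangular B-ut

    level-entry : ∀ {e d} → A ≡ B [level e ] → ∀ i j → toℕ j ∸ toℕ i ℕ.≤ d →
                  A i j ≡ B i j [mod p ℕ.^ exponent e d ]
    level-entry {e} {d} A≡B i j j-i≤d with Finₚ.<-cmp i j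
    ... | tri< i<j _ _    = weaken (exponent-antimono e j-i≤d) (entry A≡B i<j)
    ... | tri≈ _ ≡.refl _ = reduce-modulus (exponent≤N e d) (mod-trans (A.diagonal i) (mod-sym (B.diagonal i)))
    ... | tri> _ _ j<i    = reduce-modulus (exponent≤N e d) (mod-trans (A.below j<i) (mod-sym (B.below j<i)))

  sum-cong : ∀ {k m} {s t : Fin k → ℤ} → (∀ l → s l ≡ t l [mod m ]) → sum s ≡ sum t [mod m ]
  sum-cong {m = m} = SemiringSum.sum-cong-≋ (CommutativeRing.semiring (ℤ/ m))

  -- Each summand A i l * B l j equals, up to the divisible
  -- (A i l - I i l) (B l j - I l j), A i l * I l j + I i l * (B l j - I l j).
  ⊗-level : ∀ {k e f} {A B : Matrix k} → IsUnitriangular A → IsUnitriangular B →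
    A ≡ I [level e ] → B ≡ I [level f ] →
    (A ⊗ B) ≡ (λ i j → A i j ℤ.+ (B i j ℤ.- I i j)) [level e ℕ.+ f ]
  ⊗-level {e = e} {f} {A} {B} A-ut B-ut A≡I B≡I = entrywise entries
   where
   entries : ∀ {i j} → i Fin.< j →
     (A ⊗ B) i j ≡ A i j ℤ.+ (B i j ℤ.- I i j) [mod p ℕ.^ exponent (e ℕ.+ f) (toℕ j ∸ toℕ i) ]
   entries {i} {j} i<j = mod-trans (sum-cong summand)
    (reduce-modulus (exponent≤N (e ℕ.+ f) (toℕ j ∸ toℕ i)) (mod-trans
      (SemiringSum.∑-distrib-+ (CommutativeRing.semiring R)
        (λ l → A i l ℤ.* I l j) (λ l → I i l ℤ.* (B l j ℤ.- I l j)))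
      (mod-+-cong (⊗-identityʳ A i j) (⊗-identityˡ (λ i j → B i j ℤ.- I i j) i j))))
    where
    difference≡0 : ∀ {m a b} → a ≡ b [mod m ] → a ℤ.- b ≡ 0ℤ [mod m ]
    difference≡0 {m} {a} {b} = mod-difference (ℤₚ.+-identityʳ (a ℤ.- b))
    M = p ℕ.^ exponent (e ℕ.+ f) (toℕ j ∸ toℕ i)
    product≡0 : ∀ l → (A i l ℤ.- I i l) ℤ.* (B l j ℤ.- I l j) ≡ 0ℤ [mod M ]
    product≡0 l with l Finₚ.<? i | j Finₚ.<? l
    ... | yes l<i | _ = reduce-modulus (exponent≤N (e ℕ.+ f) (toℕ j ∸ toℕ i)) (mod-trans
      (mod-*-cong (difference≡0 (mod-trans (IsUnitriangular.below A-ut l<i)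
        (mod-sym (IsUnitriangular.below I-isUnitriangular l<i)))) mod-refl)
      (≡⇒mod (ℤₚ.*-zeroˡ (B l j ℤ.- I l j))))
    ... | _ | yes j<l = reduce-modulus (exponent≤N (e ℕ.+ f) (toℕ j ∸ toℕ i)) (mod-trans
      (mod-*-cong (mod-refl {a = A i l ℤ.- I i l}) (difference≡0 (mod-trans (IsUnitriangular.below B-ut j<l)
        (mod-sym (IsUnitriangular.below I-isUnitriangular j<l)))))
      (≡⇒mod (ℤₚ.*-zeroʳ (A i l ℤ.- I i l))))
    -- For i ≤ l ≤ j the distances from i to l and from l to j add up to j - i.
    ... | no l≮i | no j≮l = mod-weaken
      (≡.subst (M ℕ∣.∣_) (ℕₚ.^-distribˡ-+-* p (exponent e (toℕ l ∸ toℕ i)) (exponent f (toℕ j ∸ toℕ l)))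
        (p^∣p^ p (≡.subst
          (λ d → exponent (e ℕ.+ f) d ℕ.≤ exponent e (toℕ l ∸ toℕ i) ℕ.+ exponent f (toℕ j ∸ toℕ l)) distance
          (exponent-+ e f (toℕ l ∸ toℕ i) (toℕ j ∸ toℕ l)))))
      (mod-*-0 (difference≡0 (level-entry A-ut I-isUnitriangular {e} A≡I i l ℕₚ.≤-refl))
               (difference≡0 (level-entry B-ut I-isUnitriangular {f} B≡I l j ℕₚ.≤-refl)))
      where
      distance : (toℕ l ∸ toℕ i) ℕ.+ (toℕ j ∸ toℕ l) ≡ toℕ j ∸ toℕ i
      distance = ≡.trans (ℕₚ.+-comm (toℕ l ∸ toℕ i) _)
        (≡.trans (≡.sym (ℕₚ.+-∸-assoc (toℕ j ∸ toℕ l) (ℕₚ.≮⇒≥ l≮i)))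
          (≡.cong (_∸ toℕ i) (ℕₚ.m∸n+n≡m (ℕₚ.≮⇒≥ j≮l))))
    summand : ∀ l → A i l ℤ.* B l j ≡ A i l ℤ.* I l j ℤ.+ I i l ℤ.* (B l j ℤ.- I l j) [mod M ]
    summand l = mod-difference (lemma (A i l) (B l j) (I i l) (I l j)) (product≡0 l)
      where
      lemma : ∀ a b x y → a ℤ.* b ℤ.- (a ℤ.* y ℤ.+ x ℤ.* (b ℤ.- y)) ≡ (a ℤ.- x) ℤ.* (b ℤ.- y) ℤ.- 0ℤ
      lemma = solve-∀

  -- Row i of C contributes only for l ≥ i, so A and B are compared at distances at most j - i,
  -- where their congruence is at least as strong.
  ⊗-level-congˡ : ∀ {k e} {A B C : Matrix k} → IsUnitriangular A → IsUnitriangular B → IsUnitriangular C →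
    A ≡ B [level e ] → (C ⊗ A) ≡ (C ⊗ B) [level e ]
  ⊗-level-congˡ {e = e} {A} {B} {C} A-ut B-ut C-ut A≡B = entrywise λ {i} {j} _ → sum-cong (summand i j)
    where
    summand : ∀ i j l → C i l ℤ.* A l j ≡ C i l ℤ.* B l j [mod p ℕ.^ exponent e (toℕ j ∸ toℕ i) ]
    summand i j l with l Finₚ.<? i
    ... | yes l<i = mod-trans (mod-*-cong C≡0 (mod-refl {a = A l j})) (mod-sym (mod-*-cong C≡0 (mod-refl {a = B l j})))
      where C≡0 = reduce-modulus (exponent≤N e (toℕ j ∸ toℕ i)) (IsUnitriangular.below C-ut l<i)
    ... | no l≮i  = mod-*-cong (mod-refl {a = C i l})
      (level-entry A-ut B-ut {e} A≡B l j (ℕₚ.∸-monoʳ-≤ (toℕ j) (ℕₚ.≮⇒≥ l≮i)))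

  module _ (k : ℕ) where
    open Group (𝕌 k)

    private
      M : Carrier → Matrix k
      M = toMatrix

    isUnitriangular : ∀ u → IsUnitriangular (M u)
    isUnitriangular u = proj₂ (Unit.val u)

    _∼[_]_ : Carrier → ℕ → Carrier → Set
    u ∼[ e ] v = M u ≡ M v [level e ]

    -- Every g has level 1, so by `⊗-level` both products agree with the symmetric expression g + h
    -- - I at level 1 + (e + 1).
    commute : ∀ {e} g {h} → h ∼[ suc e ] ε → (g ∙ h) ∼[ suc (suc e) ] (h ∙ g)
    commute {e} g {h} h∼ε = level-trans {A = M (g ∙ h)} {λ i j → M g i j ℤ.+ (M h i j ℤ.- I i j)} {M (h ∙ g)}
      (⊗-level {e = 1} {suc e} (isUnitriangular g) (isUnitriangular h) level-1 h∼ε)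
      (level-sym (level-trans {A = M (h ∙ g)}
        {λ i j → M h i j ℤ.+ (M g i j ℤ.- I i j)} {λ i j → M g i j ℤ.+ (M h i j ℤ.- I i j)}
        (≡.subst (λ f → M (h ∙ g) ≡ (λ i j → M h i j ℤ.+ (M g i j ℤ.- I i j)) [level f ]) (ℕₚ.+-comm (suc e) 1)
          (⊗-level {e = suc e} {1} (isUnitriangular h) (isUnitriangular g) h∼ε level-1))
        (entrywise λ {i} {j} _ → ≡⇒mod (lemma (M g i j) (M h i j) (I i j)))))
      where
      lemma : ∀ a b x → b ℤ.+ (a ℤ.- x) ≡ a ℤ.+ (b ℤ.- x)
      lemma = solve-∀

    ∼-congˡ : ∀ {e u v} w → u ∼[ e ] v → (w ∙ u) ∼[ e ] (w ∙ v)
    ∼-congˡ {e} {u} {v} w u∼v = ⊗-level-congˡ {e = e} {M u} {M v} {M w}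
      (isUnitriangular u) (isUnitriangular v) (isUnitriangular w) u∼v

    ∼-power : ∀ {e h} → h ∼[ e ] ε → ∀ m → power (𝕌 k) h m ∼[ e ] ε
    ∼-power         h∼ε zero    = ≈⇒level {A = M ε} {M ε} (λ i j → mod-refl)
    ∼-power {e} {h} h∼ε (suc m) = level-trans {A = M (h ∙ power (𝕌 k) h m)} {M (h ∙ ε)} {M ε}
      (∼-congˡ {e} {power (𝕌 k) h m} {ε} h (∼-power {e} {h} h∼ε m))
      (level-trans {A = M (h ∙ ε)} {M h} {M ε} (≈⇒level {A = M (h ∙ ε)} {M h} (⊗-identityʳ (M h))) h∼ε)

    -- A binomial expansion to first order: in the inductive step the product of h - I and hᵐ - I
    -- has level 2(e + 1) ≥ e + 2 and drops out.
    power-expand : ∀ {e h} → h ∼[ suc e ] ε → ∀ m →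
      M (power (𝕌 k) h m) ≡ (λ i j → I i j ℤ.+ + m ℤ.* (M h i j ℤ.- I i j)) [level suc (suc e) ]
    power-expand         h∼ε zero    = entrywise λ {i} {j} _ → ≡⇒mod (≡.sym (ℤₚ.+-identityʳ (I i j)))
    power-expand {e} {h} h∼ε (suc m) = entrywise λ {i} {j} i<j → mod-trans
      (weaken (exponent-mono (toℕ j ∸ toℕ i) {suc (suc e)} {suc e ℕ.+ suc e} (s≤s (ℕₚ.m≤n+m (suc e) e)))
        (entry (⊗-level {e = suc e} {suc e} {M h} {M (power (𝕌 k) h m)} (isUnitriangular h)
          (isUnitriangular (power (𝕌 k) h m)) h∼ε (∼-power {suc e} {h} h∼ε m)) i<j))
      (mod-trans (mod-+-cong (mod-refl {a = M h i j})
        (mod-+-cong (entry (power-expand {e} {h} h∼ε m) i<j) (mod-refl {a = ℤ.- I i j})))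
        (≡⇒mod (lemma (M h i j) (I i j) (+ m))))
      where
      lemma : ∀ a x m → a ℤ.+ (x ℤ.+ m ℤ.* (a ℤ.- x) ℤ.- x) ≡ x ℤ.+ (1ℤ ℤ.+ m) ℤ.* (a ℤ.- x)
      lemma = solve-∀

    -- In I + p(h - I) the factor p supplies what is missing, as raising the level by one raises
    -- each exponent by at most one.
    ∼-pth-power : ∀ {e h} → h ∼[ suc e ] ε → power (𝕌 k) h p ∼[ suc (suc e) ] ε
    ∼-pth-power {e} {h} h∼ε = level-trans {A = M (power (𝕌 k) h p)}
      {λ i j → I i j ℤ.+ + p ℤ.* (M h i j ℤ.- I i j)} {M ε}
      (power-expand {e} {h} h∼ε p) (entrywise λ {i} {j} i<j →
      mod-trans (mod-+-cong (mod-refl {a = I i j})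
        (weaken (exponent-suc (suc e) (toℕ j ∸ toℕ i)) (mod-*-0 p≡0
          (mod-difference (ℤₚ.+-identityʳ (M h i j ℤ.- I i j)) (entry h∼ε i<j)))))
        (≡⇒mod (ℤₚ.+-identityʳ (I i j))))
      where
      p≡0 : + p ≡ 0ℤ [mod p ]
      p≡0 = mod (ℤ∣.divides 1ℤ (≡.trans (ℤₚ.+-identityʳ (+ p)) (≡.sym (ℤₚ.*-identityˡ (+ p)))))

    filtration : IsCentralFiltration p (𝕌 k) _∼[_]_
    filtration = record
      { ∼-sym       = level-sym
      ; ∼-trans     = level-trans
      ; ∼-reflexive = λ {e} {u} {v} → ≈⇒level {e = e} {M u} {M v}
      ; ∼-congˡ     = λ {e} {u} {v} → ∼-congˡ {e} {u} {v}
      ; level-1     = λ u → level-1 {A = M u} {I}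
      ; commute     = λ {e} g {h} → commute {e} g {h}
      ; ∼-pth-power = λ {e} {h} → ∼-pth-power {e} {h}
      }

    lowerCentral⇒level : ∀ n {u} → lowerCentral (discrete (𝕌 k)) p n u → toMatrix u ≡ I [level n ]
    lowerCentral⇒level zero    {u} _  = level-weaken (z≤n {1}) (level-1 {A = M u} {I})
    lowerCentral⇒level (suc n) {u} u∈ = IsCentralFiltration.lowerCentral⇒∼ε filtration n {u} u∈

-- Integral parts and the corner coordinate

mod-scale : ∀ {m a b} c → a ≡ b [mod m ] → a ℤ.* + c ≡ b ℤ.* + c [mod m ℕ.* c ]
mod-scale {m} {a} {b} c (mod (ℤ∣.divides q a-b≡qm)) = mod (ℤ∣.divides q
  (≡.trans (lemma₁ a b (+ c)) (≡.trans (≡.cong (ℤ._* + c) a-b≡qm)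
    (≡.trans (ℤₚ.*-assoc q (+ m) (+ c)) (≡.cong (q ℤ.*_) (≡.sym (ℤₚ.pos-* m c)))))))
  where
  lemma₁ : ∀ a b c → a ℤ.* c ℤ.- b ℤ.* c ≡ (a ℤ.- b) ℤ.* c
  lemma₁ = solve-∀

module _ (p c : ℕ) .{{_ : NonZero c}} where

  ≡-modulo-c : ∀ {x y} a → x ≡ y ℤ.+ a ℤ.* + c [mod p ℕ.* c ] → x ≡ y [mod c ]
  ≡-modulo-c {x} {y} a x≡y+ac = mod-trans (mod-weaken (ℕ∣.n∣m*n p) x≡y+ac)
    (mod (ℤ∣.divides a (lemma y (a ℤ.* + c))))
    where
    lemma : ∀ y b → y ℤ.+ b ℤ.- y ≡ b
    lemma = solve-∀

  %-cong : ∀ {x y} → x ≡ y [mod c ] → x ℤD.%ℕ c ≡ y ℤD.%ℕ c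
  %-cong {x} {y} x≡y = ≡.trans (≡.sym (Finₚ.toℕ-fromℕ< (ℤD.n%ℕd<d x c)))
    (≡.trans (≡.cong toℕ (Injection.cong (proj₂ (ℤ/-finite c)) x≡y)) (Finₚ.toℕ-fromℕ< (ℤD.n%ℕd<d y c)))

  -- Since x ≡ y modulo c, both leave the same remainder on division by c. The difference of x and y
  -- + ac is thus c times that of the integral parts, and c cancels against the modulus pc. This
  -- makes `t` well defined and compatible with translation by z.
  quotient-shift : ∀ {x y} a → x ≡ y ℤ.+ a ℤ.* + c [mod p ℕ.* c ] → x ℤD./ℕ c ≡ (y ℤD./ℕ c) ℤ.+ a [mod p ]
  quotient-shift {x} {y} a x≡y+ac@(mod (ℤ∣.divides k eq)) = mod (ℤ∣.divides k
    (ℤₚ.*-cancelʳ-≡ _ _ (+ c) (begin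
      (q ℤ.- (q′ ℤ.+ a)) ℤ.* + c
        ≡⟨ lemma (+ r) q q′ a (+ c) ⟩
      (+ r ℤ.+ q ℤ.* + c) ℤ.- (+ r ℤ.+ q′ ℤ.* + c ℤ.+ a ℤ.* + c)
        ≡⟨ ≡.cong₂ (λ x y → x ℤ.- (y ℤ.+ a ℤ.* + c)) (ℤD.a≡a%ℕn+[a/ℕn]*n x c)
             (≡.trans (ℤD.a≡a%ℕn+[a/ℕn]*n y c) (≡.cong (λ r → + r ℤ.+ q′ ℤ.* + c) r′≡r)) ⟨
      x ℤ.- (y ℤ.+ a ℤ.* + c)     ≡⟨ eq ⟩
      k ℤ.* + (p ℕ.* c)           ≡⟨ ≡.cong (k ℤ.*_) (ℤₚ.pos-* p c) ⟩
      k ℤ.* (+ p ℤ.* + c)         ≡⟨ ℤₚ.*-assoc k (+ p) (+ c) ⟨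
      k ℤ.* + p ℤ.* + c           ∎)))
    where
    open ≡.≡-Reasoning
    r = x ℤD.%ℕ c
    q = x ℤD./ℕ c
    q′ = y ℤD./ℕ c
    r′≡r : y ℤD.%ℕ c ≡ r
    r′≡r = ≡.sym (%-cong {x} {y} (≡-modulo-c {x} {y} a x≡y+ac))
    lemma : ∀ r q q′ a c → (q ℤ.- (q′ ℤ.+ a)) ℤ.* c ≡ (r ℤ.+ q ℤ.* c) ℤ.- (r ℤ.+ q′ ℤ.* c ℤ.+ a ℤ.* c)
    lemma = solve-∀

  0/c≡0 : 0ℤ ℤD./ℕ c ≡ 0ℤ
  0/c≡0 = ≡.cong +_ (ℕD.0/n≡0 c)

module CentralSubgroup (p n s : ℕ) (0<p : 0 ℕ.< p) (0<s : 0 ℕ.< s) where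
  private
    instance
      s≢0 : NonZero s
      s≢0 = ℕ.>-nonZero 0<s
      c≢0 : NonZero (p ℕ.^ (n ∸ s))
      c≢0 = ℕₚ.m^n≢0 p (n ∸ s) {{ℕ.>-nonZero 0<p}}
    c = p ℕ.^ (n ∸ s)
    module R = CommutativeRing (ℤ/ 𝕌-modulus p n s)
  open Matrices (ℤ/ 𝕌-modulus p n s)
  open Corner (ℤ/ 𝕌-modulus p n s)
  open Group (Matrices.𝕌 (ℤ/ 𝕌-modulus p n s) (suc s))

  z : ℤ → Group.Carrier (Matrices.𝕌 (ℤ/ 𝕌-modulus p n s) (suc s))
  z a = record
    { val      = I+ a ℤ.* + c E , I+E-isUnitriangular (a ℤ.* + c)
    ; inverse  = I+ ℤ.- (a ℤ.* + c) E , I+E-isUnitriangular (ℤ.- (a ℤ.* + c))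
    ; inverseˡ = λ i j → mod-trans (I+E-+ (ℤ.- (a ℤ.* + c)) (a ℤ.* + c) i j)
        (mod-trans (I+E-cong {s} (R.-‿inverseˡ (a ℤ.* + c)) i j) (I+0E i j))
    ; inverseʳ = λ i j → mod-trans (I+E-+ (a ℤ.* + c) (ℤ.- (a ℤ.* + c)) i j)
        (mod-trans (I+E-cong {s} (R.-‿inverseʳ (a ℤ.* + c)) i j) (I+0E i j))
    }

  z-cong : ∀ {a b} → a ≡ b [mod p ] → z a ≈ z b
  z-cong a≡b = I+E-cong {s} (mod-scale c a≡b)

  z-homo : ∀ a b → z (a ℤ.+ b) ≈ z a ∙ z b
  z-homo a b i j = mod-trans (I+E-cong {s} (≡⇒mod (ℤₚ.*-distribʳ-+ (+ c) a b)) i j)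
    (mod-sym (I+E-+ (a ℤ.* + c) (b ℤ.* + c) i j))

  z-central : ∀ a u → z a ∙ u ≈ u ∙ z a
  z-central a u i j = mod-trans (I+E-⊗ (proj₂ (Unit.val u)) (a ℤ.* + c) i j)
    (mod-sym (⊗-I+E (proj₂ (Unit.val u)) (a ℤ.* + c) i j))

  open Filtration p (suc (n ∸ s)) (𝕌-modulus p n s) ℕ∣.∣-refl using (exponent; lowerCentral⇒level; _≡_[level_])

  -- At level n the corner, at distance s, is divisible by p^(n-s), and `a` is the quotient. Any
  -- other entry above the diagonal has distance below s, so its exponent reaches the cap n - s + 1
  -- and the entry is 0 in the ring.
  lowerCentral⇒z : s ℕ.≤ n → ∀ {u} →
    lowerCentral (discrete (Matrices.𝕌 (ℤ/ 𝕌-modulus p n s) (suc s))) p n u → ∃[ a ] u ≈ z a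
  lowerCentral⇒z s≤n {u} u∈ =
    a , ≈I+E {A = toMatrix u} {a ℤ.* + c} (proj₂ (Unit.val u)) off
      (≡⇒mod (≡.trans (≡.sym (ℤₚ.+-identityʳ (toMatrix u zero (fromℕ s)))) entry≡ac))
    where
    u≡I : ∀ {i j} → i Fin.< j → toMatrix u i j ≡ I i j [mod p ℕ.^ exponent n (toℕ j ∸ toℕ i) ]
    u≡I = _≡_[level_].entry (lowerCentral⇒level (suc s) n {u} u∈)
    at-corner : toMatrix u zero (fromℕ s) ≡ 0ℤ [mod c ]
    at-corner = mod-trans (≡.subst (λ e → toMatrix u zero (fromℕ s) ≡ I {suc s} zero (fromℕ s) [mod p ℕ.^ e ])
      (≡.trans (≡.cong (exponent n) (Finₚ.toℕ-fromℕ s)) (ℕₚ.m≤n⇒m⊓n≡m (ℕₚ.n≤1+n (n ∸ s))))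
      (u≡I (fromℕ-maximal zero≢fromℕ)))
      (mod-weaken (ℕ∣.n∣m*n p) (I-off-diagonal zero≢fromℕ))
    a = ℤ∣.quotient (_≡_[mod_].m∣a-b at-corner)
    entry≡ac = ℤ∣._∣_.equality (_≡_[mod_].m∣a-b at-corner)
    off : ∀ {i j} → i Fin.< j → ¬ (i ≡ zero × j ≡ fromℕ s) → toMatrix u i j ≡ 0ℤ [mod 𝕌-modulus p n s ]
    off {i} {j} i<j ij≢ = mod-trans
      (≡.subst (λ e → toMatrix u i j ≡ I i j [mod p ℕ.^ e ])
        (ℕₚ.m≥n⇒m⊓n≡n (ℕₚ.≤-trans (ℕₚ.≤-reflexive (≡.sym (ℕₚ.+-∸-assoc 1 {n} {s} s≤n)))
          (ℕₚ.∸-monoʳ-≤ (suc n) (off-corner-distance i j i<j ij≢))))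
        (u≡I i<j))
      (I-off-diagonal (λ i≡j → Finₚ.<-irrefl i≡j i<j))

  t : Group.Carrier (Matrices.𝕌 (ℤ/ 𝕌-modulus p n s) (suc s)) → ℤ
  t u = toMatrix u zero (fromℕ s) ℤD./ℕ c

  t-cong : ∀ {u v} → u ≈ v → t u ≡ t v [mod p ]
  t-cong {u} {v} u≈v = mod-trans (quotient-shift p c {y = toMatrix v zero (fromℕ s)} 0ℤ
    (mod-trans (u≈v zero (fromℕ s)) (≡⇒mod (≡.sym (ℤₚ.+-identityʳ _)))))
    (≡⇒mod (ℤₚ.+-identityʳ (t v)))

  t-∙z : ∀ u a → t (u ∙ z a) ≡ t u ℤ.+ a [mod p ]
  t-∙z u a = quotient-shift p c {toMatrix (u ∙ z a) zero (fromℕ s)} {toMatrix u zero (fromℕ s)} a (mod-trans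
    (⊗-I+E (proj₂ (Unit.val u)) (a ℤ.* + c) zero (fromℕ s))
    (mod-+-cong (mod-refl {a = toMatrix u zero (fromℕ s)}) (corner-corner {s} (a ℤ.* + c))))

  t-ε : t ε ≡ 0ℤ [mod p ]
  t-ε = mod-trans (quotient-shift p c {toMatrix ε zero (fromℕ s)} {0ℤ} 0ℤ (I-off-diagonal (zero≢fromℕ {s})))
    (mod-trans (≡⇒mod (ℤₚ.+-identityʳ (0ℤ ℤD./ℕ c))) (≡⇒mod (0/c≡0 p c)))

-- Lyndon commutators in the unitriangular group

module LyndonMatrix {ℓ} {X : Set ℓ} {_<_ : Rel X ℓ} (<-isSTO : IsStrictTotalOrder _≡_ _<_)
                    (R : CommutativeRing 0ℓ 0ℓ) (w : List X) where
  open Words <-isSTO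
  open IsStrictTotalOrder <-isSTO using (_≟_)
  open StandardFactorization <-isSTO
  open CommutativeRing R hiding (zero)
  open PowerSeries X R
  open Matrices R
  open Corner R
  open SeriesMatrix X R
  open LeadingWords <-isSTO R
  open SemiringSum semiring using (sum-cong-≋)

  private
    s = length w
    module U = Group (Matrices.𝕌 R (suc (length w)))
    G = units seriesMonoid
    module G = Group G

  seriesMatrix-inverse : ∀ f g → f ⊛ g ≋ one → seriesMatrix f w ⊗ seriesMatrix g w ≈ᴹ I
  seriesMatrix-inverse f g fg≋1 i j = trans (sym (seriesMatrix-⊛ f g w i j))
    (trans (seriesMatrix-cong w (λ u _ → fg≋1 u) i j) (seriesMatrix-one w i j))

  -- The matrix that ρ^w assigns to the generator y, written down directly because no free profinite
  -- group is at hand here.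
  generator : X → Group.Carrier (Matrices.𝕌 R (suc (length w)))
  generator y = record
    { val      = seriesMatrix (1+ _≟_ y) w , seriesMatrix-isUnitriangular (1+ _≟_ y) w refl
    ; inverse  = seriesMatrix (1+⁻¹ _≟_ y) w , seriesMatrix-isUnitriangular (1+⁻¹ _≟_ y) w refl
    ; inverseˡ = seriesMatrix-inverse (1+⁻¹ _≟_ y) (1+ _≟_ y) (Unit.inverseˡ (1+-unit _≟_ y))
    ; inverseʳ = seriesMatrix-inverse (1+ _≟_ y) (1+⁻¹ _≟_ y) (Unit.inverseʳ (1+-unit _≟_ y))
    }

  _represents_ : U.Carrier → G.Carrier → Set
  u represents f = toMatrix u ≈ᴹ seriesMatrix (val f) w

  ⊗-cong : ∀ {k} {A A′ B B′ : Matrix k} → A ≈ᴹ A′ → B ≈ᴹ B′ → A ⊗ B ≈ᴹ A′ ⊗ B′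
  ⊗-cong A≈A′ B≈B′ i j = sum-cong-≋ (λ l → *-cong (A≈A′ i l) (B≈B′ l j))

  represents-∙ : ∀ {u u′ f f′} → u represents f → u′ represents f′ → (u U.∙ u′) represents (f G.∙ f′)
  represents-∙ {u} {u′} {f} {f′} u∼f u′∼f′ i j = trans
    (⊗-cong {A = toMatrix u} {_} {toMatrix u′} u∼f u′∼f′ i j) (sym (seriesMatrix-⊛ (val f) (val f′) w i j))

  represents-⁻¹ : ∀ {u f} → u represents f → (u U.⁻¹) represents (f G.⁻¹)
  represents-⁻¹ {u} {f} u∼f i j = begin
    B i j                 ≈⟨ ⊗-identityʳ B i j ⟨
    (B ⊗ I) i j           ≈⟨ ⊗-cong {A = B} {B} {F ⊗ F′} {I} (λ _ _ → refl)
      (seriesMatrix-inverse (val f) (Unit.inverse f) (Unit.inverseʳ f)) i j ⟨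
    (B ⊗ (F ⊗ F′)) i j    ≈⟨ ⊗-assoc B F F′ i j ⟨
    (B ⊗ F ⊗ F′) i j      ≈⟨ ⊗-cong {A = B ⊗ A} {B ⊗ F} {F′} {F′}
      (⊗-cong {A = B} {B} {A} {F} (λ _ _ → refl) u∼f) (λ _ _ → refl) i j ⟨
    (B ⊗ A ⊗ F′) i j      ≈⟨ ⊗-cong {A = B ⊗ A} {I} {F′} {F′} (U.inverseˡ u) (λ _ _ → refl) i j ⟩
    (I ⊗ F′) i j          ≈⟨ ⊗-identityˡ F′ i j ⟩
    F′ i j                ∎
    where
    open SetoidReasoning setoid
    A = toMatrix u
    B = toMatrix (u U.⁻¹)
    F = seriesMatrix (val f) w
    F′ = seriesMatrix (Unit.inverse f) w

  τ-power-represents : ∀ m →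
    power (Matrices.𝕌 R (suc (length w))) (τ (Matrices.𝕌 R (suc (length w))) generator w) m represents
    power G (τ G (1+-unit _≟_) w) m
  τ-power-represents m = power-related {G = Matrices.𝕌 R (suc (length w))} {G} _represents_
    (λ i j → sym (seriesMatrix-one w i j))
    (λ {u} {u′} {f} {f′} → represents-∙ {u} {u′} {f} {f′})
    (λ {u} {f} → represents-⁻¹ {u} {f}) m
    (bracketing-related {G = Matrices.𝕌 R (suc (length w))} {G} _represents_
      (λ i j → sym (seriesMatrix-one w i j))
      (λ {u} {u′} {f} {f′} → represents-∙ {u} {u′} {f} {f′})
      (λ {u} {f} → represents-⁻¹ {u} {f}) {generator} {1+-unit _≟_} (λ y i j → refl) s w)

  factor-length : ∀ (i j : Fin (suc s)) → length (take (toℕ j ∸ toℕ i) (drop (toℕ i) w)) ≡ toℕ j ∸ toℕ i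
  factor-length i j = ≡.trans (Listₚ.length-take (toℕ j ∸ toℕ i) (drop (toℕ i) w))
    (≡.trans (≡.cong ((toℕ j ∸ toℕ i) ⊓_) (Listₚ.length-drop (toℕ i) w))
      (ℕₚ.m≤n⇒m⊓n≡m (ℕₚ.∸-monoˡ-≤ (toℕ i) (ℕₚ.<⇒≤pred (Finₚ.toℕ<n j)))))

  seriesMatrix-≤ : ∀ f (i j : Fin (suc s)) → i Fin.≤ j →
    seriesMatrix f w i j ≡ f (take (toℕ j ∸ toℕ i) (drop (toℕ i) w))
  seriesMatrix-≤ f i j i≤j with toℕ i ℕ.≤ᵇ toℕ j | ℕₚ.≤⇒≤ᵇ i≤j
  ... | true | _ = ≡.refl

  seriesMatrix-corner : ∀ f → seriesMatrix f w zero (fromℕ s) ≡ f w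
  seriesMatrix-corner f = ≡.cong f (≡.trans (≡.cong (λ k → take k w) (Finₚ.toℕ-fromℕ s)) (Listₚ.take-all s w ℕₚ.≤-refl))

  -- Above the diagonal, an entry off the corner is the coefficient at a nonempty factor of w
  -- shorter than w, and such a factor precedes w.
  leading-matrix : .{{_ : NonZero s}} → ∀ {a f} → Leading w a f → seriesMatrix f w ≈ᴹ I+ a E
  leading-matrix {a} {f} f-leading = ≈I+E (seriesMatrix-isUnitriangular f w constant) off
    (trans (reflexive (seriesMatrix-corner f)) leading)
    where
    open Leading f-leading
    off : ∀ {i j} → i Fin.< j → ¬ (i ≡ zero × j ≡ fromℕ s) → seriesMatrix f w i j ≈ 0#
    off {i} {j} i<j ij≢ = trans (reflexive (seriesMatrix-≤ f i j (ℕₚ.<⇒≤ i<j)))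
      (small _ nonempty (inj₁ (≡.subst (ℕ._< s) (≡.sym (factor-length i j)) (off-corner-distance i j i<j ij≢))))
      where
      nonempty : take (toℕ j ∸ toℕ i) (drop (toℕ i) w) ≢ []
      nonempty eq = ℕₚ.m<n⇒n≢0 (ℕₚ.m<n⇒0<n∸m i<j) (≡.trans (≡.sym (factor-length i j)) (≡.cong length eq))

  τ-power-matrix : .{{_ : NonZero s}} → IsLyndon w → ∀ m →
    toMatrix (power (Matrices.𝕌 R (suc (length w))) (τ (Matrices.𝕌 R (suc (length w))) generator w) m) ≈ᴹ
    I+ RawMonoidOps._×_ +-rawMonoid m 1# E
  τ-power-matrix w-isLyndon m i j = trans (τ-power-represents m i j)
    (leading-matrix (τ-power-leading w-isLyndon m) i j)

-- Any proper suffix starts with a positive letter, so the first letter 0 decides. This provides a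
-- Lyndon word of every positive length, whatever the alphabet X.
applyUpTo-isLyndon : ∀ k → Words.IsLyndon ℕₚ.<-isStrictTotalOrder (0 ∷ applyUpTo suc k)
applyUpTo-isLyndon k = (λ ()) , below
  where
  positive : ∀ {y v} → All (0 ℕ.<_) (y ∷ v) → 0 ℕ.< y
  positive (0<y ∷ _) = 0<y
  below : ∀ u v → u ≢ [] → v ≢ [] → 0 ∷ applyUpTo suc k ≡ u ++ v → Lex.Lex-< _≡_ ℕ._<_ (0 ∷ applyUpTo suc k) v
  below []      v        u≢[] _    _  = ⊥-elim (u≢[] ≡.refl)
  below (_ ∷ u) []       _    v≢[] _  = ⊥-elim (v≢[] ≡.refl)
  below (_ ∷ u) (y ∷ v)  _    _    eq = Lex.this (positive (Allₚ.++⁻ʳ u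
    (≡.subst (All (0 ℕ.<_)) (Listₚ.∷-injectiveʳ eq) (Allₚ.applyUpTo⁺₂ suc k (λ _ → s≤s z≤n)))))

×1≡ : ∀ m k → RawMonoidOps._×_ (CommutativeRing.+-rawMonoid (ℤ/ m)) k 1ℤ ≡ + k
×1≡ m zero    = ≡.refl
×1≡ m (suc k) = ≡.cong ℤ.suc (×1≡ m k)

module _ {ℓ} {p} .{{_ : NonZero p}} {U : Group ℓ ℓ} (z : ℤ → Group.Carrier U)
         (z-cong : ∀ {a b} → a ≡ b [mod p ] → Group._≈_ U (z a) (z b))
         (z-homo : ∀ a b → Group._≈_ U (z (a ℤ.+ b)) (Group._∙_ U (z a) (z b)))
         (n : ℕ) where
  open Group U
  open IsNormalSubgroup (lowerCentral-isNormal (discrete U) p n)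
  private
    N : Carrier → Set ℓ
    N = lowerCentral (discrete U) p n

  -- z is additive and depends on a modulo p only, so z a is the power of z 1 whose exponent is the
  -- nonnegative residue of a.
  z1∈⇒z∈ : ∀ {u} → N u → u ≈ z 1ℤ → ∀ a → N (z a)
  z1∈⇒z∈ u∈ u≈z1 a = N-resp (z-cong (mod-sym (mod-residue p a))) (natural (toℕ (residue p a)))
    where
    natural : ∀ k → N (z (+ k))
    natural zero    = N-resp (sym (GroupProperties.identityˡ-unique U (z 0ℤ) (z 0ℤ) (sym (z-homo 0ℤ 0ℤ)))) N-ε
    natural (suc k) = N-resp (sym (z-homo 1ℤ (+ k))) (N-∙ (N-resp u≈z1 u∈) (natural k))

module _ (p n : ℕ) (0<p : 0 ℕ.< p) where
  private instance
    p≢0 : NonZero p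
    p≢0 = ℕ.>-nonZero 0<p

  module _ (s : ℕ) (0<s : 0 ℕ.< s) where
    open CentralSubgroup p n s 0<p 0<s
    open Group (Matrices.𝕌 (ℤ/ 𝕌-modulus p n s) (suc s))

    z∈lowerCentral-from : ∀ u → lowerCentral (discrete (Matrices.𝕌 (ℤ/ 𝕌-modulus p n s) (suc s))) p n u →
      Matrices._≈ᴹ_ (ℤ/ 𝕌-modulus p n s) (Matrices.toMatrix (ℤ/ 𝕌-modulus p n s) u)
        (Matrices.I+_E (ℤ/ 𝕌-modulus p n s)
          (RawMonoidOps._×_ (CommutativeRing.+-rawMonoid (ℤ/ 𝕌-modulus p n s)) (p ℕ.^ (n ∸ s)) 1ℤ)) →
      ∀ a → lowerCentral (discrete (Matrices.𝕌 (ℤ/ 𝕌-modulus p n s) (suc s))) p n (z a)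
    z∈lowerCentral-from u u∈ u≈I+cE = z1∈⇒z∈ {p = p} {U = Matrices.𝕌 (ℤ/ 𝕌-modulus p n s) (suc s)}
      z z-cong z-homo n {u} u∈ u≈z1
      where
      c = p ℕ.^ (n ∸ s)
      u≈z1 : u ≈ z 1ℤ
      u≈z1 i j = mod-trans (u≈I+cE i j) (Corner.I+E-cong (ℤ/ 𝕌-modulus p n s) {s}
        (≡⇒mod (≡.trans (×1≡ (𝕌-modulus p n s) c) (≡.sym (ℤₚ.*-identityˡ (+ c))))) i j)

  z∈lowerCentral : ∀ s (0<s : 0 ℕ.< s) → s ℕ.≤ n → ∀ a →
    lowerCentral (discrete (Matrices.𝕌 (ℤ/ 𝕌-modulus p n s) (suc s))) p n (CentralSubgroup.z p n s 0<p 0<s a)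
  z∈lowerCentral (suc s′) 0<s s≤n a = for-length (suc s′) 0<s (0 ∷ applyUpTo suc s′) (applyUpTo-isLyndon s′)
    (≡.cong suc (Listₚ.length-applyUpTo suc s′)) s≤n a
    where
    -- The length of `0 ∷ applyUpTo suc s′` does not compute to `suc s′`; generalizing over s allows
    -- the equation to be matched with `≡.refl`.
    for-length : ∀ s (0<s : 0 ℕ.< s) w → Words.IsLyndon ℕₚ.<-isStrictTotalOrder w → length w ≡ s → s ℕ.≤ n →
      ∀ a → lowerCentral (discrete (Matrices.𝕌 (ℤ/ 𝕌-modulus p n s) (suc s))) p n (CentralSubgroup.z p n s 0<p 0<s a)
    for-length _ 0<s w w-isLyndon ≡.refl s≤n = z∈lowerCentral-from (length w) 0<s
      (power (Matrices.𝕌 (ℤ/ 𝕌-modulus p n (length w)) (suc (length w)))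
        (Words.τ ℕₚ.<-isStrictTotalOrder (Matrices.𝕌 (ℤ/ 𝕌-modulus p n (length w)) (suc (length w))) generator w)
        (p ℕ.^ (n ∸ length w)))
      (StandardFactorization.τ-power∈lowerCentral ℕₚ.<-isStrictTotalOrder
        (discrete (Matrices.𝕌 (ℤ/ 𝕌-modulus p n (length w)) (suc (length w)))) generator p n w (proj₁ w-isLyndon) s≤n)
      (τ-power-matrix {{ℕ.>-nonZero 0<s}} w-isLyndon (p ℕ.^ (n ∸ length w)))
      where open LyndonMatrix ℕₚ.<-isStrictTotalOrder (ℤ/ 𝕌-modulus p n (length w)) w

-- The entries of the pairing matrix

module _ (p n s : ℕ) (0<p : 0 ℕ.< p) (0<s : 0 ℕ.< s) where
  open CentralSubgroup p n s 0<p 0<s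

  centralSubgroup-isCentralℤ/ : s ≤ n → IsCentralℤ/ p n (𝕌ₙ,ₛ p n s) (𝕌-kernel p n s) z t
  centralSubgroup-isCentralℤ/ s≤n = record
    { trivialNbhd    = tt
    ; near⇒≈         = λ u≈v → u≈v
    ; κ⇒≈            = λ u≈za → u≈za
    ; ≈⇒κ            = λ u≈za → u≈za
    ; z-cong         = z-cong
    ; z-homo         = z-homo
    ; z-central      = z-central
    ; z∈lowerCentral = z∈lowerCentral p n 0<p s 0<s s≤n
    ; lowerCentral⇒z = λ {u} → lowerCentral⇒z s≤n {u}
    ; t-cong         = λ {u} {v} → t-cong {u} {v}
    ; t-∙z           = t-∙z
    ; t-ε            = t-ε
    }

  module _ {ℓ} {S : TopGroup ℓ} (φ : ContinuousHom S (𝕌ₙ,ₛ p n s)) where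

    pairing-entry : s ≤ n → 2 ≤ n → ∀ σ σ∈ → The (H² (𝕌ₙ,ₛ p n s /lowerCentral[ n , p ]) p) (Isγ p n s)
      (λ γ → PairingIs S n p σ σ∈ (pullback (induced φ n p) γ) (t (ContinuousHom.⟦_⟧ φ σ)))
    pairing-entry s≤n 2≤n σ σ∈ = c , c-isClass , (λ γ γ-isClass → isClass-unique γ-isClass) , pairing φ 2≤n σ σ∈
      where open CentralExtension (centralSubgroup-isCentralℤ/ s≤n)

  t-corner : ∀ u a →
             Matrices.toMatrix (ℤ/ 𝕌-modulus p n s) u zero (fromℕ s) ≡ a ℤ.* + (p ℕ.^ (n ∸ s)) [mod 𝕌-modulus p n s ] →
             t u ≡ a [mod p ]
  t-corner u a corner≡ac = mod-trans
    (quotient-shift p c {{c≢0}} {Matrices.toMatrix (ℤ/ 𝕌-modulus p n s) u zero (fromℕ s)} {0ℤ} a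
      (mod-trans corner≡ac (≡⇒mod (≡.sym (ℤₚ.+-identityˡ (a ℤ.* + c))))))
    (mod-trans (mod-+-cong (≡⇒mod (0/c≡0 p c {{c≢0}})) (mod-refl {a = a})) (≡⇒mod (ℤₚ.+-identityˡ a)))
    where
    c = p ℕ.^ (n ∸ s)
    c≢0 : NonZero c
    c≢0 = ℕₚ.m^n≢0 p (n ∸ s) {{ℕ.>-nonZero 0<p}}

module _ {ℓ} {X : Set ℓ} {_<_ : Rel X ℓ} (<-isSTO : IsStrictTotalOrder _≡_ _<_)
         {a b} {G : TopGroup a} {H : TopGroup b} (φ : ContinuousHom G H) where
  open Words <-isSTO
  private
    module G = TopGroup G
    module H = TopGroup H
  open ContinuousHom φ

  τ-power-homo : ∀ {ι κ} → (∀ x → ⟦ ι x ⟧ H.≈ κ x) → ∀ m w →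
    ⟦ power G.group (τ G.group ι w) m ⟧ H.≈ power H.group (τ H.group κ w) m
  τ-power-homo ι∼κ m w = power-related {G = G.group} {H.group} (λ g h → ⟦ g ⟧ H.≈ h) ε-homo ∙-related ⁻¹-related m
    (bracketing-related {G = G.group} {H.group} (λ g h → ⟦ g ⟧ H.≈ h) ε-homo ∙-related ⁻¹-related ι∼κ (length w) w)
    where
    open StandardFactorization <-isSTO
    ∙-related : ∀ {g g′ h h′} → ⟦ g ⟧ H.≈ h → ⟦ g′ ⟧ H.≈ h′ → ⟦ g G.∙ g′ ⟧ H.≈ h H.∙ h′
    ∙-related g∼h g′∼h′ = H.trans (homo _ _) (H.∙-cong g∼h g′∼h′)
    ⁻¹-related : ∀ {g h} → ⟦ g ⟧ H.≈ h → ⟦ g G.⁻¹ ⟧ H.≈ h H.⁻¹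
    ⁻¹-related g∼h = H.trans (⁻¹-homo _) (H.⁻¹-cong g∼h)

module _ {ℓ} {X : Set ℓ} {_<_ : Rel X ℓ} (<-isSTO : IsStrictTotalOrder _≡_ _<_)
         (S : ProfiniteGroup ℓ) (ι : X → ProfiniteGroup.Carrier S) (S-free : IsFreeProfinite S ι) where
  open Words <-isSTO
  private module S = ProfiniteGroup S

  free-extension-τ-power : ∀ G φ (φ-converges : ConvergesToOne G φ) m w →
    let open ProfiniteGroup G; Φ = proj₁ (IsFreeProfinite.extend S-free G φ φ-converges)
    in ContinuousHom.⟦_⟧ Φ (power S.group (τ S.group ι w) m) ≈ power group (τ group φ w) m
  free-extension-τ-power G φ φ-converges m w =
    let Φ , Φ-ι , _ = IsFreeProfinite.extend S-free G φ φ-converges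
    in τ-power-homo <-isSTO Φ Φ-ι m w

module _ {ℓ} {p : ℕ} (p-prime : Prime p)
         {X : Set ℓ} {_<_ : Rel X ℓ} (<-isSTO : IsStrictTotalOrder _≡_ _<_)
         (S : ProfiniteGroup ℓ) (ι : X → ProfiniteGroup.Carrier S) (S-free : IsFreeProfinite S ι)
         (n : ℕ) where
  open Words <-isSTO hiding (Lyndon≤)
  open Pairing p-prime <-isSTO S ι S-free n using (ρ; τ-power)

  private
    0<p : 0 ℕ.< p
    0<p = ℕ.>-nonZero⁻¹ p {{prime⇒nonZero p-prime}}

    0<length : ∀ {w} → IsLyndon w → 0 ℕ.< length w
    0<length {[]}    (w≢[] , _) = ⊥-elim (w≢[] ≡.refl)
    0<length {_ ∷ _} _          = s≤s z≤n

  entry : Lyndon≤ <-isSTO n → Lyndon≤ <-isSTO n → ℤ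
  entry (w , _) (w′ , w′-isLyndon , _) =
    CentralSubgroup.t p n (length w′) 0<p (0<length w′-isLyndon) (ContinuousHom.⟦_⟧ (ρ w′) (τ-power w))

  entry-is : 2 ≤ n → ∀ w w′ → EntryIs p-prime <-isSTO S ι S-free n (proj₁ w) (proj₁ w′) (entry w w′)
  entry-is 2≤n (w , (w≢[] , _) , |w|≤n) (w′ , w′-isLyndon , |w′|≤n) =
    τ∈ , pairing-entry p n (length w′) 0<p (0<length w′-isLyndon) (ρ w′) |w′|≤n 2≤n (τ-power w) τ∈
    where
    τ∈ = StandardFactorization.τ-power∈lowerCentral <-isSTO (ProfiniteGroup.topGroup S) ι p n w w≢[] |w|≤n

  private
    module _ (w w′ : Word) where
      open PowerSeries X (ℤ/ 𝕌-modulus p n (length w′))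

      τ-power-series : Unit seriesMonoid
      τ-power-series = power (units seriesMonoid)
        (τ (units seriesMonoid) (1+-unit (IsStrictTotalOrder._≟_ <-isSTO)) w) (p ℕ.^ (n ∸ length w))

      corner≡τ-power-series :
        Matrices.toMatrix (ℤ/ 𝕌-modulus p n (length w′)) (ContinuousHom.⟦_⟧ (ρ w′) (τ-power w)) zero (fromℕ (length w′)) ≡
        val τ-power-series w′ [mod 𝕌-modulus p n (length w′) ]
      -- The other fields are left to unification: if they were given, Agda would have to
      -- compare two proofs of finiteness.
      corner≡τ-power-series = mod-trans
        (free-extension-τ-power <-isSTO S ι S-free
          record { topGroup = seriesUnits ; separated = _ ; finite = _ ; complete = _ }
          (1+-unit (IsStrictTotalOrder._≟_ <-isSTO)) _ (p ℕ.^ (n ∸ length w)) w (take (toℕ (fromℕ (length w′))) w′))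
        -- The corner entry unfolds to the coefficient at a prefix of w′, which is all of w′.
        (≡⇒mod (≡.cong (val τ-power-series)
          (≡.trans (≡.cong (λ k → take k w′) (Finₚ.toℕ-fromℕ (length w′))) (Listₚ.take-all (length w′) w′ ℕₚ.≤-refl))))

  entry-upperTriangularUnipotent : IsUpperTriangularUnipotent p-prime <-isSTO S ι S-free n entry
  entry-upperTriangularUnipotent = diagonal , below
    where
    diagonal : ∀ w w′ → proj₁ w ≡ proj₁ w′ → entry w w′ ≡ 1ℤ [mod p ]
    diagonal (w , w-isLyndon , _) (.w , w′-isLyndon , _) ≡.refl =
      t-corner p n (length w) 0<p (0<length w′-isLyndon) (ContinuousHom.⟦_⟧ (ρ w) (τ-power w)) 1ℤ
        (mod-trans (corner≡τ-power-series w w)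
          (mod-trans (Leading.leading (τ-power-leading w-isLyndon c))
            (≡⇒mod (≡.trans (×1≡ (𝕌-modulus p n (length w)) c) (≡.sym (ℤₚ.*-identityˡ (+ c)))))))
      where
      open LeadingWords <-isSTO (ℤ/ 𝕌-modulus p n (length w))
      c = p ℕ.^ (n ∸ length w)
    below : ∀ w w′ → proj₁ w′ ≺ proj₁ w → entry w w′ ≡ 0ℤ [mod p ]
    below (w , w-isLyndon , _) (w′ , w′-isLyndon , _) w′≺w =
      t-corner p n (length w′) 0<p (0<length w′-isLyndon) (ContinuousHom.⟦_⟧ (ρ w′) (τ-power w)) 0ℤ
        (mod-trans (corner≡τ-power-series w w′)
          (mod-trans (Leading.small (τ-power-leading w-isLyndon (p ℕ.^ (n ∸ length w))) w′ (proj₁ w′-isLyndon) (≺⇒⊰ w′≺w))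
            (≡⇒mod (≡.sym (ℤₚ.*-zeroˡ (+ (p ℕ.^ (n ∸ length w′))))))))
      where open LeadingWords <-isSTO (ℤ/ 𝕌-modulus p n (length w′))

corollary8p3 : ∀ {ℓ} {p : ℕ} (p-prime : Prime p)
    {X : Set ℓ} {_<_ : Rel X ℓ} (<-isSTO : IsStrictTotalOrder _≡_ _<_) (x₀ : X)
    (S : ProfiniteGroup ℓ) (ι : X → ProfiniteGroup.Carrier S) (S-free : IsFreeProfinite S ι)
    (n : ℕ) → 2 ≤ n →
    ∃[ M ] (∀ (w w′ : Lyndon≤ <-isSTO n) →
    EntryIs p-prime <-isSTO S ι S-free n (proj₁ w) (proj₁ w′) (M w w′)) ×
    IsUpperTriangularUnipotent p-prime <-isSTO S ι S-free n M
corollary8p3 p-prime <-isSTO _ S ι S-free n 2≤n =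
  entry p-prime <-isSTO S ι S-free n ,
  entry-is p-prime <-isSTO S ι S-free n 2≤n ,
  entry-upperTriangularUnipotent p-prime <-isSTO S ι S-free n
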